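{- There are constants $C,C',C''>0$ such that for every sufficiently large $n$ there is a triangle-free graph on $n$ vertices with all degrees between $C'n^{1/3}$ and $C''n^{1/3}$ that contains no semi-bipartite induced subgraph of average degree (with respect to its semi-bipartition) at least $C\log n$.
   Context: $\log$ is the natural logarithm. Given a graph $G$, an induced subgraph $G'$ of $G$ with vertex set $V'$ is semi-bipartite if it admits a partition $V'=V_1\cup V_2$ such that $V_1$ is a stable set of $G$; its average degree with respect to this semi-bipartition is the average degree of the bipartite graph on $V_1\cup V_2$ formed by the edges of $G$ between $V_1$ and $V_2$ (edges inside $V_2$ are ignored). A semi-bipartite induced subgraph of average degree at least $x$ means one admitting some semi-bipartition with respect to which its average degree is at least $x$. -}

module Defs where

open import Data.Bool using (Bool; true; false; if_then_else_)
open import Data.Nat using (ℕ; zero; suc)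
import Data.Nat as ℕ
open import Data.Fin using (Fin)
open import Data.List using (List; map; allFin)
open import Data.Nat.ListAction using (sum)
open import Data.Integer using (+_)
open import Data.Rational using (ℚ; 0ℚ; 1ℚ; _+_; _*_; _/_; _≤_; _>_; 1/_; positive)
open import Data.Rational.Properties using (pos⇒nonZero)
open import Data.Product using (∃; _×_)
open import Data.Empty using (⊥)
open import Relation.Binary.PropositionalEquality using (_≡_)

record Graph (n : ℕ) : Set where
  field
    adj   : Fin n → Fin n → Bool
    sym   : ∀ u v → adj u v ≡ adj v u
    irrefl : ∀ v → adj v v ≡ false
open Graph public

b2n : Bool → ℕ
b2n true  = 1
b2n false = 0

countFin : (n : ℕ) → (Fin n → Bool) → ℕ
countFin n P = sum (map (λ u → b2n (P u)) (allFin n))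

degree : ∀ {n} → Graph n → Fin n → ℕ
degree {n} G v = countFin n (adj G v)

TriangleFree : ∀ {n} → Graph n → Set
TriangleFree G = ∀ u v w → adj G u v ≡ true → adj G v w ≡ true → adj G u w ≡ true → ⊥

-- Semi-bipartite induced subgraphs: a vertex is either outside V',
-- in V₁ or in V₂ (V₁, V₂ disjoint by construction).

data Part : Set where
  out one two : Part

isOne : Part → Bool
isOne one = true
isOne _   = false

isTwo : Part → Bool
isTwo two = true
isTwo _   = false

inV' : Part → Bool
inV' out = false
inV' _   = true

_∧_ : Bool → Bool → Bool
true ∧ b = b
false ∧ _ = false

Stable₁ : ∀ {n} → Graph n → (Fin n → Part) → Set
Stable₁ G f = ∀ u v → adj G u v ≡ true → f u ≡ one → f v ≡ one → ⊥

size : ∀ {n} → (Fin n → Part) → ℕ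
size {n} f = countFin n (λ v → inV' (f v))

crossEdges : ∀ {n} → Graph n → (Fin n → Part) → ℕ
crossEdges {n} G f =
  sum (map (λ u → countFin n (λ v → isOne (f u) ∧ (isTwo (f v) ∧ adj G u v))) (allFin n))

-- average degree of the bipartite graph (V₁ ∪ V₂, E(V₁,V₂)) : 2e/|V'|
-- (only used when |V'| = suc m ≥ 1)
avgDeg : (e m : ℕ) → ℚ
avgDeg e m = (+ (2 ℕ.* e)) / suc m

ℕtoℚ : ℕ → ℚ
ℕtoℚ k = (+ k) / 1

expTerm : ℚ → ℕ → ℚ
expTerm x zero    = 1ℚ
expTerm x (suc k) = expTerm x k * (x * ((+ 1) / suc k))

expPartial : ℚ → ℕ → ℚ
expPartial x zero    = 0ℚ
expPartial x (suc k) = expPartial x k + expTerm x k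

divPos : (a C : ℚ) → C > 0ℚ → ℚ
divPos a C p = a * (1/ C) {{pos⇒nonZero C {{positive p}}}}

-- "a ≥ C · log n" (natural log, C > 0, a ≥ 0), i.e. exp(a/C) ≥ n, i.e.
-- the partial sums of the exponential series of a/C come arbitrarily
-- close to (or exceed) n.
GeCLog : (C : ℚ) → C > 0ℚ → (a : ℚ) → (n : ℕ) → Set
GeCLog C p a n = ∀ (ε : ℚ) → ε > 0ℚ → ∃ λ k → ℕtoℚ n ≤ expPartial (divPos a C p) k + ε

HasDenseSemiBip : ∀ {n} → Graph n → (C : ℚ) → C > 0ℚ → Set
HasDenseSemiBip {n} G C p =
  ∃ λ (f : Fin n → Part) → ∃ λ m →
    Stable₁ G f × size f ≡ suc m × GeCLog C p (avgDeg (crossEdges G f) m) n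

-- C' n^{1/3} ≤ d   ⇔  C'^3 · n ≤ d^3   (for C' > 0)
cube : ℚ → ℚ
cube x = x * x * x

LowerCubeRoot : ℚ → ℕ → ℕ → Set
LowerCubeRoot C' n d = cube C' * ℕtoℚ n ≤ cube (ℕtoℚ d)

UpperCubeRoot : ℚ → ℕ → ℕ → Set
UpperCubeRoot C'' n d = cube (ℕtoℚ d) ≤ cube C'' * ℕtoℚ n

{-# OPTIONS --safe #-}

-- Let p be a prime of the order of n^{1/3}.  In F_p³ consider the p³ lines with directions (1, y, y²).
-- Any three of these directions are independent, so two points lie on at most one line and no three
-- lines form a triangle.  The rank of a point u on its line with direction y is u₀ + y mod p.  For each
-- of its lines, u picks a random number below max(rank, p/2) and, if this is the rank of a lower point
-- of the line, is joined to that point.  A triangle would have to lie on a single line, where its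
-- highest vertex picked only one neighbour; so the graph is triangle-free.  Every point has rank at
-- least p/2 on half of its lines, so all degrees are at least about p/2.
--
-- Since a point off a line is collinear with at most one point of it, a second moment computation
-- shows that A and B span at most (|A| + p²)(|A| + |B|)/p collinear pairs, while S spans about |S|²/p
-- of them.  A collinear pair is an edge with probability between 1/p and 2/p, and exponential moments
-- factor over the independent picks.  Union bounds then show that stable sets have O(p² log p) points
-- and that e(A, B) = O(log p)(|A| + |B|) whenever A is that small.  Since some prime lies in (x, 11x]
-- for every large x, copying each vertex a bounded number of times reaches every large n.
module Submission where

open import Defs renaming (sym to adj-sym)
open import Data.Rational using (ℚ; 0ℚ; _>_)
import Data.Integer as ℤ
open import Relation.Binary.PropositionalEquality

-- Partial sums of the exponential series

-- In the base graph, stability of V₁ enters only through its size. The pair count bounds the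
-- expected number of edges between A and B by a multiple of (|A| + p²)(|A| + |B|)/p², which is
-- logarithmic in average degree once |A| is O(p² log p), and stable sets obey that bound. One pick
-- per point and line, instead of independent edges with deletions, makes triangle-freeness and the
-- lower degree bound hold for every outcome; only stable sets, cross edges and upper degrees need
-- chance. Probabilities are never divided out: outcomes are counted in ℕ and compared with their
-- total number, and fractional powers are removed by raising to a common exponent. Logarithms are
-- exponents of two, and the bound exp(J/2) ≤ 2^J for partial sums translates the series in `GeCLog`
-- into powers of two. Copies of one vertex are never adjacent, so a blow-up keeps
-- triangle-freeness, and a semi-bipartite subgraph of it projects to one of the base graph at the
-- cost of a constant factor in the average degree.

module Exponential where
  open import Data.Integer using (+_)
  import Data.Integer.Properties as ℤP
  import Data.Integer.Tactic.RingSolver as ℤ-Solver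
  open import Data.Nat as ℕ using (ℕ; zero; suc; z≤n)
  import Data.Nat.Properties as ℕP
  open import Data.Rational using (1ℚ; ½; _+_; _*_; _/_; _≤_; toℚᵘ; nonNegative)
  open import Data.Rational.Properties
  open import Data.Rational.Solver using (module +-*-Solver)
  import Data.Rational.Unnormalised as ℚᵘ
  import Data.Rational.Unnormalised.Properties as ℚᵘP
  open +-*-Solver using (solve; _:+_; _:*_; _:=_; con)

  private
    mk : ℕ → ℕ → ℚᵘ.ℚᵘ
    mk a d = ℚᵘ.mkℚᵘ (+ a) d

  fraction-≤ : ∀ a d b e → a ℕ.* suc e ℕ.≤ b ℕ.* suc d → (+ a) / suc d ≤ (+ b) / suc e
  fraction-≤ a d b e le = toℚᵘ-cancel-≤ (ℚᵘP.≤-respˡ-≃ (ℚᵘP.≃-sym (toℚᵘ-fromℚᵘ (mk a d)))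
    (ℚᵘP.≤-respʳ-≃ (ℚᵘP.≃-sym (toℚᵘ-fromℚᵘ (mk b e)))
      (ℚᵘ.*≤* (subst₂ ℤ._≤_ (ℤP.pos-* a (suc e)) (ℤP.pos-* b (suc d)) (ℤ.+≤+ le)))))

  fraction-≤⁻¹ : ∀ a d b e → (+ a) / suc d ≤ (+ b) / suc e → a ℕ.* suc e ℕ.≤ b ℕ.* suc d
  fraction-≤⁻¹ a d b e le with ℚᵘP.≤-respˡ-≃ (toℚᵘ-fromℚᵘ (mk a d)) (ℚᵘP.≤-respʳ-≃ (toℚᵘ-fromℚᵘ (mk b e)) (toℚᵘ-mono-≤ le))
  ... | ℚᵘ.*≤* q = ℤ.drop‿+≤+ (subst₂ ℤ._≤_ (sym (ℤP.pos-* a (suc e))) (sym (ℤP.pos-* b (suc d))) q)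

  ℕtoℚ-mono : ∀ {a b} → a ℕ.≤ b → ℕtoℚ a ≤ ℕtoℚ b
  ℕtoℚ-mono {a} {b} le = fraction-≤ a 0 b 0 (ℕP.*-monoˡ-≤ 1 le)

  ℕtoℚ-cancel : ∀ {a b} → ℕtoℚ a ≤ ℕtoℚ b → a ℕ.≤ b
  ℕtoℚ-cancel {a} {b} le = ℕP.*-cancelʳ-≤ a b 1 (fraction-≤⁻¹ a 0 b 0 le)

  ℕtoℚ-+ : ∀ a b → ℕtoℚ (a ℕ.+ b) ≡ ℕtoℚ a + ℕtoℚ b
  ℕtoℚ-+ a b = toℚᵘ-injective (begin
    toℚᵘ (ℕtoℚ (a ℕ.+ b))               ≈⟨ toℚᵘ-fromℚᵘ (mk (a ℕ.+ b) 0) ⟩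
    mk (a ℕ.+ b) 0                      ≈⟨ ℚᵘ.*≡* (identity (+ a) (+ b)) ⟩
    mk a 0 ℚᵘ.+ mk b 0                  ≈⟨ ℚᵘP.+-cong (ℚᵘP.≃-sym (toℚᵘ-fromℚᵘ (mk a 0))) (ℚᵘP.≃-sym (toℚᵘ-fromℚᵘ (mk b 0))) ⟩
    toℚᵘ (ℕtoℚ a) ℚᵘ.+ toℚᵘ (ℕtoℚ b)    ≈⟨ ℚᵘP.≃-sym (toℚᵘ-homo-+ (ℕtoℚ a) (ℕtoℚ b)) ⟩
    toℚᵘ (ℕtoℚ a + ℕtoℚ b)              ∎)
    where
    open ℚᵘP.≃-Reasoning
    identity : ∀ a b → (a ℤ.+ b) ℤ.* + 1 ≡ (a ℤ.* + 1 ℤ.+ b ℤ.* + 1) ℤ.* + 1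
    identity = ℤ-Solver.solve-∀

  fraction-* : ∀ a d b e → (+ a) / suc d * ((+ b) / suc e) ≡ (+ (a ℕ.* b)) / (suc d ℕ.* suc e)
  fraction-* a d b e = toℚᵘ-injective (begin
    toℚᵘ ((+ a) / suc d * ((+ b) / suc e))                ≈⟨ toℚᵘ-homo-* ((+ a) / suc d) ((+ b) / suc e) ⟩
    toℚᵘ ((+ a) / suc d) ℚᵘ.* toℚᵘ ((+ b) / suc e)        ≈⟨ ℚᵘP.*-cong (toℚᵘ-fromℚᵘ (mk a d)) (toℚᵘ-fromℚᵘ (mk b e)) ⟩
    mk a d ℚᵘ.* mk b e                                    ≈⟨ ℚᵘP.≃-reflexive (cong (λ z → ℚᵘ.mkℚᵘ z (e ℕ.+ d ℕ.* suc e)) (sym (ℤP.pos-* a b))) ⟩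
    mk (a ℕ.* b) (e ℕ.+ d ℕ.* suc e)                      ≈⟨ ℚᵘP.≃-sym (toℚᵘ-fromℚᵘ (mk (a ℕ.* b) (e ℕ.+ d ℕ.* suc e))) ⟩
    toℚᵘ ((+ (a ℕ.* b)) / (suc d ℕ.* suc e))              ∎)
    where open ℚᵘP.≃-Reasoning

  ℕtoℚ-* : ∀ a b → ℕtoℚ (a ℕ.* b) ≡ ℕtoℚ a * ℕtoℚ b
  ℕtoℚ-* a b = sym (fraction-* a 0 b 0)

  recip : ℕ → ℚ
  recip k = (+ 1) / suc k

  recip-inverse : ∀ k → ℕtoℚ (suc k) * recip k ≡ 1ℚ
  recip-inverse k = trans (fraction-* (suc k) 0 1 k) (≤-antisym
    (fraction-≤ (suc k ℕ.* 1) (k ℕ.+ 0) 1 0 (ℕP.≤-reflexive lemma))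
    (fraction-≤ 1 0 (suc k ℕ.* 1) (k ℕ.+ 0) (ℕP.≤-reflexive (sym lemma))))
    where
    lemma : suc k ℕ.* 1 ℕ.* 1 ≡ 1 ℕ.* suc (k ℕ.+ 0)
    lemma = cong suc (trans (trans (ℕP.*-identityʳ (k ℕ.* 1)) (ℕP.*-identityʳ k)) (trans (sym (ℕP.+-identityʳ k)) (sym (ℕP.+-identityʳ (k ℕ.+ 0)))))

  0≤recip : ∀ k → 0ℚ ≤ recip k
  0≤recip k = fraction-≤ 0 0 1 k z≤n

  *-nonneg : ∀ {a b} → 0ℚ ≤ a → 0ℚ ≤ b → 0ℚ ≤ a * b
  *-nonneg {a} {b} 0≤a 0≤b = subst (_≤ a * b) (*-zeroʳ a) (*-monoˡ-≤-nonNeg a {{nonNegative 0≤a}} 0≤b)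

  *-mono-nonneg : ∀ {a b c d} → 0ℚ ≤ b → 0ℚ ≤ c → a ≤ b → c ≤ d → a * c ≤ b * d
  *-mono-nonneg {a} {b} {c} {d} 0≤b 0≤c a≤b c≤d = ≤-trans (*-monoʳ-≤-nonNeg c {{nonNegative 0≤c}} a≤b) (*-monoˡ-≤-nonNeg b {{nonNegative 0≤b}} c≤d)

  expTerm-nonneg : ∀ {x} → 0ℚ ≤ x → ∀ k → 0ℚ ≤ expTerm x k
  expTerm-nonneg 0≤x zero    = fraction-≤ 0 0 1 0 z≤n
  expTerm-nonneg 0≤x (suc k) = *-nonneg (expTerm-nonneg 0≤x k) (*-nonneg 0≤x (0≤recip k))

  expTerm-mono : ∀ {x y} → 0ℚ ≤ x → x ≤ y → ∀ k → expTerm x k ≤ expTerm y k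
  expTerm-mono 0≤x x≤y zero    = ≤-refl
  expTerm-mono {x} {y} 0≤x x≤y (suc k) = *-mono-nonneg (expTerm-nonneg (≤-trans 0≤x x≤y) k) (*-nonneg 0≤x (0≤recip k))
    (expTerm-mono 0≤x x≤y k) (*-monoʳ-≤-nonNeg (recip k) {{nonNegative (0≤recip k)}} x≤y)

  expPartial-mono : ∀ {x y} → 0ℚ ≤ x → x ≤ y → ∀ k → expPartial x k ≤ expPartial y k
  expPartial-mono 0≤x x≤y zero    = ≤-refl
  expPartial-mono 0≤x x≤y (suc k) = +-mono-≤ (expPartial-mono 0≤x x≤y k) (expTerm-mono 0≤x x≤y k)

  -- The mean value inequality zⁿ⁺¹ − xⁿ⁺¹ ≤ (n+1)(z − x)zⁿ, divided by (n+1)!.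
  expTerm-step : ∀ x h → 0ℚ ≤ x → 0ℚ ≤ h → ∀ k → expTerm (x + h) (suc k) ≤ expTerm x (suc k) + h * expTerm (x + h) k
  expTerm-step x h 0≤x 0≤h zero = ≤-reflexive (solve 2 (λ x h → con 1ℚ :* ((x :+ h) :* con 1ℚ) := con 1ℚ :* (x :* con 1ℚ) :+ h :* con 1ℚ) refl x h)
  expTerm-step x h 0≤x 0≤h (suc k) = begin
    T * (z * c)                                             ≡⟨ solve 4 (λ T x h c → T :* ((x :+ h) :* c) := c :* (x :* T :+ h :* T)) refl T x h c ⟩
    c * (x * T + h * T)                                     ≤⟨ mono-c (+-monoˡ-≤ (h * T) (≤-trans step₁ step₂)) ⟩
    c * (x * S + h * (z * U) + h * T)                       ≡⟨ cong (λ w → c * (x * S + h * w + h * T)) zU ⟩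
    c * (x * S + h * (ℕtoℚ (suc k) * T) + h * T)            ≡⟨ solve 6 (λ c x S h n T → c :* (x :* S :+ h :* (n :* T) :+ h :* T) := S :* (x :* c) :+ h :* (T :* ((n :+ con 1ℚ) :* c))) refl c x S h (ℕtoℚ (suc k)) T ⟩
    S * (x * c) + h * (T * ((ℕtoℚ (suc k) + 1ℚ) * c))       ≡⟨ cong (λ w → S * (x * c) + h * (T * w)) nc ⟩
    S * (x * c) + h * (T * 1ℚ)                              ≡⟨ cong (λ w → S * (x * c) + h * w) (*-identityʳ T) ⟩
    S * (x * c) + h * T                                     ∎
    where
    open ≤-Reasoning
    z = x + h
    T = expTerm z (suc k)
    S = expTerm x (suc k)
    U = expTerm z k
    c = recip (suc k)
    0≤z : 0ℚ ≤ z
    0≤z = +-mono-≤ 0≤x 0≤h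
    0≤U : 0ℚ ≤ U
    0≤U = expTerm-nonneg 0≤z k
    mono-c : ∀ {a b} → a ≤ b → c * a ≤ c * b
    mono-c = *-monoˡ-≤-nonNeg c {{nonNegative (0≤recip (suc k))}}
    step₁ : x * T ≤ x * (S + h * U)
    step₁ = *-monoˡ-≤-nonNeg x {{nonNegative 0≤x}} (expTerm-step x h 0≤x 0≤h k)
    step₂ : x * (S + h * U) ≤ x * S + h * (z * U)
    step₂ = begin
      x * (S + h * U)              ≡⟨ solve 4 (λ x S h U → x :* (S :+ h :* U) := x :* S :+ h :* (x :* U) :+ con 0ℚ) refl x S h U ⟩
      x * S + h * (x * U) + 0ℚ     ≤⟨ +-monoʳ-≤ (x * S + h * (x * U)) (*-nonneg 0≤h (*-nonneg 0≤h 0≤U)) ⟩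
      x * S + h * (x * U) + h * (h * U)  ≡⟨ solve 4 (λ x S h U → x :* S :+ h :* (x :* U) :+ h :* (h :* U) := x :* S :+ h :* ((x :+ h) :* U)) refl x S h U ⟩
      x * S + h * (z * U)          ∎
    zU : z * U ≡ ℕtoℚ (suc k) * T
    zU = trans (sym (*-identityʳ (z * U))) (trans (cong (z * U *_) (sym (recip-inverse k)))
      (solve 4 (λ z U n c → z :* U :* (n :* c) := n :* (U :* (z :* c))) refl z U (ℕtoℚ (suc k)) (recip k)))
    nc : (ℕtoℚ (suc k) + 1ℚ) * c ≡ 1ℚ
    nc = trans (cong (_* c) (trans (sym (ℕtoℚ-+ (suc k) 1)) (cong ℕtoℚ (ℕP.+-comm (suc k) 1)))) (recip-inverse (suc k))

  expPartial-step : ∀ x h → 0ℚ ≤ x → 0ℚ ≤ h → ∀ k → expPartial (x + h) (suc k) ≤ expPartial x (suc k) + h * expPartial (x + h) k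
  expPartial-step x h 0≤x 0≤h zero    = ≤-reflexive (solve 1 (λ h → con 0ℚ :+ con 1ℚ := con 0ℚ :+ con 1ℚ :+ h :* con 0ℚ) refl h)
  expPartial-step x h 0≤x 0≤h (suc k) = ≤-trans (+-mono-≤ (expPartial-step x h 0≤x 0≤h k) (expTerm-step x h 0≤x 0≤h k))
    (≤-reflexive (solve 5 (λ E h F S T → E :+ h :* F :+ (S :+ h :* T) := E :+ S :+ h :* (F :+ T)) refl
      (expPartial x (suc k)) h (expPartial (x + h) k) (expTerm x (suc k)) (expTerm (x + h) k)))

  0≤½ : 0ℚ ≤ ½
  0≤½ = fraction-≤ 0 0 1 1 z≤n

  -- The finite form of e^(1/2) ≤ 2. With `h = ½` in `expPartial-step`, the sum F at `x + ½` and the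
  -- sum E at `x` satisfy F ≤ E + F/2, hence F ≤ 2E.
  expPartial-half-step : ∀ x → 0ℚ ≤ x → ∀ k → expPartial (x + ½) k ≤ ℕtoℚ 2 * expPartial x k
  expPartial-half-step x 0≤x zero    = ≤-reflexive (sym (*-zeroʳ (ℕtoℚ 2)))
  expPartial-half-step x 0≤x (suc k) = begin
    F                                  ≡⟨ solve 1 (λ F → F := con (ℕtoℚ 2) :* (F :+ con (ℤ.- + 1 / 2) :* F)) refl F ⟩
    ℕtoℚ 2 * (F + ℤ.- + 1 / 2 * F)     ≤⟨ *-monoˡ-≤-nonNeg (ℕtoℚ 2) (+-monoˡ-≤ (ℤ.- + 1 / 2 * F) (≤-trans (expPartial-step x ½ 0≤x 0≤½ k) (+-monoʳ-≤ E (*-monoˡ-≤-nonNeg ½ F′≤F)))) ⟩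
    ℕtoℚ 2 * (E + ½ * F + ℤ.- + 1 / 2 * F) ≡⟨ solve 2 (λ E F → con (ℕtoℚ 2) :* (E :+ con ½ :* F :+ con (ℤ.- + 1 / 2) :* F) := con (ℕtoℚ 2) :* E) refl E F ⟩
    ℕtoℚ 2 * E                         ∎
    where
    open ≤-Reasoning
    E = expPartial x (suc k)
    F = expPartial (x + ½) (suc k)
    F′≤F : expPartial (x + ½) k ≤ F
    F′≤F = subst (_≤ F) (+-identityʳ (expPartial (x + ½) k)) (+-monoʳ-≤ (expPartial (x + ½) k) (expTerm-nonneg (+-mono-≤ 0≤x 0≤½) k))

  -- The number J/2, built by repeated addition so that each summand is one use of
  -- `expPartial-half-step`.
  halves : ℕ → ℚ
  halves zero    = 0ℚ
  halves (suc J) = halves J + ½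

  0≤halves : ∀ J → 0ℚ ≤ halves J
  0≤halves zero    = ≤-refl
  0≤halves (suc J) = +-mono-≤ (0≤halves J) 0≤½

  halves-double : ∀ J → halves J * ℕtoℚ 2 ≡ ℕtoℚ J
  halves-double zero    = refl
  halves-double (suc J) = trans (solve 1 (λ x → (x :+ con ½) :* con (ℕtoℚ 2) := con 1ℚ :+ x :* con (ℕtoℚ 2)) refl (halves J))
    (trans (cong (λ w → 1ℚ + w) (halves-double J)) (sym (ℕtoℚ-+ 1 J)))

  expPartial-0≤1 : ∀ k → expPartial 0ℚ k ≤ 1ℚ
  expPartial-0≤1 zero    = fraction-≤ 0 0 1 0 z≤n
  expPartial-0≤1 (suc zero) = ≤-refl
  expPartial-0≤1 (suc (suc k)) = ≤-trans (≤-reflexive (trans (cong (λ w → expPartial 0ℚ (suc k) + w)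
    (solve 2 (λ t c → t :* (con 0ℚ :* c) := con 0ℚ) refl (expTerm 0ℚ k) (recip k))) (+-identityʳ _))) (expPartial-0≤1 (suc k))

  expPartial-halves : ∀ J k → expPartial (halves J) k ≤ ℕtoℚ (2 ℕ.^ J)
  expPartial-halves zero    k = expPartial-0≤1 k
  expPartial-halves (suc J) k = ≤-trans (expPartial-half-step (halves J) (0≤halves J) k)
    (≤-trans (*-monoˡ-≤-nonNeg (ℕtoℚ 2) (expPartial-halves J k)) (≤-reflexive (sym (ℕtoℚ-* 2 (2 ℕ.^ J)))))

open Exponential

import Algebra.Properties.Group as GroupProperties
import Algebra.Solver.Ring.NaturalCoefficients.Default as SemiringSolver
open import Algebra.Bundles using (CommutativeRing)
open import Algebra.Structures using (IsCommutativeRing)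
open import Data.Bool using (Bool; true; false; if_then_else_)
import Data.Bool.Properties as Bool
open import Data.Empty using (⊥; ⊥-elim)
open import Data.Fin using (Fin; zero; suc; toℕ; fromℕ<; combine; remQuot; _↑ˡ_; _↑ʳ_)
import Data.Fin.Properties as Fin
open import Data.List using (map; allFin; tabulate)
open import Data.List.Properties using (map-tabulate)
open import Data.Nat hiding (_>_)
open import Data.Nat.Divisibility
open import Data.Nat.DivMod
open import Data.Nat.ListAction using (sum)
open import Data.Nat.Primality
open import Data.Nat.Properties
open import Data.Nat.Tactic.RingSolver using (solve-∀)
open import Data.Product using (∃; ∃₂; Σ; _×_; _,_; proj₁; proj₂)
import Data.Rational as ℚ
import Data.Rational.Properties as ℚP
open import Data.Rational.Solver using (module +-*-Solver)
open import Data.Sum as Sum using (_⊎_; inj₁; inj₂)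
open import Function using (_∘_; id; const)
open import Level using (Level; 0ℓ)
open import Relation.Binary.Definitions using (tri<; tri≈; tri>)
open import Relation.Nullary using (Dec; yes; no; ¬_; does; contradiction)
open import Relation.Nullary.Decidable using (_×-dec_; _⊎-dec_; dec-true; dec-false)

-- Finite sums and products

module Sums where

  private variable
    n m : ℕ

  -- Opaque, so that unification may treat ∑ as injective.
  opaque
    ∑ : (Fin n → ℕ) → ℕ
    ∑ {zero}  f = 0
    ∑ {suc n} f = f zero + ∑ (f ∘ suc)

    ∑-suc : (f : Fin (suc n) → ℕ) → ∑ f ≡ f zero + ∑ (f ∘ suc)
    ∑-suc f = refl

  ∏ : (Fin n → ℕ) → ℕ
  ∏ {zero}  f = 1
  ∏ {suc n} f = f zero * ∏ (f ∘ suc)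

  opaque
    unfolding ∑

    sum-allFin : (f : Fin n → ℕ) → sum (map f (allFin n)) ≡ ∑ f
    sum-allFin {n} f = trans (cong sum (map-tabulate id f)) (go f)
      where
      go : ∀ {m} (g : Fin m → ℕ) → sum (tabulate g) ≡ ∑ g
      go {zero}  g = refl
      go {suc m} g = cong (g zero +_) (go (g ∘ suc))

    ∑-cong : {f g : Fin n → ℕ} → (∀ i → f i ≡ g i) → ∑ f ≡ ∑ g
    ∑-cong {zero}  e = refl
    ∑-cong {suc n} e = cong₂ _+_ (e zero) (∑-cong (e ∘ suc))

    ∑-mono : {f g : Fin n → ℕ} → (∀ i → f i ≤ g i) → ∑ f ≤ ∑ g
    ∑-mono {zero}  e = z≤n
    ∑-mono {suc n} e = +-mono-≤ (e zero) (∑-mono (e ∘ suc))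

    ∑-+ : (f g : Fin n → ℕ) → ∑ (λ i → f i + g i) ≡ ∑ f + ∑ g
    ∑-+ {zero}  f g = refl
    ∑-+ {suc n} f g = begin
      f zero + g zero + ∑ (λ i → f (suc i) + g (suc i))        ≡⟨ cong (f zero + g zero +_) (∑-+ (f ∘ suc) (g ∘ suc)) ⟩
      f zero + g zero + (∑ (f ∘ suc) + ∑ (g ∘ suc))            ≡⟨ arith (f zero) (g zero) _ _ ⟩
      f zero + ∑ (f ∘ suc) + (g zero + ∑ (g ∘ suc))            ∎
      where
      open ≡-Reasoning
      arith : ∀ a b c d → a + b + (c + d) ≡ a + c + (b + d)
      arith = solve-∀

    ∑-*ˡ : (c : ℕ) (f : Fin n → ℕ) → ∑ (λ i → c * f i) ≡ c * ∑ f
    ∑-*ˡ {zero}  c f = sym (*-zeroʳ c)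
    ∑-*ˡ {suc n} c f = trans (cong (c * f zero +_) (∑-*ˡ c (f ∘ suc))) (sym (*-distribˡ-+ c (f zero) _))

  ∑-*ʳ : (f : Fin n → ℕ) (c : ℕ) → ∑ (λ i → f i * c) ≡ ∑ f * c
  ∑-*ʳ f c = trans (∑-cong (λ i → *-comm (f i) c)) (trans (∑-*ˡ c f) (*-comm c _))

  opaque
    unfolding ∑

    ∑-const : ∀ n c → ∑ {n} (const c) ≡ n * c
    ∑-const zero    c = refl
    ∑-const (suc n) c = cong (c +_) (∑-const n c)

    ∑-swap : (f : Fin m → Fin n → ℕ) → ∑ (λ i → ∑ (λ j → f i j)) ≡ ∑ (λ j → ∑ (λ i → f i j))
    ∑-swap {zero} {n} f = sym (trans (∑-const n 0) (*-zeroʳ n))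
    ∑-swap {suc m}    f = trans (cong (∑ (f zero) +_) (∑-swap (f ∘ suc))) (sym (∑-+ (f zero) _))

    term≤∑ : (f : Fin n → ℕ) (i : Fin n) → f i ≤ ∑ f
    term≤∑ f zero    = m≤m+n _ _
    term≤∑ f (suc i) = ≤-trans (term≤∑ (f ∘ suc) i) (m≤n+m _ (f zero))

    ∑-↑ : ∀ m (f : Fin (m + n) → ℕ) → ∑ f ≡ ∑ (λ i → f (i ↑ˡ n)) + ∑ (λ j → f (m ↑ʳ j))
    ∑-↑ zero    f = refl
    ∑-↑ (suc m) f = trans (cong (f zero +_) (∑-↑ m (f ∘ suc))) (sym (+-assoc (f zero) _ _))

    ∑-combine : ∀ m {n} (f : Fin (m * n) → ℕ) → ∑ f ≡ ∑ {m} (λ i → ∑ {n} (λ j → f (combine i j)))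
    ∑-combine zero        f = refl
    ∑-combine (suc m) {n} f = trans (∑-↑ n f) (cong (∑ (λ i → f (i ↑ˡ (m * n))) +_) (∑-combine m (f ∘ (n ↑ʳ_))))

  ∏-cong : {f g : Fin n → ℕ} → (∀ i → f i ≡ g i) → ∏ f ≡ ∏ g
  ∏-cong {zero}  e = refl
  ∏-cong {suc n} e = cong₂ _*_ (e zero) (∏-cong (e ∘ suc))

  ∏-mono : {f g : Fin n → ℕ} → (∀ i → f i ≤ g i) → ∏ f ≤ ∏ g
  ∏-mono {zero}  e = ≤-refl
  ∏-mono {suc n} e = *-mono-≤ (e zero) (∏-mono (e ∘ suc))

  ∏-* : (f g : Fin n → ℕ) → ∏ (λ i → f i * g i) ≡ ∏ f * ∏ g
  ∏-* {zero}  f g = refl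
  ∏-* {suc n} f g = begin
    f zero * g zero * ∏ (λ i → f (suc i) * g (suc i))  ≡⟨ cong (f zero * g zero *_) (∏-* (f ∘ suc) (g ∘ suc)) ⟩
    f zero * g zero * (∏ (f ∘ suc) * ∏ (g ∘ suc))      ≡⟨ arith (f zero) (g zero) _ _ ⟩
    f zero * ∏ (f ∘ suc) * (g zero * ∏ (g ∘ suc))      ∎
    where
    open ≡-Reasoning
    arith : ∀ a b c d → a * b * (c * d) ≡ a * c * (b * d)
    arith = solve-∀

  ∏-const : ∀ n c → ∏ {n} (const c) ≡ c ^ n
  ∏-const zero    c = refl
  ∏-const (suc n) c = cong (c *_) (∏-const n c)

  opaque
    unfolding ∑

    ∏-^ : ∀ b (f : Fin n → ℕ) → ∏ (λ i → b ^ f i) ≡ b ^ ∑ f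
    ∏-^ {zero}  b f = refl
    ∏-^ {suc n} b f = trans (cong (b ^ f zero *_) (∏-^ b (f ∘ suc))) (sym (^-distribˡ-+-* b (f zero) _))

  ^-distribʳ-* : ∀ a b k → (a * b) ^ k ≡ a ^ k * b ^ k
  ^-distribʳ-* a b zero    = refl
  ^-distribʳ-* a b (suc k) = trans (cong (a * b *_) (^-distribʳ-* a b k)) (arith a b (a ^ k) (b ^ k))
    where
    arith : ∀ a b c d → a * b * (c * d) ≡ a * c * (b * d)
    arith = solve-∀

  ^-∏ : ∀ (f : Fin n → ℕ) k → ∏ (λ i → f i ^ k) ≡ ∏ f ^ k
  ^-∏ {zero}  f k = sym (^-zeroˡ k)
  ^-∏ {suc n} f k = trans (cong (f zero ^ k *_) (^-∏ (f ∘ suc) k)) (sym (^-distribʳ-* (f zero) _ k))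

  χ : ∀ {a} {P : Set a} → Dec P → ℕ
  χ d = b2n (does d)

  module _ {a : Level} {P : Set a} where

    χ-yes : (d : Dec P) → P → χ d ≡ 1
    χ-yes d x = cong b2n (dec-true d x)

    χ-no : (d : Dec P) → ¬ P → χ d ≡ 0
    χ-no d x = cong b2n (dec-false d x)

    χ≤1 : (d : Dec P) → χ d ≤ 1
    χ≤1 (yes _) = ≤-refl
    χ≤1 (no _)  = z≤n

    χ≤ : (d : Dec P) {x : ℕ} → (P → 1 ≤ x) → χ d ≤ x
    χ≤ (yes q) f = f q
    χ≤ (no _)  f = z≤n

    χ-cong : ∀ {b} {Q : Set b} (d : Dec P) (e : Dec Q) → (P → Q) → (Q → P) → χ d ≡ χ e
    χ-cong (yes q) e f g = sym (cong b2n (dec-true e (f q)))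
    χ-cong (no ¬q) e f g = sym (cong b2n (dec-false e (¬q ∘ g)))

  χ-× : ∀ {a b} {P : Set a} {Q : Set b} (d : Dec P) (e : Dec Q) → χ (d ×-dec e) ≡ χ d * χ e
  χ-× (yes _) e = sym (*-identityˡ _)
  χ-× (no _)  e = refl

  χ*≤ : ∀ {a} {P : Set a} (d : Dec P) {x y : ℕ} → (P → x ≤ y) → χ d * x ≤ y
  χ*≤ (yes q) f = ≤-trans (≤-reflexive (*-identityˡ _)) (f q)
  χ*≤ (no _)  f = z≤n

  opaque
    unfolding ∑

    ∑-δ : (j : Fin n) (f : Fin n → ℕ) → ∑ (λ i → χ (i Fin.≟ j) * f i) ≡ f j
    ∑-δ {suc n} zero    f = trans (cong₂ _+_ (*-identityˡ (f zero)) (trans (∑-const n 0) (*-zeroʳ n))) (+-identityʳ _)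
    ∑-δ {suc n} (suc j) f = trans
      (∑-cong λ i → cong (_* f (suc i)) (χ-cong (suc i Fin.≟ suc j) (i Fin.≟ j) Fin.suc-injective (cong suc)))
      (∑-δ j (f ∘ suc))

  ∑-δ′ : (j : Fin n) (f : Fin n → ℕ) → ∑ (λ i → χ (j Fin.≟ i) * f i) ≡ f j
  ∑-δ′ j f = trans (∑-cong λ i → cong (_* f i) (χ-cong (j Fin.≟ i) (i Fin.≟ j) sym sym)) (∑-δ j f)

  ∑-δ-1 : (j : Fin n) → ∑ (λ i → χ (i Fin.≟ j)) ≡ 1
  ∑-δ-1 j = trans (∑-cong λ i → sym (*-identityʳ (χ (i Fin.≟ j)))) (∑-δ j (const 1))

  -- After inserting a Kronecker delta and exchanging the sums, the delta at j = φ i becomes the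
  -- delta at i = ψ j.
  ∑-bij : (φ : Fin n → Fin m) (ψ : Fin m → Fin n) → (∀ i → ψ (φ i) ≡ i) → (∀ j → φ (ψ j) ≡ j) →
          (f : Fin m → ℕ) → ∑ (f ∘ φ) ≡ ∑ f
  ∑-bij φ ψ ψφ φψ f = begin
    ∑ (f ∘ φ)                                    ≡⟨ ∑-cong (λ i → sym (∑-δ (φ i) f)) ⟩
    ∑ (λ i → ∑ (λ j → χ (j Fin.≟ φ i) * f j))    ≡⟨ ∑-swap (λ i j → χ (j Fin.≟ φ i) * f j) ⟩
    ∑ (λ j → ∑ (λ i → χ (j Fin.≟ φ i) * f j))    ≡⟨ ∑-cong (λ j → ∑-cong λ i → cong (_* f j)
                                                      (χ-cong (j Fin.≟ φ i) (i Fin.≟ ψ j)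
                                                        (λ e → trans (sym (ψφ i)) (cong ψ (sym e)))
                                                        (λ e → trans (sym (φψ j)) (cong φ (sym e))))) ⟩
    ∑ (λ j → ∑ (λ i → χ (i Fin.≟ ψ j) * f j))    ≡⟨ ∑-cong (λ j → ∑-δ (ψ j) (const (f j))) ⟩
    ∑ f                                          ∎
    where open ≡-Reasoning

  ∑-unique : {P : Fin n → Set} (P? : ∀ i → Dec (P i)) → (∀ i j → P i → P j → i ≡ j) → ∑ (λ i → χ (P? i)) ≤ 1
  ∑-unique {n} P? uniq with Fin.any? P?
  ... | no ∄ = ≤-trans (≤-reflexive (trans (∑-cong (λ i → χ-no (P? i) λ q → ∄ (i , q))) (trans (∑-const n 0) (*-zeroʳ n)))) z≤n
  ... | yes (j , q) = ≤-trans (∑-mono λ i → χ≤ (P? i) λ r → ≤-reflexive (sym (χ-yes (i Fin.≟ j) (uniq i j r q)))) (≤-reflexive (∑-δ-1 j))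

  ∑∑-unique : {P : Fin n → Fin m → Set} (P? : ∀ i j → Dec (P i j)) →
              (∀ i j k l → P i j → P k l → i ≡ k × j ≡ l) → ∑ (λ i → ∑ (λ j → χ (P? i j))) ≤ 1
  ∑∑-unique {n} {m} P? uniq = ≤-trans (∑-mono λ i → inner i) (∑-unique (λ i → Fin.any? (P? i)) λ { i k (_ , q) (_ , r) → proj₁ (uniq _ _ _ _ q r) })
    where
    inner : ∀ i → ∑ (λ j → χ (P? i j)) ≤ χ (Fin.any? (P? i))
    inner i with Fin.any? (P? i)
    ... | yes _ = ∑-unique (P? i) λ j l q r → proj₂ (uniq _ _ _ _ q r)
    ... | no ∄  = ≤-reflexive (trans (∑-cong (λ j → χ-no (P? i j) λ q → ∄ (j , q))) (trans (∑-const m 0) (*-zeroʳ m)))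

  opaque
    unfolding ∑

    -- Makes sums over initial segments of different lengths comparable; it is the passage between
    -- `range u y`, `rank u y` and `p`.
    ∑-< : ∀ r m (F : ℕ → ℕ) → r ≤ m → ∑ {m} (λ t → χ (toℕ t <? r) * F (toℕ t)) ≡ ∑ {r} (λ t → F (toℕ t))
    ∑-< zero    m       F _ = trans (∑-cong {m} (λ t → refl)) (trans (∑-const m 0) (*-zeroʳ m))
    ∑-< (suc r) (suc m) F (s≤s r≤m) = cong₂ _+_ (*-identityˡ (F 0)) (∑-< r m (F ∘ suc) r≤m)

open Sums

-- Power inequalities

-- Inequalities with exponents of denominator `k` are proved for the `k`-th powers; this returns to
-- the bases.
^-cancelˡ-≤ : ∀ {a b} k .{{_ : NonZero k}} → a ^ k ≤ b ^ k → a ≤ b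
^-cancelˡ-≤ {a} {b} k a^k≤b^k with a ≤? b
... | yes a≤b = a≤b
... | no  a≰b = contradiction a^k≤b^k (<⇒≱ (^-monoˡ-< k (≰⇒> a≰b)))

bernoulli : ∀ m k → m ^ k * (m + k) ≤ suc m ^ k * m
bernoulli m zero    = ≤-reflexive (cong (1 *_) (+-identityʳ m))
bernoulli m (suc k) = begin
  m * m ^ k * (m + suc k)                ≤⟨ m≤m+n _ (m ^ k * k) ⟩
  m * m ^ k * (m + suc k) + m ^ k * k    ≡⟨ arith m k (m ^ k) ⟩
  suc m * (m ^ k * (m + k))              ≤⟨ *-monoʳ-≤ (suc m) (bernoulli m k) ⟩
  suc m * (suc m ^ k * m)                ≡⟨ *-assoc (suc m) (suc m ^ k) m ⟨
  suc m * suc m ^ k * m                  ∎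
  where
  open ≤-Reasoning
  arith : ∀ m k x → m * x * (m + (1 + k)) + x * k ≡ (1 + m) * (x * (m + k))
  arith = solve-∀

-- (1 + 1/m)^k ≥ 1 + k/m ≥ 2, cleared of denominators.
2*m^k≤[1+m]^k : ∀ m k .{{_ : NonZero k}} → m ≤ k → m ^ k * 2 ≤ suc m ^ k
2*m^k≤[1+m]^k zero (suc k)  m≤k = z≤n
2*m^k≤[1+m]^k m@(suc _) k m≤k = *-cancelʳ-≤ _ _ m (begin
  m ^ k * 2 * m    ≡⟨ arith (m ^ k) m ⟩
  m ^ k * (m + m)  ≤⟨ *-monoʳ-≤ (m ^ k) (+-monoʳ-≤ m m≤k) ⟩
  m ^ k * (m + k)  ≤⟨ bernoulli m k ⟩
  suc m ^ k * m    ∎)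
  where
  open ≤-Reasoning
  arith : ∀ x m → x * 2 * m ≡ x * (m + m)
  arith = solve-∀

-- With m = a + f this is 1 - f/m ≤ 2^(-f/q) for m ≤ q, where the left side is the chance of
-- avoiding f of m values. Each unit step from `a` to `a + f` at least doubles the `q`-th power.
a^q*2^f≤[a+f]^q : ∀ a f q → a + f ≤ q → a ^ q * 2 ^ f ≤ (a + f) ^ q
a^q*2^f≤[a+f]^q a zero    q le = ≤-reflexive (trans (*-identityʳ _) (cong (_^ q) (sym (+-identityʳ a))))
a^q*2^f≤[a+f]^q a (suc f) q le = begin
  a ^ q * (2 * 2 ^ f)    ≡⟨ *-assoc (a ^ q) 2 _ ⟨
  a ^ q * 2 * 2 ^ f      ≤⟨ *-monoˡ-≤ (2 ^ f) (2*m^k≤[1+m]^k a q {{>-nonZero (≤-trans (s≤s z≤n) le′)}} (≤-trans (n≤1+n a) (≤-trans (m≤m+n _ f) le′))) ⟩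
  suc a ^ q * 2 ^ f      ≤⟨ a^q*2^f≤[a+f]^q (suc a) f q le′ ⟩
  (suc a + f) ^ q        ≡⟨ cong (_^ q) (sym (+-suc a f)) ⟩
  (a + suc f) ^ q        ∎
  where
  open ≤-Reasoning
  le′ : suc a + f ≤ q
  le′ = ≤-trans (≤-reflexive (sym (+-suc a f))) le

-- Bernoulli's (1 - 1/(m+1))^k ≥ 1 - k/(m+1) = j/(m+1), inverted and cleared of denominators.
bernoulli′ : ∀ m k j → suc m ≡ k + j → suc m ^ k * j ≤ m ^ k * (k + j)
bernoulli′ m zero    j e = ≤-refl
bernoulli′ m (suc k) j e = begin
  suc m * suc m ^ k * j        ≡⟨ arith₁ m (suc m ^ k) j ⟩
  suc m ^ k * (m * j + j)      ≤⟨ *-monoʳ-≤ (suc m ^ k) (+-monoʳ-≤ (m * j) j≤m) ⟩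
  suc m ^ k * (m * j + m)      ≡⟨ arith₂ m (suc m ^ k) j ⟩
  m * (suc m ^ k * suc j)      ≤⟨ *-monoʳ-≤ m (bernoulli′ m k (suc j) (trans e (sym (+-suc k j)))) ⟩
  m * (m ^ k * (k + suc j))    ≡⟨ cong (λ z → m * (m ^ k * z)) (+-suc k j) ⟩
  m * (m ^ k * suc (k + j))    ≡⟨ *-assoc m _ _ ⟨
  m * m ^ k * suc (k + j)      ∎
  where
  open ≤-Reasoning
  j≤m : j ≤ m
  j≤m = ≤-trans (m≤n+m j k) (≤-reflexive (sym (suc-injective e)))
  arith₁ : ∀ m x j → (1 + m) * x * j ≡ x * (m * j + j)
  arith₁ = solve-∀
  arith₂ : ∀ m x j → x * (m * j + m) ≡ m * (x * (1 + j))
  arith₂ = solve-∀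

[1+m]^k≤2*m^k : ∀ m k → k + k ≤ suc m → suc m ^ k ≤ m ^ k * 2
[1+m]^k≤2*m^k m zero    le = s≤s z≤n
[1+m]^k≤2*m^k m k@(suc _) le = *-cancelʳ-≤ _ _ j {{>-nonZero (≤-trans (s≤s z≤n) k≤j)}} (begin
  suc m ^ k * j    ≤⟨ bernoulli′ m k j (sym (m+[n∸m]≡n (≤-trans (m≤m+n k k) le))) ⟩
  m ^ k * (k + j)  ≤⟨ *-monoʳ-≤ (m ^ k) (+-monoˡ-≤ j k≤j) ⟩
  m ^ k * (j + j)  ≡⟨ arith (m ^ k) j ⟩
  m ^ k * 2 * j    ∎)
  where
  open ≤-Reasoning
  j = suc m ∸ k
  k≤j : k ≤ j
  k≤j = ≤-trans (≤-reflexive (sym (m+n∸n≡m k k))) (∸-monoˡ-≤ k le)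
  arith : ∀ x j → x * (j + j) ≡ x * 2 * j
  arith = solve-∀

-- A substitute for (1 + 1/m)^m ≤ e: each half of the exponent costs a factor of two.
[1+m]^k≤4*m^k : ∀ m k → k ≤ m → suc m ^ k ≤ m ^ k * 4
[1+m]^k≤4*m^k m k k≤m = begin
  suc m ^ k                          ≡⟨ cong (suc m ^_) (sym (⌊n/2⌋+⌈n/2⌉≡n k)) ⟩
  suc m ^ (a + b)                    ≡⟨ ^-distribˡ-+-* (suc m) a b ⟩
  suc m ^ a * suc m ^ b              ≤⟨ *-mono-≤ ([1+m]^k≤2*m^k m a a+a≤1+m) ([1+m]^k≤2*m^k m b b+b≤1+m) ⟩
  m ^ a * 2 * (m ^ b * 2)            ≡⟨ arith (m ^ a) (m ^ b) ⟩
  m ^ a * m ^ b * 4                  ≡⟨ cong (_* 4) (sym (^-distribˡ-+-* m a b)) ⟩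
  m ^ (a + b) * 4                    ≡⟨ cong (λ z → m ^ z * 4) (⌊n/2⌋+⌈n/2⌉≡n k) ⟩
  m ^ k * 4                          ∎
  where
  open ≤-Reasoning
  a = ⌊ k /2⌋
  b = ⌈ k /2⌉
  a+a≤1+m : a + a ≤ suc m
  a+a≤1+m = ≤-trans (+-monoʳ-≤ a (⌊n/2⌋≤⌈n/2⌉ k)) (≤-trans (≤-reflexive (⌊n/2⌋+⌈n/2⌉≡n k)) (≤-trans k≤m (n≤1+n m)))
  b+b≤1+m : b + b ≤ suc m
  b+b≤1+m = ≤-trans (+-monoʳ-≤ b (⌊n/2⌋≤⌈n/2⌉ (suc k))) (≤-trans (≤-reflexive (⌊n/2⌋+⌈n/2⌉≡n (suc k))) (s≤s k≤m))
  arith : ∀ x y → x * 2 * (y * 2) ≡ x * y * 4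
  arith = solve-∀

-- The integer form of 1 + h/m ≤ 4^(h/k) for k ≤ m. It bounds both the exponential moments and the
-- total weight in the union bound.
[m+h]^k≤m^k*4^h : ∀ m h k → k ≤ m → (m + h) ^ k ≤ m ^ k * 4 ^ h
[m+h]^k≤m^k*4^h m zero    k le = ≤-reflexive (trans (cong (_^ k) (+-identityʳ m)) (sym (*-identityʳ _)))
[m+h]^k≤m^k*4^h m (suc h) k le = begin
  (m + suc h) ^ k        ≡⟨ cong (_^ k) (+-suc m h) ⟩
  (suc m + h) ^ k        ≤⟨ [m+h]^k≤m^k*4^h (suc m) h k (≤-trans le (n≤1+n m)) ⟩
  suc m ^ k * 4 ^ h      ≤⟨ *-monoˡ-≤ (4 ^ h) ([1+m]^k≤4*m^k m k le) ⟩
  m ^ k * 4 * 4 ^ h      ≡⟨ *-assoc (m ^ k) 4 _ ⟩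
  m ^ k * 4 ^ suc h      ∎
  where open ≤-Reasoning

-- Counting collinear pairs

-- N points on lines with p directions: On y is collinearity in direction y, rank orders the p points
-- of each line, at u y t is the point of rank t on the line through u in direction y, and dir u r is
-- the direction in which u has rank r.
record Space (p N : ℕ) : Set₁ where
  field
    N≡p³     : N ≡ p * p * p
    On       : Fin p → Fin N → Fin N → Set
    On?      : ∀ y u v → Dec (On y u v)
    on-refl  : ∀ y u → On y u u
    on-sym   : ∀ y {u v} → On y u v → On y v u
    on-trans : ∀ y {u v w} → On y u v → On y v w → On y u w
    rank     : Fin N → Fin p → ℕ
    rank<p   : ∀ u y → rank u y < p
    at       : Fin N → Fin p → ℕ → Fin N
    on-at    : ∀ u y t → On y u (at u y t)
    rank-at  : ∀ u y t → t < p → rank (at u y t) y ≡ t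
    at-rank  : ∀ u y {v} → On y u v → at u y (rank v y) ≡ v
    dir      : Fin N → Fin p → Fin p
    rank-dir : ∀ u r → rank u (dir u r) ≡ toℕ r
    dir-rank : ∀ u r y → rank u y ≡ toℕ r → dir u r ≡ y
    two-points  : ∀ {y z u v} → u ≢ v → On y u v → On z u v → y ≡ z
    no-triangle : ∀ {x y z u v w} → u ≢ v → v ≢ w → u ≢ w → On x u v → On y v w → On z u w → x ≡ y × x ≡ z

∑-*-∑ : ∀ {m n} (f : Fin m → ℕ) (g : Fin n → ℕ) → ∑ f * ∑ g ≡ ∑ (λ i → ∑ (λ j → f i * g j))
∑-*-∑ f g = trans (sym (∑-*ʳ f (∑ g))) (∑-cong λ i → sym (∑-*ˡ (f i) g))

2xy≤x²+y² : ∀ x y → 2 * (x * y) ≤ x * x + y * y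
2xy≤x²+y² x y with ≤-total x y
... | inj₁ x≤y with d , refl ← m≤n⇒∃[o]m+o≡n x≤y = ≤-trans (m≤m+n _ (d * d)) (≤-reflexive (arith x d))
  where
  arith : ∀ x d → 2 * (x * (x + d)) + d * d ≡ x * x + (x + d) * (x + d)
  arith = solve-∀
... | inj₂ y≤x with d , refl ← m≤n⇒∃[o]m+o≡n y≤x = ≤-trans (m≤m+n _ (d * d)) (≤-reflexive (arith y d))
  where
  arith : ∀ x d → 2 * ((x + d) * x) + d * d ≡ (x + d) * (x + d) + x * x
  arith = solve-∀

-- (x − m − 2k)² ≥ 0, without subtraction.
shifted-square : ∀ x m k → 4 * k * x + 2 * (x * m) ≤ 4 * k * m + (x * x + m * m) + 4 * (k * k)
shifted-square x m k = +-cancelʳ-≤ (4 * k * m) _ _ (begin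
  4 * k * x + 2 * (x * m) + 4 * k * m                       ≡⟨ arith₁ x m k ⟩
  2 * (x * (m + 2 * k)) + 4 * k * m                         ≤⟨ +-monoˡ-≤ (4 * k * m) (2xy≤x²+y² x (m + 2 * k)) ⟩
  x * x + (m + 2 * k) * (m + 2 * k) + 4 * k * m             ≡⟨ arith₂ x m k ⟩
  4 * k * m + (x * x + m * m) + 4 * (k * k) + 4 * k * m     ∎)
  where
  open ≤-Reasoning
  arith₁ : ∀ x m k → 4 * k * x + 2 * (x * m) + 4 * k * m ≡ 2 * (x * (m + 2 * k)) + 4 * k * m
  arith₁ = solve-∀
  arith₂ : ∀ x m k → x * x + (m + 2 * k) * (m + 2 * k) + 4 * k * m ≡ 4 * k * m + (x * x + m * m) + 4 * (k * k) + 4 * k * m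
  arith₂ = solve-∀

module Counting {p N : ℕ} (X : Space p N) .{{_ : NonZero p}} where
  open Space X

  on : Fin p → Fin N → Fin N → ℕ
  on y u v = χ (On? y u v)

  on-comm : ∀ y u v → on y u v ≡ on y v u
  on-comm y u v = χ-cong (On? y u v) (On? y v u) (on-sym y) (on-sym y)

  -- Off the diagonal this is the indicator of collinearity, because distinct points share at most
  -- one direction; on the diagonal it is `p`.
  coll : Fin N → Fin N → ℕ
  coll u v = ∑ λ y → on y u v

  coll-comm : ∀ u v → coll u v ≡ coll v u
  coll-comm u v = ∑-cong λ y → on-comm y u v

  rankᶠ : Fin N → Fin p → Fin p
  rankᶠ u y = fromℕ< (rank<p u y)

  ∑-at : ∀ u y v → ∑ {p} (λ t → χ (v Fin.≟ at u y (toℕ t))) ≡ on y u v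
  ∑-at u y v with On? y u v
  ... | yes o = trans (∑-cong λ t → χ-cong (v Fin.≟ at u y (toℕ t)) (t Fin.≟ rankᶠ v y) (to t) (from t)) (∑-δ-1 (rankᶠ v y))
    where
    to : ∀ t → v ≡ at u y (toℕ t) → t ≡ rankᶠ v y
    to t e = Fin.toℕ-injective (sym (trans (Fin.toℕ-fromℕ< _) (trans (cong (λ x → rank x y) e) (rank-at u y (toℕ t) (Fin.toℕ<n t)))))
    from : ∀ t → t ≡ rankᶠ v y → v ≡ at u y (toℕ t)
    from t e = sym (trans (cong (at u y) (trans (cong toℕ e) (Fin.toℕ-fromℕ< _))) (at-rank u y o))
  ... | no ¬o = trans (∑-cong λ t → χ-no (v Fin.≟ at u y (toℕ t)) λ e → ¬o (subst (On y u) (sym e) (on-at u y (toℕ t)))) (trans (∑-const p 0) (*-zeroʳ p))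

  ∑-line : ∀ u y (f : Fin N → ℕ) → ∑ {p} (λ t → f (at u y (toℕ t))) ≡ ∑ (λ v → on y u v * f v)
  ∑-line u y f = begin
    ∑ {p} (λ t → f (at u y (toℕ t)))                               ≡⟨ ∑-cong {p} (λ t → sym (∑-δ (at u y (toℕ t)) f)) ⟩
    ∑ {p} (λ t → ∑ (λ v → χ (v Fin.≟ at u y (toℕ t)) * f v))       ≡⟨ ∑-swap {p} (λ t v → χ (v Fin.≟ at u y (toℕ t)) * f v) ⟩
    ∑ (λ v → ∑ {p} (λ t → χ (v Fin.≟ at u y (toℕ t)) * f v))       ≡⟨ ∑-cong (λ v → ∑-*ʳ {p} (λ t → χ (v Fin.≟ at u y (toℕ t))) (f v)) ⟩
    ∑ (λ v → ∑ {p} (λ t → χ (v Fin.≟ at u y (toℕ t))) * f v)       ≡⟨ ∑-cong (λ v → cong (_* f v) (∑-at u y v)) ⟩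
    ∑ (λ v → on y u v * f v)                                       ∎
    where open ≡-Reasoning

  ∑-on : ∀ y u → ∑ (λ v → on y u v) ≡ p
  ∑-on y u = trans (∑-cong λ v → sym (*-identityʳ (on y u v))) (trans (sym (∑-line u y (const 1))) (trans (∑-const p 1) (*-identityʳ p)))

  ∑-coll : ∀ u → ∑ (λ v → coll u v) ≡ p * p
  ∑-coll u = trans (∑-swap λ v y → on y u v) (trans (∑-cong (λ y → ∑-on y u)) (∑-const p p))

  -- A point off a line is collinear with at most one point of it.
  line-coll : ∀ y v w → ∑ (λ u → on y v u * coll u w) ≤ 1 + 2 * p * on y v w
  line-coll y v w with On? y v w
  ... | yes o = begin
    ∑ (λ u → on y v u * coll u w)                                      ≡⟨ ∑-cong (λ u → sym (∑-*ˡ (on y v u) λ z → on z u w)) ⟩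
    ∑ (λ u → ∑ (λ z → on y v u * on z u w))                            ≤⟨ ∑-mono (λ u → ∑-mono λ z → term u z) ⟩
    ∑ (λ u → ∑ {p} (λ z → χ (u Fin.≟ w) * 1 + χ (z Fin.≟ y) * on y v u)) ≡⟨ ∑-cong (λ u → trans (∑-+ (λ z → χ (u Fin.≟ w) * 1) (λ z → χ (z Fin.≟ y) * on y v u))
                                                                            (cong₂ _+_ (∑-const p (χ (u Fin.≟ w) * 1)) (∑-δ y (const (on y v u))))) ⟩
    ∑ (λ u → p * (χ (u Fin.≟ w) * 1) + on y v u)                       ≡⟨ ∑-+ (λ u → p * (χ (u Fin.≟ w) * 1)) (on y v) ⟩
    ∑ (λ u → p * (χ (u Fin.≟ w) * 1)) + ∑ (on y v)                     ≡⟨ cong₂ _+_ (trans (∑-*ˡ p _) (cong (p *_) (∑-δ w (const 1)))) (∑-on y v) ⟩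
    p * 1 + p                                                          ≤⟨ n≤1+n _ ⟩
    1 + (p * 1 + p)                                                    ≡⟨ arith p ⟩
    1 + 2 * p * 1                                                      ∎
    where
    open ≤-Reasoning
    arith : ∀ p → 1 + (p * 1 + p) ≡ 1 + 2 * p * 1
    arith = solve-∀
    -- A pair (u, z) counts only if `u` is `w`, for which all `p` directions are allowed, or if `z`
    -- is the direction `y` of the line itself, which has `p` points.
    term : ∀ u z → on y v u * on z u w ≤ χ (u Fin.≟ w) * 1 + χ (z Fin.≟ y) * on y v u
    term u z with On? y v u | On? z u w | u Fin.≟ w
    ... | no _   | _      | _      = z≤n
    ... | yes _  | no _   | _      = z≤n
    ... | yes _  | yes _  | yes _  = s≤s z≤n
    ... | yes o′ | yes o″ | no u≢w = ≤-reflexive (sym (trans (*-identityʳ _) (χ-yes (z Fin.≟ y) (two-points u≢w o″ (on-trans y (on-sym y o′) o)))))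
  ... | no ¬o = begin
    ∑ (λ u → on y v u * coll u w)                      ≡⟨ ∑-cong (λ u → sym (∑-*ˡ (on y v u) λ z → on z u w)) ⟩
    ∑ (λ u → ∑ (λ z → on y v u * on z u w))            ≡⟨ ∑-cong (λ u → ∑-cong λ z → sym (χ-× (On? y v u) (On? z u w))) ⟩
    ∑ (λ u → ∑ (λ z → χ (On? y v u ×-dec On? z u w)))  ≤⟨ ∑∑-unique (λ u z → On? y v u ×-dec On? z u w) uniq ⟩
    1                                                  ≤⟨ m≤m+n 1 _ ⟩
    1 + 2 * p * 0                                      ∎
    where
    open ≤-Reasoning
    off : ∀ {u} → On y v u → u ≢ w
    off o refl = ¬o o
    uniq : ∀ u z u′ z′ → On y v u × On z u w → On y v u′ × On z′ u′ w → u ≡ u′ × z ≡ z′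
    uniq u z u′ z′ (o₁ , o₂) (o₃ , o₄) with u Fin.≟ u′
    ... | yes refl = refl , two-points (off o₁) o₂ o₄
    -- Two distinct points of the line would form a triangle with `w`, which would put `w` on the
    -- line.
    ... | no u≢u′ with refl , _ ← no-triangle u≢u′ (off o₃) (off o₁) (on-trans y (on-sym y o₁) o₃) o₄ o₂ = ⊥-elim (¬o (on-trans y o₃ o₄))

  -- Each of the `p` lines through `v` has at most one point collinear with `w`, apart from a line
  -- through both. Since p² · p²/p³ = p, this is the codegree of a random relation of density 1/p.
  coll-coll : ∀ v w → ∑ (λ u → coll u v * coll u w) ≤ p + 2 * p * coll v w
  coll-coll v w = begin
    ∑ (λ u → coll u v * coll u w)              ≡⟨ ∑-cong (λ u → sym (∑-*ʳ (λ y → on y u v) (coll u w))) ⟩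
    ∑ (λ u → ∑ (λ y → on y u v * coll u w))    ≡⟨ ∑-swap (λ u y → on y u v * coll u w) ⟩
    ∑ (λ y → ∑ (λ u → on y u v * coll u w))    ≡⟨ ∑-cong (λ y → ∑-cong λ u → cong (_* coll u w) (on-comm y u v)) ⟩
    ∑ (λ y → ∑ (λ u → on y v u * coll u w))    ≤⟨ ∑-mono (λ y → line-coll y v w) ⟩
    ∑ (λ y → 1 + 2 * p * on y v w)             ≡⟨ ∑-+ (const 1) (λ y → 2 * p * on y v w) ⟩
    ∑ {p} (const 1) + ∑ (λ y → 2 * p * on y v w) ≡⟨ cong₂ _+_ (trans (∑-const p 1) (*-identityʳ p)) (∑-*ˡ (2 * p) (λ y → on y v w)) ⟩
    p + 2 * p * coll v w                       ∎
    where open ≤-Reasoning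

  -- Its average over all points is |A|/p, the value from which deviations are measured.
  gain : (Fin N → ℕ) → Fin N → ℕ
  gain A u = ∑ λ v → coll u v * A v

  pairs : (Fin N → ℕ) → (Fin N → ℕ) → ℕ
  pairs A B = ∑ λ u → B u * gain A u

  pairs-comm : ∀ A B → pairs A B ≡ pairs B A
  pairs-comm A B = begin
    ∑ (λ u → B u * ∑ (λ v → coll u v * A v))     ≡⟨ ∑-cong (λ u → sym (∑-*ˡ (B u) _)) ⟩
    ∑ (λ u → ∑ (λ v → B u * (coll u v * A v)))   ≡⟨ ∑-swap (λ u v → B u * (coll u v * A v)) ⟩
    ∑ (λ v → ∑ (λ u → B u * (coll u v * A v)))   ≡⟨ ∑-cong (λ v → ∑-cong λ u → trans (arith (B u) (coll u v) (A v)) (cong (λ c → A v * (c * B u)) (coll-comm u v))) ⟩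
    ∑ (λ v → ∑ (λ u → A v * (coll v u * B u)))   ≡⟨ ∑-cong (λ v → ∑-*ˡ (A v) _) ⟩
    ∑ (λ v → A v * ∑ (λ u → coll v u * B u))     ∎
    where
    open ≡-Reasoning
    arith : ∀ b c a → b * (c * a) ≡ a * (c * b)
    arith = solve-∀

  ∑-gain : ∀ A → ∑ (gain A) ≡ p * p * ∑ A
  ∑-gain A = begin
    ∑ (λ u → ∑ (λ v → coll u v * A v))   ≡⟨ ∑-swap (λ u v → coll u v * A v) ⟩
    ∑ (λ v → ∑ (λ u → coll u v * A v))   ≡⟨ ∑-cong (λ v → ∑-*ʳ (λ u → coll u v) (A v)) ⟩
    ∑ (λ v → ∑ (λ u → coll u v) * A v)   ≡⟨ ∑-cong (λ v → cong (_* A v) (trans (∑-cong (λ u → coll-comm u v)) (∑-coll v))) ⟩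
    ∑ (λ v → p * p * A v)                ≡⟨ ∑-*ˡ (p * p) A ⟩
    p * p * ∑ A                          ∎
    where open ≡-Reasoning

  -- Expanding the square reduces a second moment to codegrees. The relation `c` is general because
  -- it is used for `coll` and for collinearity in one direction.
  bilinear : ∀ {m} (c : Fin m → Fin N → ℕ) (A : Fin N → ℕ) →
             ∑ (λ u → ∑ (λ v → c u v * A v) * ∑ (λ w → c u w * A w)) ≡
             ∑ (λ v → ∑ (λ w → A v * A w * ∑ (λ u → c u v * c u w)))
  bilinear c A = begin
    ∑ (λ u → ∑ (λ v → c u v * A v) * ∑ (λ w → c u w * A w))     ≡⟨ ∑-cong (λ u → ∑-*-∑ (λ v → c u v * A v) (λ w → c u w * A w)) ⟩
    ∑ (λ u → ∑ (λ v → ∑ (λ w → c u v * A v * (c u w * A w))))   ≡⟨ ∑-swap (λ u v → ∑ (λ w → c u v * A v * (c u w * A w))) ⟩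
    ∑ (λ v → ∑ (λ u → ∑ (λ w → c u v * A v * (c u w * A w))))   ≡⟨ ∑-cong (λ v → ∑-swap (λ u w → c u v * A v * (c u w * A w))) ⟩
    ∑ (λ v → ∑ (λ w → ∑ (λ u → c u v * A v * (c u w * A w))))   ≡⟨ ∑-cong (λ v → ∑-cong λ w → trans (∑-cong λ u → arith (c u v) (A v) (c u w) (A w)) (∑-*ˡ (A v * A w) _)) ⟩
    ∑ (λ v → ∑ (λ w → A v * A w * ∑ (λ u → c u v * c u w)))     ∎
    where
    open ≡-Reasoning
    arith : ∀ a b c d → a * b * (c * d) ≡ b * d * (a * c)
    arith = solve-∀

  unbilinear : ∀ A k l (c : Fin N → Fin N → ℕ) → ∑ (λ v → ∑ (λ w → A v * A w * (k + l * c v w))) ≡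
               k * (∑ A * ∑ A) + l * ∑ (λ v → A v * ∑ (λ w → c v w * A w))
  unbilinear A k l c = begin
    ∑ (λ v → ∑ (λ w → A v * A w * (k + l * c v w)))                          ≡⟨ ∑-cong (λ v → trans (∑-cong λ w → arith (A v) (A w) k l (c v w))
                                                                                  (∑-+ (λ w → k * (A v * A w)) (λ w → l * (A v * (c v w * A w))))) ⟩
    ∑ (λ v → ∑ (λ w → k * (A v * A w)) + ∑ (λ w → l * (A v * (c v w * A w))))  ≡⟨ ∑-+ _ _ ⟩
    ∑ (λ v → ∑ (λ w → k * (A v * A w))) + ∑ (λ v → ∑ (λ w → l * (A v * (c v w * A w))))
      ≡⟨ cong₂ _+_ (trans (∑-cong λ v → ∑-*ˡ k _) (trans (∑-*ˡ k _) (cong (k *_) (sym (∑-*-∑ A A)))))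
                   (trans (∑-cong λ v → trans (∑-*ˡ l _) (cong (l *_) (∑-*ˡ (A v) _))) (∑-*ˡ l _)) ⟩
    k * (∑ A * ∑ A) + l * ∑ (λ v → A v * ∑ (λ w → c v w * A w))              ∎
    where
    open ≡-Reasoning
    arith : ∀ a b k l c → a * b * (k + l * c) ≡ k * (a * b) + l * (a * (c * b))
    arith = solve-∀

  ∑-gain² : ∀ A → ∑ (λ u → gain A u * gain A u) ≤ p * (∑ A * ∑ A) + 2 * p * pairs A A
  ∑-gain² A = begin
    ∑ (λ u → gain A u * gain A u)                                  ≡⟨ bilinear coll A ⟩
    ∑ (λ v → ∑ (λ w → A v * A w * ∑ (λ u → coll u v * coll u w)))  ≤⟨ ∑-mono (λ v → ∑-mono λ w → *-monoʳ-≤ (A v * A w) (coll-coll v w)) ⟩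
    ∑ (λ v → ∑ (λ w → A v * A w * (p + 2 * p * coll v w)))         ≡⟨ unbilinear A p (2 * p) coll ⟩
    p * (∑ A * ∑ A) + 2 * p * pairs A A                            ∎
    where open ≤-Reasoning

  -- For u in B the excess p · gain - |A| is at most (p · gain - |A|)²/(4k) + k, and by `∑-gain²`
  -- the squares over all u sum to at most 2p³ · `pairs A A`. The choice k = p² gives `pairs A A`
  -- the coefficient p against 2p on the left, so that it can be absorbed when B = A.
  ∑-gain≤ : ∀ A B → (∀ u → B u ≤ 1) →
            2 * (p * pairs A B) ≤ 2 * (∑ A * ∑ B) + p * pairs A A + 2 * (p * p * ∑ B)
  ∑-gain≤ A B B≤1 = *-cancelˡ-≤ (2 * (p * p)) {{m*n≢0 2 (p * p) {{_}} {{m*n≢0 p p}}}} (+-cancelʳ-≤ (2 * (p * p * p * (m * m))) _ _ (begin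
    2 * (p * p) * (2 * (p * W)) + 2 * (p * p * p * (m * m))                          ≡⟨ arith₁ p W m ⟩
    4 * (p * p) * (p * W) + 2 * (p * (p * p * m) * m)                                ≡⟨ sym lhs ⟩
    ∑ (λ u → 4 * k * (B u * (p * g u)) + 2 * (p * g u * m))                          ≤⟨ ∑-mono (λ u → term u (B u) (B≤1 u)) ⟩
    ∑ (λ u → 4 * k * m * B u + (p * g u * (p * g u) + m * m) + 4 * (k * k) * B u)    ≡⟨ rhs ⟩
    4 * k * m * b + (p * p * G + p * p * p * (m * m)) + 4 * (k * k) * b              ≤⟨ +-monoˡ-≤ _ (+-monoʳ-≤ (4 * k * m * b) (+-monoˡ-≤ _ (*-monoʳ-≤ (p * p) (∑-gain² A)))) ⟩
    4 * k * m * b + (p * p * (p * (m * m) + 2 * p * T) + p * p * p * (m * m)) + 4 * (k * k) * b  ≡⟨ arith₂ p m b T ⟩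
    2 * (p * p) * (2 * (m * b) + p * T + 2 * (p * p * b)) + 2 * (p * p * p * (m * m))   ∎))
    where
    open ≤-Reasoning
    m = ∑ A
    b = ∑ B
    g = gain A
    W = pairs A B
    T = pairs A A
    k = p * p
    G = ∑ (λ u → g u * g u)
    arith₁ : ∀ p W m → 2 * (p * p) * (2 * (p * W)) + 2 * (p * p * p * (m * m)) ≡ 4 * (p * p) * (p * W) + 2 * (p * (p * p * m) * m)
    arith₁ = solve-∀
    arith₂ : ∀ p m b T → 4 * (p * p) * m * b + (p * p * (p * (m * m) + 2 * p * T) + p * p * p * (m * m)) + 4 * (p * p * (p * p)) * b ≡
             2 * (p * p) * (2 * (m * b) + p * T + 2 * (p * p * b)) + 2 * (p * p * p * (m * m))
    arith₂ = solve-∀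
    lhs : ∑ (λ u → 4 * k * (B u * (p * g u)) + 2 * (p * g u * m)) ≡ 4 * k * (p * W) + 2 * (p * (p * p * m) * m)
    lhs = trans (∑-+ _ _) (cong₂ _+_
      (trans (∑-*ˡ (4 * k) _) (cong (4 * k *_) (trans (∑-cong λ u → swap (B u) p (g u)) (∑-*ˡ p _))))
      (trans (∑-*ˡ 2 _) (cong (2 *_) (trans (∑-*ʳ _ m) (cong (_* m) (trans (∑-*ˡ p g) (cong (p *_) (∑-gain A))))))))
      where
      swap : ∀ b p g → b * (p * g) ≡ p * (b * g)
      swap = solve-∀
    rhs : ∑ (λ u → 4 * k * m * B u + (p * g u * (p * g u) + m * m) + 4 * (k * k) * B u) ≡
          4 * k * m * b + (p * p * G + p * p * p * (m * m)) + 4 * (k * k) * b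
    rhs = trans (∑-+ _ _) (cong₂ _+_ (trans (∑-+ _ _) (cong₂ _+_ (∑-*ˡ (4 * k * m) B)
      (trans (∑-+ _ _) (cong₂ _+_ (trans (∑-cong λ u → sq p (g u)) (∑-*ˡ (p * p) _)) (trans (∑-const N (m * m)) (cong (_* (m * m)) N≡p³))))))
      (∑-*ˡ (4 * (k * k)) B))
      where
      sq : ∀ p g → p * g * (p * g) ≡ p * p * (g * g)
      sq = solve-∀
    term : ∀ u c → c ≤ 1 → 4 * k * (c * (p * g u)) + 2 * (p * g u * m) ≤
             4 * k * m * c + (p * g u * (p * g u) + m * m) + 4 * (k * k) * c
    term u 0 _ = begin
      4 * k * 0 + 2 * (p * g u * m)                                      ≡⟨ cong (_+ 2 * (p * g u * m)) (*-zeroʳ (4 * k)) ⟩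
      2 * (p * g u * m)                                                  ≤⟨ 2xy≤x²+y² (p * g u) m ⟩
      p * g u * (p * g u) + m * m                                        ≤⟨ m≤n+m _ (4 * k * m * 0) ⟩
      4 * k * m * 0 + (p * g u * (p * g u) + m * m)                      ≤⟨ m≤m+n _ (4 * (k * k) * 0) ⟩
      4 * k * m * 0 + (p * g u * (p * g u) + m * m) + 4 * (k * k) * 0    ∎
    term u 1 _ = begin
      4 * k * (1 * (p * g u)) + 2 * (p * g u * m)                        ≡⟨ cong (λ z → 4 * k * z + 2 * (p * g u * m)) (*-identityˡ _) ⟩
      4 * k * (p * g u) + 2 * (p * g u * m)                              ≤⟨ shifted-square (p * g u) m k ⟩
      4 * k * m + (p * g u * (p * g u) + m * m) + 4 * (k * k)            ≡⟨ cong₂ (λ x y → x + (p * g u * (p * g u) + m * m) + y) (sym (*-identityʳ (4 * k * m))) (sym (*-identityʳ (4 * (k * k)))) ⟩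
      4 * k * m * 1 + (p * g u * (p * g u) + m * m) + 4 * (k * k) * 1    ∎
    term u (suc (suc _)) (s≤s ())

  pairs-self≤ : ∀ A → (∀ u → A u ≤ 1) → p * pairs A A ≤ 2 * (∑ A * ∑ A) + 2 * (p * p * ∑ A)
  pairs-self≤ A A≤1 = +-cancelˡ-≤ (p * pairs A A) _ _ (begin
    p * pairs A A + p * pairs A A                                    ≡⟨ arith₁ (p * pairs A A) ⟩
    2 * (p * pairs A A)                                              ≤⟨ ∑-gain≤ A A A≤1 ⟩
    2 * (∑ A * ∑ A) + p * pairs A A + 2 * (p * p * ∑ A)              ≡⟨ arith₂ (2 * (∑ A * ∑ A)) (p * pairs A A) _ ⟩
    p * pairs A A + (2 * (∑ A * ∑ A) + 2 * (p * p * ∑ A))            ∎)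
    where
    open ≤-Reasoning
    arith₁ : ∀ x → x + x ≡ 2 * x
    arith₁ = solve-∀
    arith₂ : ∀ x y z → x + y + z ≡ y + (x + z)
    arith₂ = solve-∀

  pairs≤ : ∀ A B → (∀ u → A u ≤ 1) → (∀ u → B u ≤ 1) → p * pairs A B ≤ (∑ A + p * p) * (∑ A + ∑ B)
  pairs≤ A B A≤1 B≤1 = *-cancelˡ-≤ 2 (begin
    2 * (p * pairs A B)                                                    ≤⟨ ∑-gain≤ A B B≤1 ⟩
    2 * (∑ A * ∑ B) + p * pairs A A + 2 * (p * p * ∑ B)                    ≤⟨ +-monoˡ-≤ _ (+-monoʳ-≤ (2 * (∑ A * ∑ B)) (pairs-self≤ A A≤1)) ⟩
    2 * (∑ A * ∑ B) + (2 * (∑ A * ∑ A) + 2 * (p * p * ∑ A)) + 2 * (p * p * ∑ B) ≡⟨ arith (∑ A) (∑ B) p ⟩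
    2 * ((∑ A + p * p) * (∑ A + ∑ B))                                      ∎)
    where
    open ≤-Reasoning
    arith : ∀ a b p → 2 * (a * b) + (2 * (a * a) + 2 * (p * p * a)) + 2 * (p * p * b) ≡ 2 * ((a + p * p) * (a + b))
    arith = solve-∀

  on-on : ∀ y v w → ∑ (λ u → on y u v * on y u w) ≡ p * on y v w
  on-on y v w with On? y v w
  ... | yes o = trans (∑-cong λ u → term u) (trans (∑-on y v) (sym (*-identityʳ p)))
    where
    term : ∀ u → on y u v * on y u w ≡ on y v u
    term u with On? y u v | On? y u w
    ... | yes o₁ | yes _  = sym (χ-yes (On? y v u) (on-sym y o₁))
    ... | yes o₁ | no ¬o₂ = contradiction (on-trans y o₁ o) ¬o₂
    ... | no ¬o₁ | _      = sym (χ-no (On? y v u) (¬o₁ ∘ on-sym y))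
  ... | no ¬o = trans (∑-cong λ u → term u) (trans (∑-const N 0) (trans (*-zeroʳ N) (sym (*-zeroʳ p))))
    where
    term : ∀ u → on y u v * on y u w ≡ 0
    term u with On? y u v | On? y u w
    ... | yes o₁ | yes o₂ = contradiction (on-trans y (on-sym y o₁) o₂) ¬o
    ... | yes _  | no _   = refl
    ... | no _   | _      = refl

  -- The weight of `A` on one line, attached to every point of that line, so that sums over `u` see
  -- each line `p` times.
  local : (Fin N → ℕ) → Fin p → Fin N → ℕ
  local A y u = ∑ λ v → on y u v * A v

  ∑-local : ∀ A u → ∑ (λ y → local A y u) ≡ gain A u
  ∑-local A u = trans (∑-swap λ y v → on y u v * A v) (∑-cong λ v → ∑-*ʳ (λ y → on y u v) (A v))

  ∑-local² : ∀ A → ∑ (λ y → ∑ (λ u → local A y u * local A y u)) ≡ p * pairs A A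
  ∑-local² A = begin
    ∑ (λ y → ∑ (λ u → local A y u * local A y u))                             ≡⟨ ∑-cong (λ y → bilinear (λ u v → on y u v) A) ⟩
    ∑ (λ y → ∑ (λ v → ∑ (λ w → A v * A w * ∑ (λ u → on y u v * on y u w))))   ≡⟨ ∑-cong (λ y → ∑-cong λ v → ∑-cong λ w → cong (A v * A w *_) (on-on y v w)) ⟩
    ∑ (λ y → ∑ (λ v → ∑ (λ w → A v * A w * (0 + p * on y v w))))              ≡⟨ ∑-cong (λ y → unbilinear A 0 p (on y)) ⟩
    ∑ (λ y → p * ∑ (λ v → A v * local A y v))                                 ≡⟨ ∑-*ˡ p _ ⟩
    p * ∑ (λ y → ∑ (λ v → A v * local A y v))                                 ≡⟨ cong (p *_) (∑-swap λ y v → A v * local A y v) ⟩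
    p * ∑ (λ v → ∑ (λ y → A v * local A y v))                                 ≡⟨ cong (p *_) (∑-cong λ v → trans (∑-*ˡ (A v) _) (cong (A v *_) (∑-local A v))) ⟩
    p * pairs A A                                                             ∎
    where open ≡-Reasoning

  -- Cauchy-Schwarz over the p² parallel lines of each direction: |A|/p² is the average weight of a
  -- line, and (p² · local - |A|)² ≥ 0.
  ∑²≤pairs : ∀ A → ∑ A * ∑ A ≤ p * pairs A A
  ∑²≤pairs A = *-cancelˡ-≤ (k * k) {{m*n≢0 k k {{m*n≢0 p p}} {{m*n≢0 p p}}}} (+-cancelʳ-≤ (k * k * (m * m)) _ _ (begin
    k * k * (m * m) + k * k * (m * m)                                   ≡⟨ arith₁ k m ⟩
    2 * (k * (k * m) * m)                                               ≡⟨ sym lhs ⟩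
    ∑ (λ y → ∑ (λ u → 2 * (k * l y u * m)))                             ≤⟨ ∑-mono (λ y → ∑-mono λ u → 2xy≤x²+y² (k * l y u) m) ⟩
    ∑ (λ y → ∑ (λ u → k * l y u * (k * l y u) + m * m))                 ≡⟨ rhs ⟩
    k * k * (p * pairs A A) + p * (p * p * p * (m * m))                 ≡⟨ cong (k * k * (p * pairs A A) +_) (arith₂ p m) ⟩
    k * k * (p * pairs A A) + k * k * (m * m)                           ∎))
    where
    open ≤-Reasoning
    k = p * p
    m = ∑ A
    l = local A
    arith₁ : ∀ k m → k * k * (m * m) + k * k * (m * m) ≡ 2 * (k * (k * m) * m)
    arith₁ = solve-∀
    arith₂ : ∀ p m → p * (p * p * p * (m * m)) ≡ p * p * (p * p) * (m * m)
    arith₂ = solve-∀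
    sq : ∀ p g → p * g * (p * g) ≡ p * p * (g * g)
    sq = solve-∀
    lhs : ∑ (λ y → ∑ (λ u → 2 * (k * l y u * m))) ≡ 2 * (k * (k * m) * m)
    lhs = trans (∑-cong λ y → trans (∑-*ˡ 2 _) (cong (2 *_) (trans (∑-*ʳ _ m) (cong (_* m) (∑-*ˡ k (l y))))))
      (trans (∑-*ˡ 2 _) (cong (2 *_) (trans (∑-*ʳ _ m) (cong (_* m) (trans (∑-*ˡ k _) (cong (k *_)
        (trans (∑-swap l) (trans (∑-cong (∑-local A)) (∑-gain A)))))))))
    rhs : ∑ (λ y → ∑ (λ u → k * l y u * (k * l y u) + m * m)) ≡ k * k * (p * pairs A A) + p * (p * p * p * (m * m))
    rhs = trans (∑-cong λ y → trans (∑-+ _ _) (cong₂ _+_ (trans (∑-cong λ u → sq k (l y u)) (∑-*ˡ (k * k) _))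
                  (trans (∑-const N (m * m)) (cong (_* (m * m)) N≡p³))))
      (trans (∑-+ _ _) (cong₂ _+_ (trans (∑-*ˡ (k * k) _) (cong (k * k *_) (∑-local² A))) (∑-const p _)))

  -- The inner sum runs over ranks instead of points to match the expected number of hits of the
  -- picks.
  below : (Fin N → ℕ) → ℕ
  below A = ∑ λ u → ∑ λ y → A u * ∑ {p} (λ t → χ (toℕ t <? rank u y) * A (at u y (toℕ t)))

  below≡ : ∀ A → below A ≡ ∑ (λ u → ∑ (λ y → ∑ (λ v → A u * (on y u v * (χ (rank v y <? rank u y) * A v)))))
  below≡ A = ∑-cong λ u → ∑-cong λ y → trans (cong (A u *_) (trans
      (∑-cong {p} λ t → cong (λ r → χ (r <? rank u y) * A (at u y (toℕ t))) (sym (rank-at u y (toℕ t) (Fin.toℕ<n t))))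
      (∑-line u y (λ v → χ (rank v y <? rank u y) * A v))))
    (sym (∑-*ˡ (A u) _))

  -- Of two distinct points on a line exactly one is lower, and the diagonal contributes `p` for
  -- each point of `A`.
  pairs≤below : ∀ A → (∀ u → A u ≤ 1) → pairs A A ≤ 2 * below A + p * ∑ A
  pairs≤below A A≤1 = begin
    pairs A A                                                                             ≡⟨ ∑-cong (λ u → trans (cong (A u *_) (sym (∑-local A u))) (trans (sym (∑-*ˡ (A u) _)) (∑-cong λ y → sym (∑-*ˡ (A u) _)))) ⟩
    ∑ (λ u → ∑ (λ y → ∑ (λ v → A u * (on y u v * A v))))                                  ≤⟨ ∑-mono (λ u → ∑-mono λ y → ∑-mono λ v → term u y v) ⟩
    ∑ (λ u → ∑ (λ y → ∑ (λ v → lt u y v + lt v y u + χ (v Fin.≟ u) * A u)))               ≡⟨ ∑-cong (λ u → trans (∑-cong λ y → trans (∑-+ _ _) (cong₂ _+_ (∑-+ _ _) (∑-δ u (const (A u))))) (trans (∑-+ _ _) (cong₂ _+_ (∑-+ _ _) (∑-const p (A u))))) ⟩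
    ∑ (λ u → ∑ (λ y → ∑ (λ v → lt u y v)) + ∑ (λ y → ∑ (λ v → lt v y u)) + p * A u)       ≡⟨ trans (∑-+ _ _) (cong₂ _+_ (∑-+ _ _) (∑-*ˡ p A)) ⟩
    L + ∑ (λ u → ∑ (λ y → ∑ (λ v → lt v y u))) + p * ∑ A                                  ≡⟨ cong (λ z → L + z + p * ∑ A) flip ⟩
    L + L + p * ∑ A                                                                       ≡⟨ cong (_+ p * ∑ A) (cong₂ _+_ (sym (below≡ A)) (trans (sym (below≡ A)) (sym (+-identityʳ _)))) ⟩
    2 * below A + p * ∑ A                                                                 ∎
    where
    open ≤-Reasoning
    lt : Fin N → Fin p → Fin N → ℕ
    lt u y v = A u * (on y u v * (χ (rank v y <? rank u y) * A v))
    L = ∑ (λ u → ∑ (λ y → ∑ (λ v → lt u y v)))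
    flip : ∑ (λ u → ∑ (λ y → ∑ (λ v → lt v y u))) ≡ L
    flip = trans (∑-cong λ u → ∑-swap λ y v → lt v y u)
      (trans (∑-swap λ u v → ∑ (λ y → lt v y u)) (∑-cong λ v → ∑-swap λ u y → lt v y u))
    term : ∀ u y v → A u * (on y u v * A v) ≤ lt u y v + lt v y u + χ (v Fin.≟ u) * A u
    term u y v with On? y u v
    ... | no _  = ≤-trans (≤-reflexive (*-zeroʳ (A u))) z≤n
    ... | yes o with <-cmp (rank v y) (rank u y)
    ... | tri< r _ _ = m≤n⇒m≤n+o _ (m≤n⇒m≤n+o (lt v y u) (≤-reflexive
      (cong (λ z → A u * (1 * z)) (sym (trans (cong (_* A v) (χ-yes (rank v y <? rank u y) r)) (*-identityˡ (A v)))))))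
    ... | tri> _ _ r = m≤n⇒m≤n+o _ (m≤n⇒m≤o+n (A u * (1 * (χ (rank v y <? rank u y) * A v))) (≤-reflexive (trans (arith (A u) (A v))
      (sym (cong (A v *_) (cong₂ _*_ (χ-yes (On? y v u) (on-sym y o)) (cong (_* A u) (χ-yes (rank u y <? rank v y) r))))))))
      where
      arith : ∀ a b → a * (1 * b) ≡ b * (1 * (1 * a))
      arith = solve-∀
    ... | tri≈ _ r _ = m≤n⇒m≤o+n (A u * (1 * (χ (rank v y <? rank u y) * A v)) + lt v y u) (≤-trans
      (*-monoʳ-≤ (A u) (≤-trans (≤-reflexive (*-identityˡ (A v))) (A≤1 v)))
      (≤-reflexive (trans (*-comm (A u) 1) (cong (_* A u) (sym (χ-yes (v Fin.≟ u) v≡u))))))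
      where
      v≡u : v ≡ u
      v≡u = trans (sym (at-rank u y o)) (trans (cong (at u y) r) (at-rank u y (on-refl y u)))

-- Exponential moments and union bounds over product spaces

module ProductSpaces where

  private variable
    n : ℕ

  cons : ℕ → (Fin n → ℕ) → Fin (suc n) → ℕ
  cons t ω zero    = t
  cons t ω (suc i) = ω i

  -- The uniform product space; division by `∏ m` would give the expectation. Outcomes take values
  -- in ℕ, so the type of a weight does not depend on the ranges `m`.
  ∑Ω : (m : Fin n → ℕ) → ((Fin n → ℕ) → ℕ) → ℕ
  ∑Ω {zero}  m g = g (λ ())
  ∑Ω {suc n} m g = ∑ {m zero} λ t → ∑Ω (m ∘ suc) (g ∘ cons (toℕ t))

  ∑Ω-mono : (m : Fin n → ℕ) {g h : (Fin n → ℕ) → ℕ} → (∀ ω → g ω ≤ h ω) → ∑Ω m g ≤ ∑Ω m h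
  ∑Ω-mono {zero}  m le = le _
  ∑Ω-mono {suc n} m le = ∑-mono λ t → ∑Ω-mono (m ∘ suc) (le ∘ cons (toℕ t))

  ∑Ω-cong : (m : Fin n → ℕ) {g h : (Fin n → ℕ) → ℕ} → (∀ ω → g ω ≡ h ω) → ∑Ω m g ≡ ∑Ω m h
  ∑Ω-cong {zero}  m e = e _
  ∑Ω-cong {suc n} m e = ∑-cong λ t → ∑Ω-cong (m ∘ suc) (e ∘ cons (toℕ t))

  ∑Ω-+ : (m : Fin n → ℕ) (g h : (Fin n → ℕ) → ℕ) → ∑Ω m (λ ω → g ω + h ω) ≡ ∑Ω m g + ∑Ω m h
  ∑Ω-+ {zero}  m g h = refl
  ∑Ω-+ {suc n} m g h = trans (∑-cong λ t → ∑Ω-+ (m ∘ suc) (g ∘ cons (toℕ t)) (h ∘ cons (toℕ t))) (∑-+ _ _)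

  ∑Ω-*ˡ : (m : Fin n → ℕ) (c : ℕ) (g : (Fin n → ℕ) → ℕ) → ∑Ω m (λ ω → c * g ω) ≡ c * ∑Ω m g
  ∑Ω-*ˡ {zero}  m c g = refl
  ∑Ω-*ˡ {suc n} m c g = trans (∑-cong λ t → ∑Ω-*ˡ (m ∘ suc) c (g ∘ cons (toℕ t))) (∑-*ˡ c _)

  ∑Ω-*ʳ : (m : Fin n → ℕ) (g : (Fin n → ℕ) → ℕ) (c : ℕ) → ∑Ω m (λ ω → g ω * c) ≡ ∑Ω m g * c
  ∑Ω-*ʳ m g c = trans (∑Ω-cong m λ ω → *-comm (g ω) c) (trans (∑Ω-*ˡ m c g) (*-comm c _))

  ∑Ω-∑ : ∀ {k} (m : Fin n → ℕ) (g : (Fin n → ℕ) → Fin k → ℕ) →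
         ∑Ω m (λ ω → ∑ (g ω)) ≡ ∑ (λ i → ∑Ω m (λ ω → g ω i))
  ∑Ω-∑ {zero}  m g = refl
  ∑Ω-∑ {suc n} m g = trans (∑-cong λ t → ∑Ω-∑ (m ∘ suc) (g ∘ cons (toℕ t))) (∑-swap _)

  ∑Ω-swap : ∀ {k} (m : Fin n → ℕ) (l : Fin k → ℕ) (g : (Fin n → ℕ) → (Fin k → ℕ) → ℕ) →
            ∑Ω m (λ ω → ∑Ω l (g ω)) ≡ ∑Ω l (λ c → ∑Ω m (λ ω → g ω c))
  ∑Ω-swap {k = zero}  m l g = refl
  ∑Ω-swap {k = suc k} m l g = trans (∑Ω-∑ m _) (∑-cong λ t → ∑Ω-swap m (l ∘ suc) (λ ω → g ω ∘ cons (toℕ t)))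

  -- Independence of the coordinates, before normalisation.
  ∑Ω-∏ : (m : Fin n → ℕ) (w : Fin n → ℕ → ℕ) →
         ∑Ω m (λ ω → ∏ (λ i → w i (ω i))) ≡ ∏ (λ i → ∑ {m i} (λ t → w i (toℕ t)))
  ∑Ω-∏ {zero}  m w = refl
  ∑Ω-∏ {suc n} m w = begin
    ∑ {m zero} (λ t → ∑Ω (m ∘ suc) (λ ω → w zero (toℕ t) * ∏ (λ i → w (suc i) (ω i))))
      ≡⟨ ∑-cong (λ t → ∑Ω-*ˡ (m ∘ suc) (w zero (toℕ t)) _) ⟩
    ∑ {m zero} (λ t → w zero (toℕ t) * ∑Ω (m ∘ suc) (λ ω → ∏ (λ i → w (suc i) (ω i))))
      ≡⟨ ∑-*ʳ _ _ ⟩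
    ∑ {m zero} (λ t → w zero (toℕ t)) * ∑Ω (m ∘ suc) (λ ω → ∏ (λ i → w (suc i) (ω i)))
      ≡⟨ cong (∑ {m zero} (λ t → w zero (toℕ t)) *_) (∑Ω-∏ (m ∘ suc) (w ∘ suc)) ⟩
    ∑ {m zero} (λ t → w zero (toℕ t)) * ∏ (λ i → ∑ {m (suc i)} (λ t → w (suc i) (toℕ t)))
      ∎
    where open ≡-Reasoning

  ∑-pigeonhole : ∀ c (f : Fin n → ℕ) → ∑ f < n * c → ∃ λ i → f i < c
  ∑-pigeonhole {n} c f lt with Fin.any? (λ i → f i <? c)
  ... | yes ∃i = ∃i
  ... | no  ∄i = contradiction lt (≤⇒≯ (≤-trans (≤-reflexive (sym (∑-const n c))) (∑-mono λ i → ≮⇒≥ λ q → ∄i (i , q))))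

  -- The first-moment method: coordinate by coordinate, some value keeps the total below the number
  -- of remaining outcomes, until a natural number below 1 is left.
  ∑Ω-pigeonhole : (m : Fin n → ℕ) (g : (Fin n → ℕ) → ℕ) → ∑Ω m g < ∏ m → ∃ λ ω → (∀ i → ω i < m i) × g ω ≡ 0
  ∑Ω-pigeonhole {zero}  m g lt = (λ ()) , (λ ()) , n<1⇒n≡0 lt
  ∑Ω-pigeonhole {suc n} m g lt
    with t , lt′ ← ∑-pigeonhole (∏ (m ∘ suc)) _ lt
    with ω , bound , e ← ∑Ω-pigeonhole (m ∘ suc) (g ∘ cons (toℕ t)) lt′
    = cons (toℕ t) ω , (λ { zero → Fin.toℕ<n t ; (suc i) → bound i }) , e

  -- Extracts one member from a union bound. The summands are indexed by functions assembled with
  -- `cons`, hence the pointwise agreement with `f`.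
  ∑Ω-term : (m : Fin n → ℕ) (g : (Fin n → ℕ) → ℕ) (f : Fin n → ℕ) → (∀ i → f i < m i) →
            ∃ λ ω → (∀ i → ω i ≡ f i) × g ω ≤ ∑Ω m g
  ∑Ω-term {zero}  m g f lt = (λ ()) , (λ ()) , ≤-refl
  ∑Ω-term {suc n} m g f lt
    with ω , e , le ← ∑Ω-term (m ∘ suc) (g ∘ cons (toℕ (fromℕ< (lt zero)))) (f ∘ suc) (lt ∘ suc)
    = cons _ ω , (λ { zero → Fin.toℕ-fromℕ< (lt zero) ; (suc i) → e i })
    , ≤-trans le (term≤∑ (λ t → ∑Ω (m ∘ suc) (g ∘ cons (toℕ t))) (fromℕ< (lt zero)))

  module _ (m : Fin n → ℕ) (H : Fin n → ℕ → Bool) where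

    hits : (Fin n → ℕ) → ℕ
    hits ω = ∑ λ i → b2n (H i (ω i))

    -- Not divided by the ranges `m i`; the tail bounds divide by a uniform lower or upper bound for
    -- them.
    expected : ℕ
    expected = ∑ λ i → ∑ {m i} λ t → b2n (H i (toℕ t))

    -- Markov's inequality for 2^hits. By independence its moment is the product of m i + h i, where
    -- h i counts the hitting values of coordinate i, and (m i + h i)^k ≤ (m i)^k · 4^(h i).
    upper-tail : ∀ k .{{_ : NonZero k}} E θ → (∀ i → k ≤ m i) → expected ≤ k * E →
                 ∑Ω m (λ ω → χ (θ ≤? hits ω)) * 2 ^ θ ≤ ∏ m * 4 ^ E
    upper-tail k E θ k≤m le = begin
      ∑Ω m (λ ω → χ (θ ≤? hits ω)) * 2 ^ θ              ≡⟨ ∑Ω-*ʳ m _ (2 ^ θ) ⟨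
      ∑Ω m (λ ω → χ (θ ≤? hits ω) * 2 ^ θ)              ≤⟨ ∑Ω-mono m markov ⟩
      ∑Ω m (λ ω → 2 ^ hits ω)                           ≡⟨ ∑Ω-cong m (λ ω → sym (∏-^ 2 (λ i → b2n (H i (ω i))))) ⟩
      ∑Ω m (λ ω → ∏ (λ i → 2 ^ b2n (H i (ω i))))        ≡⟨ ∑Ω-∏ m (λ i t → 2 ^ b2n (H i t)) ⟩
      ∏ (λ i → ∑ {m i} (λ t → 2 ^ b2n (H i (toℕ t))))   ≡⟨ ∏-cong factor ⟩
      ∏ (λ i → m i + h i)                               ≤⟨ ^-cancelˡ-≤ k power ⟩
      ∏ m * 4 ^ E                                       ∎
      where
      open ≤-Reasoning
      h : Fin n → ℕ
      h i = ∑ {m i} λ t → b2n (H i (toℕ t))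
      markov : ∀ ω → χ (θ ≤? hits ω) * 2 ^ θ ≤ 2 ^ hits ω
      markov ω = χ*≤ (θ ≤? hits ω) (^-monoʳ-≤ 2)
      2^b : ∀ b → 2 ^ b2n b ≡ 1 + b2n b
      2^b true  = refl
      2^b false = refl
      factor : ∀ i → ∑ {m i} (λ t → 2 ^ b2n (H i (toℕ t))) ≡ m i + h i
      factor i = trans (∑-cong λ t → 2^b (H i (toℕ t))) (trans (∑-+ _ _) (cong (_+ h i) (trans (∑-const (m i) 1) (*-identityʳ (m i)))))
      power : ∏ (λ i → m i + h i) ^ k ≤ (∏ m * 4 ^ E) ^ k
      power = begin
        ∏ (λ i → m i + h i) ^ k              ≡⟨ ^-∏ (λ i → m i + h i) k ⟨
        ∏ (λ i → (m i + h i) ^ k)            ≤⟨ ∏-mono (λ i → [m+h]^k≤m^k*4^h (m i) (h i) k (k≤m i)) ⟩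
        ∏ (λ i → m i ^ k * 4 ^ h i)          ≡⟨ ∏-* (λ i → m i ^ k) (λ i → 4 ^ h i) ⟩
        ∏ (λ i → m i ^ k) * ∏ (λ i → 4 ^ h i) ≡⟨ cong₂ _*_ (^-∏ m k) (∏-^ 4 h) ⟩
        ∏ m ^ k * 4 ^ expected               ≤⟨ *-monoʳ-≤ (∏ m ^ k) (^-monoʳ-≤ 4 le) ⟩
        ∏ m ^ k * 4 ^ (k * E)                ≡⟨ cong (λ z → ∏ m ^ k * 4 ^ z) (*-comm k E) ⟩
        ∏ m ^ k * 4 ^ (E * k)                ≡⟨ cong (∏ m ^ k *_) (sym (^-*-assoc 4 E k)) ⟩
        ∏ m ^ k * (4 ^ E) ^ k                ≡⟨ ^-distribʳ-* (∏ m) (4 ^ E) k ⟨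
        (∏ m * 4 ^ E) ^ k                    ∎

    no-hit : (Fin n → ℕ) → ℕ
    no-hit ω = ∏ λ i → 1 ∸ b2n (H i (ω i))

    -- By independence the outcomes without a hit number the product of m i - h i, and m i ≤ q gives
    -- (m i - h i)^q · 2^(h i) ≤ (m i)^q.
    lower-tail : ∀ q .{{_ : NonZero q}} E → (∀ i → m i ≤ q) → q * E ≤ expected → ∑Ω m no-hit * 2 ^ E ≤ ∏ m
    lower-tail q E m≤q le = begin
      ∑Ω m no-hit * 2 ^ E       ≡⟨ cong (_* 2 ^ E) (∑Ω-∏ m (λ i t → 1 ∸ b2n (H i t))) ⟩
      ∏ x * 2 ^ E               ≤⟨ ^-cancelˡ-≤ q power ⟩
      ∏ m                       ∎
      where
      open ≤-Reasoning
      h x : Fin n → ℕ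
      h i = ∑ {m i} λ t → b2n (H i (toℕ t))
      x i = ∑ {m i} λ t → 1 ∸ b2n (H i (toℕ t))
      1∸b : ∀ b → 1 ∸ b2n b + b2n b ≡ 1
      1∸b true  = refl
      1∸b false = refl
      x+h≡m : ∀ i → x i + h i ≡ m i
      x+h≡m i = trans (sym (∑-+ _ _)) (trans (∑-cong λ t → 1∸b (H i (toℕ t))) (trans (∑-const (m i) 1) (*-identityʳ (m i))))
      power : (∏ x * 2 ^ E) ^ q ≤ ∏ m ^ q
      power = begin
        (∏ x * 2 ^ E) ^ q                     ≡⟨ ^-distribʳ-* (∏ x) (2 ^ E) q ⟩
        ∏ x ^ q * (2 ^ E) ^ q                 ≡⟨ cong (∏ x ^ q *_) (trans (^-*-assoc 2 E q) (cong (2 ^_) (*-comm E q))) ⟩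
        ∏ x ^ q * 2 ^ (q * E)                 ≤⟨ *-monoʳ-≤ (∏ x ^ q) (^-monoʳ-≤ 2 le) ⟩
        ∏ x ^ q * 2 ^ expected                ≡⟨ cong₂ _*_ (sym (^-∏ x q)) (sym (∏-^ 2 h)) ⟩
        ∏ (λ i → x i ^ q) * ∏ (λ i → 2 ^ h i) ≡⟨ ∏-* (λ i → x i ^ q) (λ i → 2 ^ h i) ⟨
        ∏ (λ i → x i ^ q * 2 ^ h i)           ≤⟨ ∏-mono (λ i → ≤-trans (a^q*2^f≤[a+f]^q (x i) (h i) q (≤-trans (≤-reflexive (x+h≡m i)) (m≤q i))) (≤-reflexive (cong (_^ q) (x+h≡m i)))) ⟩
        ∏ (λ i → m i ^ q)                     ≡⟨ ^-∏ m q ⟩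
        ∏ m ^ q                               ∎

  sign : ℕ → ℕ
  sign zero    = 0
  sign (suc _) = 1

  support : (Fin n → ℕ) → ℕ
  support c = ∑ λ i → sign (c i)

  -- With Z = 2^L a colouring `c` has weight Z^(-support c), and these weights sum to (1 + a/Z)^n ≤
  -- 4^a because n ≤ Z. Multiplying by Z^n keeps all exponents nonnegative.
  union-bound : ∀ a L M κ (g : (Fin n → ℕ) → ℕ) → n ≤ 2 ^ L → (∀ c → g c * 2 ^ (L * support c + κ) ≤ M) →
                ∑Ω {n} (const (suc a)) g * 2 ^ κ ≤ M * 4 ^ a
  union-bound {n} a L M κ g n≤2^L le = *-cancelʳ-≤ _ _ (Z ^ n) {{m^n≢0 Z n}} (begin
    ∑Ω l g * 2 ^ κ * Z ^ n                               ≡⟨ *-assoc (∑Ω l g) (2 ^ κ) _ ⟩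
    ∑Ω l g * (2 ^ κ * Z ^ n)                             ≡⟨ ∑Ω-*ʳ l g _ ⟨
    ∑Ω l (λ c → g c * (2 ^ κ * Z ^ n))                   ≤⟨ ∑Ω-mono l term ⟩
    ∑Ω l (λ c → M * ∏ (λ i → Z ^ (1 ∸ sign (c i))))      ≡⟨ ∑Ω-*ˡ l M _ ⟩
    M * ∑Ω l (λ c → ∏ (λ i → Z ^ (1 ∸ sign (c i))))      ≡⟨ cong (M *_) (∑Ω-∏ l (λ _ t → Z ^ (1 ∸ sign t))) ⟩
    M * ∏ {n} (λ i → ∑ {suc a} (λ t → Z ^ (1 ∸ sign (toℕ t)))) ≡⟨ cong (M *_) (trans (∏-const n _) (cong (_^ n) factor)) ⟩
    M * (Z + a) ^ n                                      ≤⟨ *-monoʳ-≤ M ([m+h]^k≤m^k*4^h Z a n n≤2^L) ⟩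
    M * (Z ^ n * 4 ^ a)                                  ≡⟨ arith M (Z ^ n) (4 ^ a) ⟩
    M * 4 ^ a * Z ^ n                                    ∎)
    where
    open ≤-Reasoning
    Z = 2 ^ L
    instance
      Z≢0 : NonZero Z
      Z≢0 = m^n≢0 2 L
    l : Fin n → ℕ
    l = const (suc a)
    arith : ∀ M x y → M * (x * y) ≡ M * y * x
    arith = solve-∀
    factor : ∑ {suc a} (λ t → Z ^ (1 ∸ sign (toℕ t))) ≡ Z + a
    factor = trans (∑-suc _) (cong₂ _+_ (*-identityʳ Z) (trans (∑-const a 1) (*-identityʳ a)))
    sign-split : ∀ t → sign t + (1 ∸ sign t) ≡ 1
    sign-split zero    = refl
    sign-split (suc t) = refl
    term : ∀ c → g c * (2 ^ κ * Z ^ n) ≤ M * ∏ (λ i → Z ^ (1 ∸ sign (c i)))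
    term c = begin
      g c * (2 ^ κ * Z ^ n)                                ≡⟨ cong (λ z → g c * (2 ^ κ * Z ^ z)) (sym (trans (sym (∑-+ _ _)) (trans (∑-cong λ i → sign-split (c i)) (trans (∑-const n 1) (*-identityʳ n))))) ⟩
      g c * (2 ^ κ * Z ^ (support c + d))                  ≡⟨ cong (λ z → g c * (2 ^ κ * z)) (^-distribˡ-+-* Z (support c) d) ⟩
      g c * (2 ^ κ * (Z ^ support c * Z ^ d))              ≡⟨ arith′ (g c) (2 ^ κ) (Z ^ support c) (Z ^ d) ⟩
      g c * (Z ^ support c * 2 ^ κ) * Z ^ d                ≡⟨ cong (λ z → g c * (z * 2 ^ κ) * Z ^ d) (^-*-assoc 2 L (support c)) ⟩
      g c * (2 ^ (L * support c) * 2 ^ κ) * Z ^ d          ≡⟨ cong (λ z → g c * z * Z ^ d) (sym (^-distribˡ-+-* 2 (L * support c) κ)) ⟩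
      g c * 2 ^ (L * support c + κ) * Z ^ d                ≤⟨ *-monoˡ-≤ (Z ^ d) (le c) ⟩
      M * Z ^ d                                            ≡⟨ cong (M *_) (sym (∏-^ Z (λ i → 1 ∸ sign (c i)))) ⟩
      M * ∏ (λ i → Z ^ (1 ∸ sign (c i)))                   ∎
      where
      d = ∑ λ i → 1 ∸ sign (c i)
      arith′ : ∀ g x y z → g * (x * (y * z)) ≡ g * (y * x) * z
      arith′ = solve-∀

open ProductSpaces

-- Lines with directions (1, y, y²) over a prime field

module PrimeField (p : ℕ) (p-prime : Prime p) where

  instance
    p≢0 : NonZero p
    p≢0 = prime⇒nonZero p-prime

  infixl 6 _⊞_
  infixl 7 _⊠_

  opaque
    ν : ℕ → Fin p
    ν m = m mod p

    _⊞_ _⊠_ : Fin p → Fin p → Fin p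
    a ⊞ b = ν (toℕ a + toℕ b)
    a ⊠ b = ν (toℕ a * toℕ b)

    ⊟_ : Fin p → Fin p
    ⊟ a = ν (p ∸ toℕ a)

    toℕ-ν : ∀ m → toℕ (ν m) ≡ m % p
    toℕ-ν m = Fin.toℕ-fromℕ< (m%n<n m p)

    ν-toℕ : ∀ a → ν (toℕ a) ≡ a
    ν-toℕ a = Fin.toℕ-injective (trans (toℕ-ν (toℕ a)) (m<n⇒m%n≡m (Fin.toℕ<n a)))

    ν-cong : ∀ {m n} → m % p ≡ n % p → ν m ≡ ν n
    ν-cong {m} {n} e = Fin.toℕ-injective (trans (toℕ-ν m) (trans e (sym (toℕ-ν n))))

    ν-+ : ∀ m n → ν m ⊞ ν n ≡ ν (m + n)
    ν-+ m n = ν-cong (trans (cong₂ (λ x y → (x + y) % p) (toℕ-ν m) (toℕ-ν n)) (sym (%-distribˡ-+ m n p)))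

    ν-* : ∀ m n → ν m ⊠ ν n ≡ ν (m * n)
    ν-* m n = ν-cong (trans (cong₂ (λ x y → (x * y) % p) (toℕ-ν m) (toℕ-ν n)) (sym (%-distribˡ-* m n p)))

    ⊟-inverseʳ : ∀ a → a ⊞ ⊟ a ≡ ν 0
    ⊟-inverseʳ a = trans (cong (_⊞ ⊟ a) (sym (ν-toℕ a))) (trans (ν-+ (toℕ a) (p ∸ toℕ a))
      (ν-cong (trans (cong (_% p) (m+[n∸m]≡n (<⇒≤ (Fin.toℕ<n a)))) (trans (n%n≡0 p) (sym (m<n⇒m%n≡m (>-nonZero⁻¹ p)))))))

    p∣toℕ⇒≡0 : ∀ a → p ∣ toℕ a → a ≡ ν 0
    p∣toℕ⇒≡0 a d with toℕ a in eq
    ... | zero  = trans (sym (ν-toℕ a)) (cong ν eq)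
    ... | suc m = contradiction d (>⇒∤ (subst (_< p) eq (Fin.toℕ<n a)))

    ⊠-domain : ∀ a b → a ⊠ b ≡ ν 0 → a ≡ ν 0 ⊎ b ≡ ν 0
    ⊠-domain a b e = Sum.map (p∣toℕ⇒≡0 a) (p∣toℕ⇒≡0 b) (euclidsLemma (toℕ a) (toℕ b) p-prime (m%n≡0⇒n∣m _ p
      (trans (sym (toℕ-ν (toℕ a * toℕ b))) (trans (cong toℕ e) (trans (toℕ-ν 0) (m<n⇒m%n≡m (>-nonZero⁻¹ p)))))))

  -- Laws of ℕ descend along the surjective semiring homomorphism ν.
  private
    lift₁ : {P : Fin p → Set} → (∀ m → P (ν m)) → ∀ a → P a
    lift₁ {P} f a = subst P (ν-toℕ a) (f (toℕ a))

  ⊞-comm : ∀ a b → a ⊞ b ≡ b ⊞ a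
  ⊞-comm = lift₁ λ m → lift₁ λ n → trans (ν-+ m n) (trans (cong ν (+-comm m n)) (sym (ν-+ n m)))

  ⊠-comm : ∀ a b → a ⊠ b ≡ b ⊠ a
  ⊠-comm = lift₁ λ m → lift₁ λ n → trans (ν-* m n) (trans (cong ν (*-comm m n)) (sym (ν-* n m)))

  ⊞-assoc : ∀ a b c → (a ⊞ b) ⊞ c ≡ a ⊞ (b ⊞ c)
  ⊞-assoc = lift₁ λ m → lift₁ λ n → lift₁ λ o → trans (trans (cong (_⊞ ν o) (ν-+ m n)) (ν-+ (m + n) o))
    (trans (cong ν (+-assoc m n o)) (sym (trans (cong (ν m ⊞_) (ν-+ n o)) (ν-+ m (n + o)))))

  ⊠-assoc : ∀ a b c → (a ⊠ b) ⊠ c ≡ a ⊠ (b ⊠ c)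
  ⊠-assoc = lift₁ λ m → lift₁ λ n → lift₁ λ o → trans (trans (cong (_⊠ ν o) (ν-* m n)) (ν-* (m * n) o))
    (trans (cong ν (*-assoc m n o)) (sym (trans (cong (ν m ⊠_) (ν-* n o)) (ν-* m (n * o)))))

  ⊠-distribˡ-⊞ : ∀ a b c → a ⊠ (b ⊞ c) ≡ a ⊠ b ⊞ a ⊠ c
  ⊠-distribˡ-⊞ = lift₁ λ m → lift₁ λ n → lift₁ λ o → trans (trans (cong (ν m ⊠_) (ν-+ n o)) (ν-* m (n + o)))
    (trans (cong ν (*-distribˡ-+ m n o)) (sym (trans (cong₂ _⊞_ (ν-* m n) (ν-* m o)) (ν-+ (m * n) (m * o)))))

  ⊞-identityˡ : ∀ a → ν 0 ⊞ a ≡ a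
  ⊞-identityˡ = lift₁ λ m → ν-+ 0 m

  ⊠-identityˡ : ∀ a → ν 1 ⊠ a ≡ a
  ⊠-identityˡ = lift₁ λ m → trans (ν-* 1 m) (cong ν (*-identityˡ m))

  isCommutativeRing : IsCommutativeRing _≡_ _⊞_ _⊠_ ⊟_ (ν 0) (ν 1)
  isCommutativeRing = record
    { isRing = record
      { +-isAbelianGroup = record
        { isGroup = record
          { isMonoid = record
            { isSemigroup = record
              { isMagma = record { isEquivalence = isEquivalence ; ∙-cong = cong₂ _⊞_ }
              ; assoc = ⊞-assoc }
            ; identity = ⊞-identityˡ , λ a → trans (⊞-comm a _) (⊞-identityˡ a) }
          ; inverse = (λ a → trans (⊞-comm _ a) (⊟-inverseʳ a)) , ⊟-inverseʳ
          ; ⁻¹-cong = cong ⊟_ }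
        ; comm = ⊞-comm }
      ; *-cong = cong₂ _⊠_
      ; *-assoc = ⊠-assoc
      ; *-identity = ⊠-identityˡ , λ a → trans (⊠-comm a _) (⊠-identityˡ a)
      ; distrib = ⊠-distribˡ-⊞ , λ a b c → trans (⊠-comm (b ⊞ c) a) (trans (⊠-distribˡ-⊞ a b c) (cong₂ _⊞_ (⊠-comm a b) (⊠-comm a c))) }
    ; *-comm = ⊠-comm }

  commutativeRing : CommutativeRing 0ℓ 0ℓ
  commutativeRing = record { isCommutativeRing = isCommutativeRing }

  open CommutativeRing commutativeRing using (+-group; commutativeSemiring) renaming (zeroʳ to ⊠-zeroʳ; +-identityʳ to ⊞-identityʳ)
  open GroupProperties +-group using () renaming (∙-cancelʳ to ⊞-cancelʳ)
  open SemiringSolver commutativeSemiring using (solve; _:+_; _:*_; _:=_)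

  ⊞-⊟ : ∀ a b → a ⊞ ⊟ b ⊞ b ≡ a
  ⊞-⊟ a b = trans (⊞-assoc a (⊟ b) b) (trans (cong (a ⊞_) (trans (⊞-comm (⊟ b) b) (⊟-inverseʳ b))) (⊞-identityʳ a))

  ⊞-⊟′ : ∀ a b → a ⊞ b ⊞ ⊟ b ≡ a
  ⊞-⊟′ a b = trans (⊞-assoc a b (⊟ b)) (trans (cong (a ⊞_) (⊟-inverseʳ b)) (⊞-identityʳ a))

  ⊠-cancelˡ : ∀ a b c → a ⊠ b ≡ a ⊠ c → a ≡ ν 0 ⊎ b ≡ c
  ⊠-cancelˡ a b c e with ⊠-domain a (b ⊞ ⊟ c) (⊞-cancelʳ (a ⊠ c) _ _ (trans (sym (⊠-distribˡ-⊞ a (b ⊞ ⊟ c) c)) (trans (cong (a ⊠_) (⊞-⊟ b c)) (trans e (sym (⊞-identityˡ _))))))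
  ... | inj₁ q = inj₁ q
  ... | inj₂ q = inj₂ (trans (sym (⊞-⊟ b c)) (trans (cong (_⊞ c) q) (⊞-identityˡ c)))

  -- Subtracting t times the first equation from the second leaves a s (s - t) = 0. If s = t, the
  -- first equation becomes (a + b) s = 0; if s = 0, it becomes b t = 0.
  vandermonde : ∀ a b s t → a ≢ ν 0 → b ≢ ν 0 → a ⊞ b ≢ ν 0 → a ⊠ s ⊞ b ⊠ t ≡ ν 0 → a ⊠ (s ⊠ s) ⊞ b ⊠ (t ⊠ t) ≡ ν 0 →
                s ≡ ν 0 × t ≡ ν 0
  vandermonde a b s t a≢0 b≢0 a+b≢0 e₁ e₂ = cases (⊠-cancelˡ (a ⊠ s) s t (⊞-cancelʳ (b ⊠ (t ⊠ t)) _ _ (begin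
    a ⊠ s ⊠ s ⊞ b ⊠ (t ⊠ t)   ≡⟨ cong (_⊞ b ⊠ (t ⊠ t)) (⊠-assoc a s s) ⟩
    a ⊠ (s ⊠ s) ⊞ b ⊠ (t ⊠ t) ≡⟨ e₂ ⟩
    ν 0                       ≡⟨ ⊠-zeroʳ t ⟨
    t ⊠ ν 0                   ≡⟨ cong (t ⊠_) (sym e₁) ⟩
    t ⊠ (a ⊠ s ⊞ b ⊠ t)       ≡⟨ solve 4 (λ a b s t → t :* (a :* s :+ b :* t) := a :* s :* t :+ b :* (t :* t)) refl a b s t ⟩
    a ⊠ s ⊠ t ⊞ b ⊠ (t ⊠ t)   ∎)))
    where
    open ≡-Reasoning
    from-zero : s ≡ ν 0 → s ≡ ν 0 × t ≡ ν 0
    from-zero refl with ⊠-domain b t (trans (trans (sym (⊞-identityˡ _)) (cong (_⊞ b ⊠ t) (sym (⊠-zeroʳ a)))) e₁)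
    ... | inj₁ q = ⊥-elim (b≢0 q)
    ... | inj₂ q = refl , q
    cases : a ⊠ s ≡ ν 0 ⊎ s ≡ t → s ≡ ν 0 × t ≡ ν 0
    cases (inj₁ q)    = Sum.[ ⊥-elim ∘ a≢0 , from-zero ] (⊠-domain a s q)
    cases (inj₂ refl) = Sum.[ ⊥-elim ∘ a+b≢0 , (λ q → q , q) ] (⊠-domain (a ⊞ b) s
      (trans (solve 3 (λ a b s → (a :+ b) :* s := a :* s :+ b :* s) refl a b s) e₁))

  Point : Set
  Point = Fin (p * (p * p))

  opaque
    coords : Point → Fin p × Fin p × Fin p
    coords u = let a , r = remQuot {p} (p * p) u in a , remQuot {p} p r

    point : Fin p × Fin p × Fin p → Point
    point (a , b , c) = combine a (combine b c)

    coords-point : ∀ t → coords (point t) ≡ t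
    coords-point (a , b , c) = trans
      (cong (λ q → proj₁ q , remQuot {p} p (proj₂ q)) (Fin.remQuot-combine {p} {p * p} a (combine b c)))
      (cong (a ,_) (Fin.remQuot-combine {p} {p} b c))

    point-coords : ∀ u → point (coords u) ≡ u
    point-coords u = trans (cong (combine (proj₁ (remQuot {p} (p * p) u))) (Fin.combine-remQuot {p} p (proj₂ (remQuot {p} (p * p) u)))) (Fin.combine-remQuot {p} (p * p) u)

  x₀ x₁ x₂ : Point → Fin p
  x₀ u = proj₁ (coords u)
  x₁ u = proj₁ (proj₂ (coords u))
  x₂ u = proj₂ (proj₂ (coords u))

  point-ext : ∀ {u v} → x₀ u ≡ x₀ v → x₁ u ≡ x₁ v → x₂ u ≡ x₂ v → u ≡ v
  point-ext {u} {v} e₀ e₁ e₂ = trans (sym (point-coords u)) (trans (cong point (cong₂ _,_ e₀ (cong₂ _,_ e₁ e₂))) (point-coords v))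

  -- v − u is a multiple of (1, y, y²).
  On : Fin p → Point → Point → Set
  On y u v = x₁ u ⊞ x₀ v ⊠ y ≡ x₁ v ⊞ x₀ u ⊠ y × x₂ u ⊞ x₀ v ⊠ (y ⊠ y) ≡ x₂ v ⊞ x₀ u ⊠ (y ⊠ y)

  line-trans : ∀ a b c d e f t → a ⊞ e ⊠ t ≡ b ⊞ d ⊠ t → b ⊞ f ⊠ t ≡ c ⊞ e ⊠ t → a ⊞ f ⊠ t ≡ c ⊞ d ⊠ t
  line-trans a b c d e f t g h = ⊞-cancelʳ (b ⊞ e ⊠ t) _ _ (begin
    a ⊞ f ⊠ t ⊞ (b ⊞ e ⊠ t)  ≡⟨ solve 5 (λ a b e f t → a :+ f :* t :+ (b :+ e :* t) := (a :+ e :* t) :+ (b :+ f :* t)) refl a b e f t ⟩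
    a ⊞ e ⊠ t ⊞ (b ⊞ f ⊠ t)  ≡⟨ cong₂ _⊞_ g h ⟩
    b ⊞ d ⊠ t ⊞ (c ⊞ e ⊠ t)  ≡⟨ solve 5 (λ b c d e t → b :+ d :* t :+ (c :+ e :* t) := (c :+ d :* t) :+ (b :+ e :* t)) refl b c d e t ⟩
    c ⊞ d ⊠ t ⊞ (b ⊞ e ⊠ t)  ∎)
    where open ≡-Reasoning

  rank : Point → Fin p → ℕ
  rank u y = toℕ (x₀ u ⊞ y)

  -- As the rank is x₀ + y, rank t forces the first coordinate t - y; the others change by y and y²
  -- times the change of the first.
  at : Point → Fin p → ℕ → Point
  at u y t = point (z , x₁ u ⊞ z ⊠ y ⊞ ⊟ (x₀ u ⊠ y) , x₂ u ⊞ z ⊠ (y ⊠ y) ⊞ ⊟ (x₀ u ⊠ (y ⊠ y)))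
    where z = ν t ⊞ ⊟ y

  on-at : ∀ u y t → On y u (at u y t)
  on-at u y t rewrite coords-point (ν t ⊞ ⊟ y , x₁ u ⊞ (ν t ⊞ ⊟ y) ⊠ y ⊞ ⊟ (x₀ u ⊠ y) , x₂ u ⊞ (ν t ⊞ ⊟ y) ⊠ (y ⊠ y) ⊞ ⊟ (x₀ u ⊠ (y ⊠ y)))
    = sym (⊞-⊟ _ _) , sym (⊞-⊟ _ _)

  rank-at : ∀ u y t → t < p → rank (at u y t) y ≡ t
  rank-at u y t t<p = trans (cong (λ c → toℕ (proj₁ c ⊞ y)) (coords-point _))
    (trans (cong toℕ (⊞-⊟ (ν t) y)) (trans (toℕ-ν t) (m<n⇒m%n≡m t<p)))

  at-rank : ∀ u y {v} → On y u v → at u y (rank v y) ≡ v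
  at-rank u y {v} (d , e) = trans (cong point (cong₂ _,_ z≡ (cong₂ _,_ (side d) (side e)))) (point-coords v)
    where
    z≡ : ν (rank v y) ⊞ ⊟ y ≡ x₀ v
    z≡ = trans (cong (_⊞ ⊟ y) (ν-toℕ (x₀ v ⊞ y))) (⊞-⊟′ (x₀ v) y)
    side : ∀ {a b t} → a ⊞ x₀ v ⊠ t ≡ b ⊞ x₀ u ⊠ t → a ⊞ (ν (rank v y) ⊞ ⊟ y) ⊠ t ⊞ ⊟ (x₀ u ⊠ t) ≡ b
    side {a} {b} {t} f = trans (cong (_⊞ ⊟ (x₀ u ⊠ t)) (trans (cong (λ z → a ⊞ z ⊠ t) z≡) f)) (⊞-⊟′ b (x₀ u ⊠ t))

  dir : Point → Fin p → Fin p
  dir u r = r ⊞ ⊟ x₀ u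

  rank-dir : ∀ u r → rank u (dir u r) ≡ toℕ r
  rank-dir u r = cong toℕ (trans (⊞-comm (x₀ u) _) (⊞-⊟ r (x₀ u)))

  dir-rank : ∀ u r y → rank u y ≡ toℕ r → dir u r ≡ y
  dir-rank u r y e = trans (cong (_⊞ ⊟ x₀ u) (trans (sym (Fin.toℕ-injective e)) (⊞-comm (x₀ u) y))) (⊞-⊟′ y (x₀ u))

  -- The multiple of (1, y, y²) that leads from `u` to `v`; since each direction starts with 1, it
  -- is the same expression for all y.
  slope : Point → Point → Fin p
  slope u v = x₀ v ⊞ ⊟ x₀ u

  slope≡ : ∀ u v → x₀ v ≡ slope u v ⊞ x₀ u
  slope≡ u v = sym (⊞-⊟ (x₀ v) (x₀ u))

  shift : ∀ {u v a b t} → a ⊞ x₀ v ⊠ t ≡ b ⊞ x₀ u ⊠ t → a ⊞ slope u v ⊠ t ≡ b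
  shift {u} {v} {a} {b} {t} f = ⊞-cancelʳ (x₀ u ⊠ t) _ _ (trans
    (solve 4 (λ a s c t → a :+ s :* t :+ c :* t := a :+ (s :+ c) :* t) refl a (slope u v) (x₀ u) t)
    (trans (cong (λ z → a ⊞ z ⊠ t) (sym (slope≡ u v))) f))

  slope≢0 : ∀ {y u v} → u ≢ v → On y u v → slope u v ≢ ν 0
  slope≢0 {y} {u} {v} u≢v (d , e) s≡0 = u≢v (point-ext (sym x₀≡) (side d) (side e))
    where
    x₀≡ : x₀ v ≡ x₀ u
    x₀≡ = trans (slope≡ u v) (trans (cong (_⊞ x₀ u) s≡0) (⊞-identityˡ _))
    side : ∀ {a b t} → a ⊞ x₀ v ⊠ t ≡ b ⊞ x₀ u ⊠ t → a ≡ b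
    side {a} {b} {t} f = ⊞-cancelʳ (x₀ u ⊠ t) _ _ (trans (cong (λ z → a ⊞ z ⊠ t) (sym x₀≡)) f)

  two-points : ∀ {y z u v} → u ≢ v → On y u v → On z u v → y ≡ z
  two-points {y} {z} {u} {v} u≢v o@(d , _) (e , _) = Sum.[ ⊥-elim ∘ slope≢0 u≢v o , id ] (⊠-cancelˡ (slope u v) y z
    (⊞-cancelʳ (x₁ u) _ _ (trans (⊞-comm _ (x₁ u)) (trans (trans (shift {u} {v} d) (sym (shift {u} {v} e))) (⊞-comm (x₁ u) _)))))

  -- A closed triangle gives a(1, x, x²) + b(1, y, y²) = (a + b)(1, z, z²), where a, b and a + b are
  -- nonzero slopes. In s = x - z and t = y - z this is the system of `vandermonde`.
  no-triangle : ∀ {x y z u v w} → u ≢ v → v ≢ w → u ≢ w → On x u v → On y v w → On z u w → x ≡ y × x ≡ z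
  no-triangle {x} {y} {z} {u} {v} {w} u≢v v≢w u≢w o₁@(d₁ , e₁) o₂@(d₂ , e₂) o₃@(d₃ , e₃) =
    trans x≡z (sym y≡z) , x≡z
    where
    open ≡-Reasoning
    a b s t : Fin p
    a = slope u v
    b = slope v w
    s = x ⊞ ⊟ z
    t = y ⊞ ⊟ z
    slope-+ : slope u w ≡ a ⊞ b
    slope-+ = ⊞-cancelʳ (x₀ u) _ _ (begin
      slope u w ⊞ x₀ u        ≡⟨ slope≡ u w ⟨
      x₀ w                    ≡⟨ slope≡ v w ⟩
      b ⊞ x₀ v                ≡⟨ cong (b ⊞_) (slope≡ u v) ⟩
      b ⊞ (a ⊞ x₀ u)          ≡⟨ solve 3 (λ a b c → b :+ (a :+ c) := a :+ b :+ c) refl a b (x₀ u) ⟩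
      a ⊞ b ⊞ x₀ u            ∎)
    balance : ∀ {k l m ξ η ζ} → k ⊞ x₀ v ⊠ ξ ≡ l ⊞ x₀ u ⊠ ξ → l ⊞ x₀ w ⊠ η ≡ m ⊞ x₀ v ⊠ η → k ⊞ x₀ w ⊠ ζ ≡ m ⊞ x₀ u ⊠ ζ →
              a ⊠ ξ ⊞ b ⊠ η ≡ (a ⊞ b) ⊠ ζ
    balance {k} {l} {m} {ξ} {η} {ζ} f g h = ⊞-cancelʳ k _ _ (begin
      a ⊠ ξ ⊞ b ⊠ η ⊞ k        ≡⟨ solve 3 (λ x y k → x :+ y :+ k := k :+ x :+ y) refl (a ⊠ ξ) (b ⊠ η) k ⟩
      k ⊞ a ⊠ ξ ⊞ b ⊠ η        ≡⟨ cong (_⊞ b ⊠ η) (shift {u} {v} f) ⟩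
      l ⊞ b ⊠ η                ≡⟨ shift {v} {w} g ⟩
      m                        ≡⟨ shift {u} {w} h ⟨
      k ⊞ slope u w ⊠ ζ        ≡⟨ cong (λ c → k ⊞ c ⊠ ζ) slope-+ ⟩
      k ⊞ (a ⊞ b) ⊠ ζ          ≡⟨ ⊞-comm k _ ⟩
      (a ⊞ b) ⊠ ζ ⊞ k          ∎)
    first : a ⊠ s ⊞ b ⊠ t ≡ ν 0
    first = ⊞-cancelʳ ((a ⊞ b) ⊠ z) _ _ (begin
      a ⊠ s ⊞ b ⊠ t ⊞ (a ⊞ b) ⊠ z      ≡⟨ solve 5 (λ a b s t z → a :* s :+ b :* t :+ (a :+ b) :* z := a :* (s :+ z) :+ b :* (t :+ z)) refl a b s t z ⟩
      a ⊠ (s ⊞ z) ⊞ b ⊠ (t ⊞ z)        ≡⟨ cong₂ (λ ξ η → a ⊠ ξ ⊞ b ⊠ η) (⊞-⊟ x z) (⊞-⊟ y z) ⟩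
      a ⊠ x ⊞ b ⊠ y                    ≡⟨ balance d₁ d₂ d₃ ⟩
      (a ⊞ b) ⊠ z                      ≡⟨ ⊞-identityˡ _ ⟨
      ν 0 ⊞ (a ⊞ b) ⊠ z                ∎)
    second : a ⊠ (s ⊠ s) ⊞ b ⊠ (t ⊠ t) ≡ ν 0
    second = ⊞-cancelʳ ((a ⊞ b) ⊠ (z ⊠ z)) _ _ (begin
      a ⊠ (s ⊠ s) ⊞ b ⊠ (t ⊠ t) ⊞ (a ⊞ b) ⊠ (z ⊠ z)
        ≡⟨ ⊞-identityʳ _ ⟨
      a ⊠ (s ⊠ s) ⊞ b ⊠ (t ⊠ t) ⊞ (a ⊞ b) ⊠ (z ⊠ z) ⊞ ν 0
        -- The multiple of `first` added here, equal to zero, supplies the mixed terms of (s + z)²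
        -- and (t + z)².
        ≡⟨ cong (a ⊠ (s ⊠ s) ⊞ b ⊠ (t ⊠ t) ⊞ (a ⊞ b) ⊠ (z ⊠ z) ⊞_) (sym (trans (cong ((z ⊞ z) ⊠_) first) (⊠-zeroʳ _))) ⟩
      a ⊠ (s ⊠ s) ⊞ b ⊠ (t ⊠ t) ⊞ (a ⊞ b) ⊠ (z ⊠ z) ⊞ (z ⊞ z) ⊠ (a ⊠ s ⊞ b ⊠ t)
        ≡⟨ solve 5 (λ a b s t z → a :* (s :* s) :+ b :* (t :* t) :+ (a :+ b) :* (z :* z) :+ (z :+ z) :* (a :* s :+ b :* t) :=
             a :* ((s :+ z) :* (s :+ z)) :+ b :* ((t :+ z) :* (t :+ z))) refl a b s t z ⟩
      a ⊠ ((s ⊞ z) ⊠ (s ⊞ z)) ⊞ b ⊠ ((t ⊞ z) ⊠ (t ⊞ z))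
        ≡⟨ cong₂ (λ ξ η → a ⊠ (ξ ⊠ ξ) ⊞ b ⊠ (η ⊠ η)) (⊞-⊟ x z) (⊞-⊟ y z) ⟩
      a ⊠ (x ⊠ x) ⊞ b ⊠ (y ⊠ y)
        ≡⟨ balance e₁ e₂ e₃ ⟩
      (a ⊞ b) ⊠ (z ⊠ z)
        ≡⟨ ⊞-identityˡ _ ⟨
      ν 0 ⊞ (a ⊞ b) ⊠ (z ⊠ z)
        ∎)
    zeros : s ≡ ν 0 × t ≡ ν 0
    zeros = vandermonde a b s t (slope≢0 u≢v o₁) (slope≢0 v≢w o₂) (slope≢0 u≢w o₃ ∘ trans slope-+) first second
    x≡z : x ≡ z
    x≡z = trans (sym (⊞-⊟ x z)) (trans (cong (_⊞ z) (proj₁ zeros)) (⊞-identityˡ z))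
    y≡z : y ≡ z
    y≡z = trans (sym (⊞-⊟ y z)) (trans (cong (_⊞ z) (proj₂ zeros)) (⊞-identityˡ z))

  space : Space p (p * (p * p))
  space = record
    { N≡p³ = sym (*-assoc p p p)
    ; On = On ; On? = λ y u v → (_ Fin.≟ _) ×-dec (_ Fin.≟ _)
    ; on-refl = λ y u → refl , refl
    ; on-sym = λ y (d , e) → sym d , sym e
    ; on-trans = λ y (d , e) (d′ , e′) → line-trans _ _ _ _ _ _ y d d′ , line-trans _ _ _ _ _ _ (y ⊠ y) e e′
    ; rank = rank ; rank<p = λ u y → Fin.toℕ<n (x₀ u ⊞ y)
    ; at = at ; on-at = on-at ; rank-at = rank-at ; at-rank = at-rank
    ; dir = dir ; rank-dir = rank-dir ; dir-rank = dir-rank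
    ; two-points = two-points ; no-triangle = no-triangle }

-- The random graph

does-true : ∀ {a} {P : Set a} (d : Dec P) → does d ≡ true → P
does-true (yes q) _ = q

does-cong : ∀ {a b} {P : Set a} {Q : Set b} (d : Dec P) (e : Dec Q) → (P → Q) → (Q → P) → does d ≡ does e
does-cong (yes q) e f g = sym (dec-true e (f q))
does-cong (no ¬q) e f g = sym (dec-false e (¬q ∘ g))

b2n-∧ : ∀ x y → b2n (x ∧ y) ≡ b2n x * b2n y
b2n-∧ true  y = sym (*-identityˡ _)
b2n-∧ false y = refl

∧∧-false : ∀ x y z → (x ≡ true → y ≡ true → z ≡ true → ⊥) → x ∧ (y ∧ z) ≡ false
∧∧-false true  true  true  f = ⊥-elim (f refl refl refl)
∧∧-false true  true  false f = refl
∧∧-false true  false _     f = refl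
∧∧-false false _     _     f = refl

b2n≤1 : ∀ x → b2n x ≤ 1
b2n≤1 true  = ≤-refl
b2n≤1 false = z≤n

∑deg : ∀ {n} → Graph n → Fin n → ℕ
∑deg G v = ∑ λ w → b2n (adj G v w)

∑size : ∀ {n} → (Fin n → Part) → ℕ
∑size f = ∑ λ v → b2n (inV' (f v))

∑cross : ∀ {n} → Graph n → (Fin n → Part) → ℕ
∑cross G f = ∑ λ u → ∑ λ v → b2n (isOne (f u) ∧ (isTwo (f v) ∧ adj G u v))

ones twos : ∀ {n} → (Fin n → Part) → Fin n → ℕ
ones f u = b2n (isOne (f u))
twos f u = b2n (isTwo (f u))

separated : Part → Part → Bool
separated one two = true
separated two one = true
separated _   _   = false

b2n-separated : ∀ a b → b2n (separated a b) ≡ b2n (isOne a) * b2n (isTwo b) + b2n (isTwo a) * b2n (isOne b)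
b2n-separated out out = refl
b2n-separated out one = refl
b2n-separated out two = refl
b2n-separated one out = refl
b2n-separated one one = refl
b2n-separated one two = refl
b2n-separated two out = refl
b2n-separated two one = refl
b2n-separated two two = refl

module Flags {p N : ℕ} (X : Space p N) .{{_ : NonZero p}} where
  open Space X
  open Counting X

  half : ℕ
  half = ⌈ p /2⌉

  instance
    half≢0 : NonZero half
    half≢0 = >-nonZero (⌈n/2⌉-mono (>-nonZero⁻¹ p))

  p≤2half : p ≤ half + half
  p≤2half = ≤-trans (≤-reflexive (sym (⌊n/2⌋+⌈n/2⌉≡n p))) (+-monoˡ-≤ half (⌊n/2⌋≤⌈n/2⌉ p))

  -- The pick of u in direction y is below range u y; keeping range u y ≥ p/2 bounds all edge
  -- probabilities by 2/p, and a rank of at least p/2 forces an edge.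
  range : Fin N → Fin p → ℕ
  range u y = rank u y ⊔ half

  half≤range : ∀ u y → half ≤ range u y
  half≤range u y = m≤n⊔m (rank u y) half

  range≤p : ∀ u y → range u y ≤ p
  range≤p u y = ⊔-lub (<⇒≤ (rank<p u y)) (⌈n/2⌉≤n p)

  -- A point with one of its directions, flattened into a single index so that all picks form one
  -- product space.
  Flag : Set
  Flag = Fin (N * p)

  onFlags : ∀ {a} {A : Set a} → (Fin N → Fin p → A) → Flag → A
  onFlags F i = F (proj₁ (remQuot {N} p i)) (proj₂ (remQuot {N} p i))

  onFlags-combine : ∀ {a} {A : Set a} (F : Fin N → Fin p → A) u y → onFlags F (combine u y) ≡ F u y
  onFlags-combine F u y = cong (λ q → F (proj₁ q) (proj₂ q)) (Fin.remQuot-combine {N} {p} u y)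

  ranges : Flag → ℕ
  ranges = onFlags range

  ∑-flags : (F : Fin N → Fin p → ℕ) → ∑ (onFlags F) ≡ ∑ (λ u → ∑ (λ y → F u y))
  ∑-flags F = trans (∑-combine N (onFlags F)) (∑-cong λ u → ∑-cong λ y → onFlags-combine F u y)

  -- The event at a flag is that its pick creates an edge within the relation `r`. Stable sets use
  -- `inside`, cross edges and degrees use `across`.
  module Below (r : Fin N → Fin N → Bool) where

    hit : Fin N → Fin p → ℕ → Bool
    hit u y t = does (t <? rank u y) ∧ r u (at u y t)

    hitᶠ : Flag → ℕ → Bool
    hitᶠ = onFlags hit

    hits≡ : ∀ ω → hits ranges hitᶠ ω ≡ ∑ (λ u → ∑ (λ y → b2n (hit u y (ω (combine u y)))))
    hits≡ ω = trans (∑-combine N {p} (λ i → b2n (hitᶠ i (ω i)))) (∑-cong λ u → ∑-cong λ y →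
      cong (λ h → b2n (h (ω (combine u y)))) (onFlags-combine hit u y))

    -- A value at or above the rank is never a hit, so the range can be cut down to the rank and
    -- then extended to `p`.
    expected≡ : expected ranges hitᶠ ≡ ∑ (λ u → ∑ (λ y → ∑ {p} (λ t → χ (toℕ t <? rank u y) * b2n (r u (at u y (toℕ t))))))
    expected≡ = trans (∑-flags (λ u y → ∑ {range u y} (λ t → b2n (hit u y (toℕ t))))) (∑-cong λ u → ∑-cong λ y → begin
      ∑ {range u y} (λ t → b2n (hit u y (toℕ t)))                                      ≡⟨ ∑-cong {range u y} (λ t → b2n-∧ (does (toℕ t <? rank u y)) _) ⟩
      ∑ {range u y} (λ t → χ (toℕ t <? rank u y) * b2n (r u (at u y (toℕ t))))         ≡⟨ ∑-< (rank u y) (range u y) (λ t → b2n (r u (at u y t))) (m≤m⊔n _ _) ⟩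
      ∑ {rank u y} (λ t → b2n (r u (at u y (toℕ t))))                                  ≡⟨ ∑-< (rank u y) p (λ t → b2n (r u (at u y t))) (<⇒≤ (rank<p u y)) ⟨
      ∑ {p} (λ t → χ (toℕ t <? rank u y) * b2n (r u (at u y (toℕ t))))                 ∎)
      where open ≡-Reasoning

  inside : (Fin N → Bool) → Fin N → Fin N → Bool
  inside S u v = S u ∧ S v

  across : (Fin N → Part) → Fin N → Fin N → Bool
  across f u v = separated (f u) (f v)

  expected-inside : ∀ S → expected ranges (Below.hitᶠ (inside S)) ≡ below (b2n ∘ S)
  expected-inside S = trans (Below.expected≡ (inside S)) (∑-cong λ u → ∑-cong λ y → trans
    (∑-cong λ t → trans (cong (χ (toℕ t <? rank u y) *_) (b2n-∧ (S u) _)) (arith (χ (toℕ t <? rank u y)) (b2n (S u)) _)) (∑-*ˡ (b2n (S u)) _))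
    where
    arith : ∀ x y z → x * (y * z) ≡ y * (x * z)
    arith = solve-∀

  -- The condition that the picked point be lower is dropped, after which each crossing pair is seen
  -- from both ends.
  expected-across : ∀ f → expected ranges (Below.hitᶠ (across f)) ≤ 2 * pairs (ones f) (twos f)
  expected-across f = begin
    expected ranges (Below.hitᶠ (across f))                                          ≡⟨ Below.expected≡ (across f) ⟩
    ∑ (λ u → ∑ (λ y → ∑ {p} (λ t → χ (toℕ t <? rank u y) * b2n (across f u (at u y (toℕ t))))))  ≤⟨ ∑-mono (λ u → ∑-mono λ y → ∑-mono {p} λ t → ≤-trans (*-monoˡ-≤ _ (χ≤1 (toℕ t <? rank u y))) (≤-reflexive (*-identityˡ _))) ⟩
    ∑ (λ u → ∑ (λ y → ∑ {p} (λ t → b2n (across f u (at u y (toℕ t))))))              ≡⟨ ∑-cong (λ u → ∑-cong λ y → trans (∑-cong {p} λ t → b2n-separated (f u) (f (at u y (toℕ t)))) (trans (∑-+ _ _) (cong₂ _+_ (trans (∑-*ˡ (ones f u) _) (cong (ones f u *_) (∑-line u y (twos f)))) (trans (∑-*ˡ (twos f u) _) (cong (twos f u *_) (∑-line u y (ones f))))))) ⟩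
    ∑ (λ u → ∑ (λ y → ones f u * local (twos f) y u + twos f u * local (ones f) y u)) ≡⟨ ∑-cong (λ u → trans (∑-+ _ _) (cong₂ _+_ (trans (∑-*ˡ (ones f u) _) (cong (ones f u *_) (∑-local (twos f) u))) (trans (∑-*ˡ (twos f u) _) (cong (twos f u *_) (∑-local (ones f) u))))) ⟩
    ∑ (λ u → ones f u * gain (twos f) u + twos f u * gain (ones f) u)                ≡⟨ ∑-+ _ _ ⟩
    pairs (twos f) (ones f) + pairs (ones f) (twos f)                                ≡⟨ cong₂ _+_ (pairs-comm (twos f) (ones f)) (sym (+-identityʳ _)) ⟩
    2 * pairs (ones f) (twos f)                                                      ∎
    where open ≤-Reasoning

  module Sample (ω : Flag → ℕ) (ω<range : ∀ i → ω i < ranges i) where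

    choice : Fin N → Fin p → ℕ
    choice u y = ω (combine u y)

    choice<range : ∀ u y → choice u y < range u y
    choice<range u y = subst (choice u y <_) (onFlags-combine range u y) (ω<range (combine u y))

    Step : Fin N → Fin N → Fin p → Set
    Step u v y = choice u y < rank u y × at u y (choice u y) ≡ v

    step? : ∀ u v y → Dec (Step u v y)
    step? u v y = (choice u y <? rank u y) ×-dec (at u y (choice u y) Fin.≟ v)

    Arrow : Fin N → Fin N → Set
    Arrow u v = ∃ (Step u v)

    arrow? : ∀ u v → Dec (Arrow u v)
    arrow? u v = Fin.any? (step? u v)

    Adj : Fin N → Fin N → Set
    Adj u v = Arrow u v ⊎ Arrow v u

    adj? : ∀ u v → Dec (Adj u v)
    adj? u v = arrow? u v ⊎-dec arrow? v u

    module _ {u v : Fin N} {y : Fin p} (s : Step u v y) where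

      step-on : On y u v
      step-on = subst (On y u) (proj₂ s) (on-at u y _)

      step-rank : rank v y ≡ choice u y
      step-rank = trans (cong (λ x → rank x y) (sym (proj₂ s))) (rank-at u y _ (<-trans (proj₁ s) (rank<p u y)))

      step-< : rank v y < rank u y
      step-< = subst (_< rank u y) (sym step-rank) (proj₁ s)

      step-≢ : u ≢ v
      step-≢ u≡v = <-irrefl (cong (λ x → rank x y) (sym u≡v)) step-<

    EdgeOn : Fin p → Fin N → Fin N → Set
    EdgeOn y u v = (rank v y ≡ choice u y × rank v y < rank u y) ⊎ (rank u y ≡ choice v y × rank u y < rank v y)

    adj-edge : ∀ {u v} → Adj u v → u ≢ v × ∃ λ y → On y u v × EdgeOn y u v
    adj-edge (inj₁ (y , s)) = step-≢ s , y , step-on s , inj₁ (step-rank s , step-< s)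
    adj-edge (inj₂ (y , s)) = step-≢ s ∘ sym , y , on-sym y (step-on s) , inj₂ (step-rank s , step-< s)

    -- Of three points on a line the highest one has chosen only one of the others.
    no-edge-triangle : ∀ {y u v w} → EdgeOn y u v → EdgeOn y v w → EdgeOn y u w → ⊥
    no-edge-triangle (inj₁ (a , _)) (inj₁ (_ , l)) (inj₁ (b , _)) = <-irrefl (trans b (sym a)) l
    no-edge-triangle (inj₁ (a , _)) (inj₂ (_ , l)) (inj₁ (b , _)) = <-irrefl (trans a (sym b)) l
    -- A cyclic orientation contradicts the order of the ranks directly.
    no-edge-triangle (inj₁ (_ , l)) (inj₁ (_ , m)) (inj₂ (_ , n)) = <-irrefl refl (<-trans l (<-trans n m))
    no-edge-triangle (inj₁ (_ , l)) (inj₂ (a , _)) (inj₂ (b , _)) = <-irrefl (trans a (sym b)) l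
    no-edge-triangle (inj₂ (a , _)) (inj₁ (b , _)) (inj₁ (_ , n)) = <-irrefl (trans b (sym a)) n
    no-edge-triangle (inj₂ (a , _)) (inj₁ (b , _)) (inj₂ (_ , n)) = <-irrefl (trans a (sym b)) n
    no-edge-triangle (inj₂ (_ , l)) (inj₂ (_ , m)) (inj₁ (_ , n)) = <-irrefl refl (<-trans l (<-trans m n))
    no-edge-triangle (inj₂ (_ , l)) (inj₂ (b , _)) (inj₂ (a , _)) = <-irrefl (trans a (sym b)) l

    graph : Graph N
    graph = record
      { adj    = λ u v → does (adj? u v)
      ; sym    = λ u v → does-cong (adj? u v) (adj? v u) Sum.swap Sum.swap
      ; irrefl = λ v → dec-false (adj? v v) λ a → proj₁ (adj-edge a) refl }

    triangle-free : TriangleFree graph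
    triangle-free u v w uv vw uw
      with u≢v , x , o₁ , e₁ ← adj-edge (does-true (adj? u v) uv)
      with v≢w , y , o₂ , e₂ ← adj-edge (does-true (adj? v w) vw)
      with u≢w , z , o₃ , e₃ ← adj-edge (does-true (adj? u w) uw)
      with refl , refl ← no-triangle u≢v v≢w u≢w o₁ o₂ o₃
      = no-edge-triangle e₁ e₂ e₃

    ∑-step≤arrow : ∀ u v → ∑ (λ y → χ (step? u v y)) ≤ χ (arrow? u v)
    ∑-step≤arrow u v with arrow? u v
    ... | yes _ = ∑-unique (step? u v) λ y z s s′ → two-points (step-≢ s) (step-on s) (step-on s′)
    ... | no ∄  = ≤-reflexive (trans (∑-cong λ y → χ-no (step? u v y) λ s → ∄ (y , s)) (trans (∑-const p 0) (*-zeroʳ p)))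

    -- `dir u` inverts the rank, so over the `p` directions the ranks are 0, ..., p - 1, of which
    -- `half` lie below `half`.
    ∑-rank≥half : ∀ u → ∑ (λ y → χ (half ≤? rank u y)) + half ≡ p
    ∑-rank≥half u = begin
      ∑ (λ y → χ (half ≤? rank u y)) + half                                ≡⟨ cong (_+ half) (∑-cong λ y → cong (λ r → χ (half ≤? r)) (sym (Fin.toℕ-fromℕ< (rank<p u y)))) ⟩
      ∑ (λ y → χ (half ≤? toℕ (rankᶠ u y))) + half                         ≡⟨ cong (_+ half) (∑-bij (rankᶠ u) (dir u)
                                                                                (λ y → dir-rank u _ y (sym (Fin.toℕ-fromℕ< (rank<p u y))))
                                                                                (λ r → Fin.toℕ-injective (trans (Fin.toℕ-fromℕ< _) (rank-dir u r)))
                                                                                (λ r → χ (half ≤? toℕ r))) ⟩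
      ∑ {p} (λ r → χ (half ≤? toℕ r)) + half                               ≡⟨ cong (∑ {p} (λ r → χ (half ≤? toℕ r)) +_) (sym (trans (∑-< half p (const 1) (⌈n/2⌉≤n p)) (trans (∑-const half 1) (*-identityʳ half)))) ⟩
      ∑ {p} (λ r → χ (half ≤? toℕ r)) + ∑ {p} (λ r → χ (toℕ r <? half) * 1) ≡⟨ sym (∑-+ _ _) ⟩
      ∑ {p} (λ r → χ (half ≤? toℕ r) + χ (toℕ r <? half) * 1)              ≡⟨ ∑-cong (λ r → dichotomy (toℕ r)) ⟩
      ∑ {p} (const 1)                                                      ≡⟨ trans (∑-const p 1) (*-identityʳ p) ⟩
      p                                                                    ∎
      where
      open ≡-Reasoning
      dichotomy : ∀ r → χ (half ≤? r) + χ (r <? half) * 1 ≡ 1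
      dichotomy r with ≤-<-connex half r
      ... | inj₁ q = cong₂ (λ x y → x + y * 1) (χ-yes (half ≤? r) q) (χ-no (r <? half) (≤⇒≯ q))
      ... | inj₂ q = cong₂ (λ x y → x + y * 1) (χ-no (half ≤? r) (<⇒≱ q)) (χ-yes (r <? half) q)

    -- A rank of at least `half` equals its range, so the pick certainly lies below it, and
    -- different directions give different neighbours.
    p≤deg+half : ∀ u → p ≤ ∑deg graph u + half
    p≤deg+half u = begin
      p                                                               ≡⟨ ∑-rank≥half u ⟨
      ∑ (λ y → χ (half ≤? rank u y)) + half                           ≤⟨ +-monoˡ-≤ half (∑-mono λ y → χ≤ (half ≤? rank u y) λ q → ≤-reflexive (sym (χ-yes (choice u y <? rank u y) (subst (choice u y <_) (m≥n⇒m⊔n≡m q) (choice<range u y))))) ⟩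
      ∑ (λ y → χ (choice u y <? rank u y)) + half                     ≡⟨ cong (_+ half) (∑-cong λ y → sym (trans (∑-cong λ v → χ-× (choice u y <? rank u y) (at u y (choice u y) Fin.≟ v)) (trans (∑-*ˡ (χ (choice u y <? rank u y)) _) (trans (cong (χ (choice u y <? rank u y) *_) (trans (∑-cong λ v → sym (*-identityʳ _)) (∑-δ′ (at u y (choice u y)) (const 1)))) (*-identityʳ _))))) ⟩
      ∑ (λ y → ∑ (λ v → χ (step? u v y))) + half                      ≡⟨ cong (_+ half) (∑-swap λ y v → χ (step? u v y)) ⟩
      ∑ (λ v → ∑ (λ y → χ (step? u v y))) + half                      ≤⟨ +-monoˡ-≤ half (∑-mono λ v → ≤-trans (∑-step≤arrow u v) (χ≤ (arrow? u v) λ a → ≤-reflexive (sym (χ-yes (adj? u v) (inj₁ a))))) ⟩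
      ∑deg graph u + half                                             ∎
      where open ≤-Reasoning

    adj≤steps : ∀ u v → b2n (adj graph u v) ≤ ∑ (λ y → χ (step? u v y)) + ∑ (λ y → χ (step? v u y))
    adj≤steps u v = χ≤ (adj? u v) λ
      { (inj₁ (y , s)) → m≤n⇒m≤n+o _ (≤-trans (≤-reflexive (sym (χ-yes (step? u v y) s))) (term≤∑ (λ y → χ (step? u v y)) y))
      ; (inj₂ (y , s)) → m≤n⇒m≤o+n (∑ (λ y → χ (step? u v y))) (≤-trans (≤-reflexive (sym (χ-yes (step? v u y) s))) (term≤∑ (λ y → χ (step? v u y)) y)) }

    -- Every edge between the parts comes from a pick at one of its ends, and that pick is a hit.
    hits-across : ∀ f → ∑cross graph f ≤ hits ranges (Below.hitᶠ (across f)) ω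
    hits-across f = begin
      ∑ (λ u → ∑ (λ v → b2n (isOne (f u) ∧ (isTwo (f v) ∧ adj graph u v))))     ≤⟨ ∑-mono (λ u → ∑-mono λ v → ≤-trans (≤-reflexive (trans (b2n-∧ (isOne (f u)) _) (trans (cong (A u *_) (b2n-∧ (isTwo (f v)) _)) (sym (*-assoc (A u) (B v) _))))) (≤-trans (*-monoʳ-≤ (A u * B v) (adj≤steps u v)) (≤-reflexive (*-distribˡ-+ (A u * B v) (e u v) (e v u))))) ⟩
      ∑ (λ u → ∑ (λ v → A u * B v * e u v + A u * B v * e v u))                 ≡⟨ trans (∑-cong λ u → ∑-+ _ _) (∑-+ _ _) ⟩
      ∑ (λ u → ∑ (λ v → A u * B v * e u v)) + ∑ (λ u → ∑ (λ v → A u * B v * e v u)) ≡⟨ cong (∑ (λ u → ∑ (λ v → A u * B v * e u v)) +_) (∑-swap λ u v → A u * B v * e v u) ⟩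
      ∑ (λ u → ∑ (λ v → A u * B v * e u v)) + ∑ (λ u → ∑ (λ v → A v * B u * e u v)) ≡⟨ trans (sym (∑-+ _ _)) (∑-cong λ u → sym (∑-+ _ _)) ⟩
      ∑ (λ u → ∑ (λ v → A u * B v * e u v + A v * B u * e u v))                 ≡⟨ ∑-cong (λ u → trans (∑-cong λ v → trans (arith (A u) (B v) (A v) (B u) (e u v)) (sym (∑-*ˡ (A u * B v + B u * A v) _))) (∑-swap λ v y → (A u * B v + B u * A v) * χ (step? u v y))) ⟩
      ∑ (λ u → ∑ (λ y → ∑ (λ v → (A u * B v + B u * A v) * χ (step? u v y))))   ≡⟨ ∑-cong (λ u → ∑-cong λ y → trans (∑-cong λ v → trans (cong ((A u * B v + B u * A v) *_) (χ-× (choice u y <? rank u y) (at u y (choice u y) Fin.≟ v))) (arith′ (A u * B v + B u * A v) (χ (choice u y <? rank u y)) (χ (at u y (choice u y) Fin.≟ v)))) (trans (∑-*ˡ (χ (choice u y <? rank u y)) _) (cong (χ (choice u y <? rank u y) *_) (∑-δ′ (at u y (choice u y)) (λ v → A u * B v + B u * A v))))) ⟩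
      ∑ (λ u → ∑ (λ y → χ (choice u y <? rank u y) * (A u * B (at u y (choice u y)) + B u * A (at u y (choice u y))))) ≡⟨ ∑-cong (λ u → ∑-cong λ y → sym (trans (b2n-∧ (does (choice u y <? rank u y)) _) (cong (χ (choice u y <? rank u y) *_) (b2n-separated (f u) (f (at u y (choice u y))))))) ⟩
      ∑ (λ u → ∑ (λ y → b2n (Below.hit (across f) u y (choice u y))))           ≡⟨ Below.hits≡ (across f) ω ⟨
      hits ranges (Below.hitᶠ (across f)) ω                                     ∎
      where
      open ≤-Reasoning
      A = ones f
      B = twos f
      e : Fin N → Fin N → ℕ
      e u v = ∑ λ y → χ (step? u v y)
      arith : ∀ a b c d e → a * b * e + c * d * e ≡ (a * b + d * c) * e
      arith = solve-∀
      arith′ : ∀ x y z → x * (y * z) ≡ y * (z * x)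
      arith′ = solve-∀

    hits-inside : ∀ S → (∀ u v → adj graph u v ≡ true → S u ≡ true → S v ≡ true → ⊥) →
                  no-hit ranges (Below.hitᶠ (inside S)) ω ≡ 1
    hits-inside S stable = trans (∏-cong λ i → cong (1 ∸_) (cong b2n (miss i))) (trans (∏-const (N * p) 1) (^-zeroˡ (N * p)))
      where
      miss′ : ∀ u y → Below.hit (inside S) u y (choice u y) ≡ false
      miss′ u y = ∧∧-false (does (choice u y <? rank u y)) (S u) (S (at u y (choice u y))) λ l →
        stable u _ (dec-true (adj? u (at u y (choice u y))) (inj₁ (y , does-true (choice u y <? rank u y) l , refl)))
      miss : ∀ i → Below.hitᶠ (inside S) i (ω i) ≡ false
      miss i = subst (λ j → Below.hitᶠ (inside S) i (ω j) ≡ false) (Fin.combine-remQuot {N} p i)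
        (miss′ (proj₁ (remQuot {N} p i)) (proj₂ (remQuot {N} p i)))

-- Colourings, bad events and the first-moment argument

nonzero? : ℕ → Bool
nonzero? zero    = false
nonzero? (suc _) = true

sign≡ : ∀ k → b2n (nonzero? k) ≡ sign k
sign≡ zero    = refl
sign≡ (suc k) = refl

-- Partitions become colourings by 0, 1, 2 for `union-bound`. With 0 for `out`, the support is V',
-- whose size determines the cost.
part : ℕ → Part
part 0 = out
part 1 = one
part _ = two

code : Part → ℕ
code out = 0
code one = 1
code two = 2

part-code : ∀ a → part (code a) ≡ a
part-code out = refl
part-code one = refl
part-code two = refl

code<3 : ∀ a → code a < 3
code<3 out = s≤s z≤n
code<3 one = s≤s (s≤s z≤n)
code<3 two = s≤s (s≤s (s≤s z≤n))

sign-part : ∀ k → b2n (isOne (part k)) + b2n (isTwo (part k)) ≡ sign k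
sign-part 0             = refl
sign-part 1             = refl
sign-part (suc (suc k)) = refl

inV-part : ∀ k → b2n (inV' (part k)) ≡ sign k
inV-part 0             = refl
inV-part 1             = refl
inV-part (suc (suc k)) = refl

4^≡2^ : ∀ k → 4 ^ k ≡ 2 ^ (2 * k)
4^≡2^ k = ^-*-assoc 2 2 k

-- N ≤ 2^L serves the union bounds over colourings, 4N ≤ 2^p the one over vertices.
module Base {p N : ℕ} (X : Space p N) .{{_ : NonZero p}} (L : ℕ) (N≤2^L : N ≤ 2 ^ L) (4N≤2^p : 4 * N ≤ 2 ^ p) where
  open Space X
  open Counting X
  open Flags X

  M : ℕ
  M = ∏ ranges

  M>0 : 0 < M
  M>0 = ≤-trans (≤-reflexive (sym (trans (∏-const (N * p) 1) (^-zeroˡ (N * p))))) (∏-mono {f = const 1} {ranges} λ i → ≤-trans (>-nonZero⁻¹ half) (half≤range _ _))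

  N>0 : 0 < N
  N>0 = subst (0 <_) (sym N≡p³) (>-nonZero⁻¹ (p * p * p) {{m*n≢0 (p * p) p {{m*n≢0 p p}}}})

  -- In `below-bound` the part 2L + 8 pays for twice the exponent Lm + 4m, and the remaining 1 for
  -- the diagonal pairs.
  s : ℕ
  s = p * p * (2 * L + 9)

  insideᶜ : (Fin N → ℕ) → Flag → ℕ → Bool
  insideᶜ c = Below.hitᶠ (inside (nonzero? ∘ c))

  acrossᶜ : (Fin N → ℕ) → Flag → ℕ → Bool
  acrossᶜ c = Below.hitᶠ (across (part ∘ c))

  -- Of the coefficient, 16 L + 80 is the exponential moment and L pays for the union bound.
  θ : (Fin N → ℕ) → ℕ
  θ c = (17 * L + 80) * support c + 6

  large-stable : (Flag → ℕ) → (Fin N → ℕ) → ℕ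
  large-stable ω c = χ (s ≤? support c) * no-hit ranges (insideᶜ c) ω

  -- The first factor restricts the union bound to colourings whose first part is as small as a
  -- stable set must be.
  many-across : (Flag → ℕ) → (Fin N → ℕ) → ℕ
  many-across ω c = χ (∑ (ones (part ∘ c)) ≤? s) * χ (θ c ≤? hits ranges (acrossᶜ c) ω)

  -- Turns the degree of `v` into a number of cross edges, so that degrees are controlled by the
  -- same hits.
  star : Fin N → Fin N → Part
  star v w with w Fin.≟ v
  ... | yes _ = one
  ... | no _  = two

  large-degree : (Flag → ℕ) → Fin N → ℕ
  large-degree ω v = χ (9 * p ≤? hits ranges (Below.hitᶠ (across (star v))) ω)

  -- `L * support c` is the price of the union bound. Two colours lose a factor 4 there, so the
  -- additional exponent 4 leaves a quarter: 2⁴ = 4 · 4.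
  large-stable-bound : ∀ c → ∑Ω ranges (λ ω → large-stable ω c) * 2 ^ (L * support c + 4) ≤ M
  large-stable-bound c = ≤-trans
    (≤-reflexive (trans (cong (_* 2 ^ E) (∑Ω-*ˡ ranges (χ (s ≤? support c)) _)) (*-assoc (χ (s ≤? support c)) _ _)))
    (χ*≤ (s ≤? support c) λ s≤m → lower-tail ranges (insideᶜ c) p E (λ i → range≤p _ _)
      (≤-trans (below-bound s≤m) (≤-reflexive (sym (expected-inside (nonzero? ∘ c))))))
    where
    E = L * support c + 4
    A : Fin N → ℕ
    A = b2n ∘ nonzero? ∘ c
    m = support c
    ∑A≡m : ∑ A ≡ m
    ∑A≡m = ∑-cong λ i → sign≡ (c i)
    below-bound : s ≤ m → p * E ≤ below A
    below-bound s≤m = *-cancelˡ-≤ (2 * p) {{m*n≢0 2 p}} (begin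
      2 * p * (p * (L * m + 4))                       ≤⟨ *-monoʳ-≤ (2 * p) (*-monoʳ-≤ p (+-monoʳ-≤ (L * m) (*-monoʳ-≤ 4 1≤m))) ⟩
      2 * p * (p * (L * m + 4 * m))                   ≤⟨ +-cancelʳ-≤ (p * p * m) _ _ (begin
        2 * p * (p * (L * m + 4 * m)) + p * p * m       ≡⟨ arith₁ p L m ⟩
        p * p * (2 * L + 9) * m                         ≤⟨ *-monoˡ-≤ m s≤m ⟩
        m * m                                           ≡⟨ cong₂ _*_ (sym ∑A≡m) (sym ∑A≡m) ⟩
        ∑ A * ∑ A                                       ≤⟨ ∑²≤pairs A ⟩
        p * pairs A A                                   ≤⟨ *-monoʳ-≤ p (pairs≤below A λ u → b2n≤1 (nonzero? (c u))) ⟩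
        p * (2 * below A + p * ∑ A)                     ≡⟨ cong (λ z → p * (2 * below A + p * z)) ∑A≡m ⟩
        p * (2 * below A + p * m)                       ≡⟨ arith₂ p (below A) m ⟩
        2 * p * below A + p * p * m                     ∎) ⟩
      2 * p * below A                                 ∎)
      where
      open ≤-Reasoning
      1≤m : 1 ≤ m
      1≤m = ≤-trans (>-nonZero⁻¹ s {{m*n≢0 (p * p) (2 * L + 9) {{m*n≢0 p p}} {{>-nonZero (≤-trans (s≤s z≤n) (m≤n+m 9 (2 * L)))}}}}) s≤m
      arith₁ : ∀ p L m → 2 * p * (p * (L * m + 4 * m)) + p * p * m ≡ p * p * (2 * L + 9) * m
      arith₁ = solve-∀
      arith₂ : ∀ p b m → p * (2 * b + p * m) ≡ 2 * p * b + p * p * m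
      arith₂ = solve-∀

  -- Three colours lose 4² in the union bound, so the additional exponent is 6: 2⁶ = 4 · 4². The
  -- threshold `θ c` exceeds 2E by exactly the exponent claimed.
  many-across-bound : ∀ c → ∑Ω ranges (λ ω → many-across ω c) * 2 ^ (L * support c + 6) ≤ M
  many-across-bound c = ≤-trans
    (≤-reflexive (trans (cong (_* 2 ^ (L * m + 6)) (∑Ω-*ˡ ranges (χ (∑ A ≤? s)) _)) (*-assoc (χ (∑ A ≤? s)) _ _)))
    (χ*≤ (∑ A ≤? s) λ ∑A≤s → *-cancelʳ-≤ _ _ (4 ^ E) {{m^n≢0 4 E}} (begin
      x * 2 ^ (L * m + 6) * 4 ^ E                   ≡⟨ cong (λ z → x * 2 ^ (L * m + 6) * z) (4^≡2^ E) ⟩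
      x * 2 ^ (L * m + 6) * 2 ^ (2 * E)             ≡⟨ *-assoc x _ _ ⟩
      x * (2 ^ (L * m + 6) * 2 ^ (2 * E))           ≡⟨ cong (x *_) (sym (^-distribˡ-+-* 2 (L * m + 6) (2 * E))) ⟩
      x * 2 ^ (L * m + 6 + 2 * E)                   ≡⟨ cong (λ z → x * 2 ^ z) (arith L m) ⟩
      x * 2 ^ θ c                                   ≤⟨ upper-tail ranges (acrossᶜ c) half E (θ c) (λ i → half≤range _ _) (expected-bound ∑A≤s) ⟩
      M * 4 ^ E                                     ∎))
    where
    open ≤-Reasoning
    f = part ∘ c
    A = ones f
    B = twos f
    m = support c
    x = ∑Ω ranges (λ ω → χ (θ c ≤? hits ranges (acrossᶜ c) ω))
    -- From p · expected ≤ 2(s + p²)m with s + p² = p²(2L + 10) and p ≤ 2 · half.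
    E = 4 * (2 * L + 10) * m
    arith : ∀ L m → L * m + 6 + 2 * (4 * (2 * L + 10) * m) ≡ (17 * L + 80) * m + 6
    arith = solve-∀
    sizes : ∑ A + ∑ B ≡ m
    sizes = trans (sym (∑-+ A B)) (∑-cong λ i → sign-part (c i))
    expected-bound : ∑ A ≤ s → expected ranges (acrossᶜ c) ≤ half * E
    expected-bound ∑A≤s = *-cancelˡ-≤ p (begin
      p * expected ranges (acrossᶜ c)               ≤⟨ *-monoʳ-≤ p (expected-across f) ⟩
      p * (2 * pairs A B)                           ≡⟨ arith₁ p (pairs A B) ⟩
      2 * (p * pairs A B)                           ≤⟨ *-monoʳ-≤ 2 (pairs≤ A B (λ u → b2n≤1 (isOne (f u))) (λ u → b2n≤1 (isTwo (f u)))) ⟩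
      2 * ((∑ A + p * p) * (∑ A + ∑ B))             ≡⟨ cong (λ z → 2 * ((∑ A + p * p) * z)) sizes ⟩
      2 * ((∑ A + p * p) * m)                       ≤⟨ *-monoʳ-≤ 2 (*-monoˡ-≤ m (+-monoˡ-≤ (p * p) ∑A≤s)) ⟩
      2 * ((p * p * (2 * L + 9) + p * p) * m)       ≡⟨ arith₂ p L m ⟩
      p * (p * (2 * (2 * L + 10) * m))              ≤⟨ *-monoʳ-≤ p (*-monoˡ-≤ (2 * (2 * L + 10) * m) p≤2half) ⟩
      p * ((half + half) * (2 * (2 * L + 10) * m))  ≡⟨ cong (p *_) (arith₃ half L m) ⟩
      p * (half * E)                                ∎)
      where
      arith₁ : ∀ p x → p * (2 * x) ≡ 2 * (p * x)
      arith₁ = solve-∀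
      arith₂ : ∀ p L m → 2 * ((p * p * (2 * L + 9) + p * p) * m) ≡ p * (p * (2 * (2 * L + 10) * m))
      arith₂ = solve-∀
      arith₃ : ∀ h L m → (h + h) * (2 * (2 * L + 10) * m) ≡ h * (4 * (2 * L + 10) * m)
      arith₃ = solve-∀

  ∑-star : ∀ v → ∑ (ones (star v)) ≡ 1
  ∑-star v = trans (∑-cong term) (∑-δ-1 v)
    where
    term : ∀ w → ones (star v) w ≡ χ (w Fin.≟ v)
    term w with w Fin.≟ v
    ... | yes _ = refl
    ... | no _  = refl

  -- The at most p² collinear pairs at `v`, seen from both ends, give an expected count of at most
  -- half · 4p. The threshold 9p = 2 · 4p + p leaves a chance of 2^(-p) per vertex.
  large-degree-bound : ∀ v → ∑Ω ranges (λ ω → large-degree ω v) * 2 ^ p ≤ M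
  large-degree-bound v = *-cancelʳ-≤ _ _ (4 ^ (4 * p)) {{m^n≢0 4 (4 * p)}} (begin
    x * 2 ^ p * 4 ^ (4 * p)          ≡⟨ cong (x * 2 ^ p *_) (4^≡2^ (4 * p)) ⟩
    x * 2 ^ p * 2 ^ (2 * (4 * p))    ≡⟨ *-assoc x _ _ ⟩
    x * (2 ^ p * 2 ^ (2 * (4 * p)))  ≡⟨ cong (x *_) (sym (^-distribˡ-+-* 2 p _)) ⟩
    x * 2 ^ (p + 2 * (4 * p))        ≡⟨ cong (λ z → x * 2 ^ z) (arith p) ⟩
    x * 2 ^ (9 * p)                  ≤⟨ upper-tail ranges (Below.hitᶠ (across (star v))) half (4 * p) (9 * p) (λ i → half≤range _ _) expected-bound ⟩
    M * 4 ^ (4 * p)                  ∎)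
    where
    open ≤-Reasoning
    x = ∑Ω ranges (λ ω → large-degree ω v)
    A = ones (star v)
    B = twos (star v)
    arith : ∀ p → p + 2 * (4 * p) ≡ 9 * p
    arith = solve-∀
    expected-bound : expected ranges (Below.hitᶠ (across (star v))) ≤ half * (4 * p)
    expected-bound = begin
      expected ranges (Below.hitᶠ (across (star v)))  ≤⟨ expected-across (star v) ⟩
      2 * ∑ (λ u → B u * gain A u)                    ≤⟨ *-monoʳ-≤ 2 (∑-mono λ u → ≤-trans (*-monoˡ-≤ (gain A u) (b2n≤1 (isTwo (star v u)))) (≤-reflexive (*-identityˡ _))) ⟩
      2 * ∑ (gain A)                                  ≡⟨ cong (2 *_) (trans (∑-gain A) (cong (p * p *_) (∑-star v))) ⟩
      2 * (p * p * 1)                                 ≡⟨ arith₁ p ⟩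
      p * (2 * p)                                     ≤⟨ *-monoˡ-≤ (2 * p) p≤2half ⟩
      (half + half) * (2 * p)                         ≡⟨ arith₂ half p ⟩
      half * (4 * p)                                  ∎
      where
      arith₁ : ∀ p → 2 * (p * p * 1) ≡ p * (2 * p)
      arith₁ = solve-∀
      arith₂ : ∀ h p → (h + h) * (2 * p) ≡ h * (4 * p)
      arith₂ = solve-∀

  bad₁ bad₂ bad₃ bad : (Flag → ℕ) → ℕ
  bad₁ ω = ∑Ω (const 2) (large-stable ω)
  bad₂ ω = ∑Ω (const 3) (many-across ω)
  bad₃ ω = ∑ (large-degree ω)
  bad ω = bad₁ ω + bad₂ ω + bad₃ ω

  4bad₁≤M : 4 * ∑Ω ranges bad₁ ≤ M
  4bad₁≤M = *-cancelʳ-≤ _ _ 4 (begin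
    4 * ∑Ω ranges bad₁ * 4                    ≡⟨ arith (∑Ω ranges bad₁) ⟩
    ∑Ω ranges bad₁ * 2 ^ 4                    ≡⟨ cong (_* 2 ^ 4) (∑Ω-swap ranges (const 2) large-stable) ⟩
    ∑Ω {N} (const 2) (λ c → ∑Ω ranges (λ ω → large-stable ω c)) * 2 ^ 4 ≤⟨ union-bound 1 L M 4 _ N≤2^L large-stable-bound ⟩
    M * 4                                     ∎)
    where
    open ≤-Reasoning
    arith : ∀ x → 4 * x * 4 ≡ x * 16
    arith = solve-∀

  4bad₂≤M : 4 * ∑Ω ranges bad₂ ≤ M
  4bad₂≤M = *-cancelʳ-≤ _ _ 16 (begin
    4 * ∑Ω ranges bad₂ * 16                   ≡⟨ arith (∑Ω ranges bad₂) ⟩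
    ∑Ω ranges bad₂ * 2 ^ 6                    ≡⟨ cong (_* 2 ^ 6) (∑Ω-swap ranges (const 3) many-across) ⟩
    ∑Ω {N} (const 3) (λ c → ∑Ω ranges (λ ω → many-across ω c)) * 2 ^ 6 ≤⟨ union-bound 2 L M 6 _ N≤2^L many-across-bound ⟩
    M * 16                                    ∎)
    where
    open ≤-Reasoning
    arith : ∀ x → 4 * x * 16 ≡ x * 64
    arith = solve-∀

  4bad₃≤M : 4 * ∑Ω ranges bad₃ ≤ M
  4bad₃≤M = *-cancelʳ-≤ _ _ N {{>-nonZero N>0}} (begin
    4 * ∑Ω ranges bad₃ * N                                    ≡⟨ arith (∑Ω ranges bad₃) N ⟩
    ∑Ω ranges bad₃ * (4 * N)                                  ≤⟨ *-monoʳ-≤ (∑Ω ranges bad₃) 4N≤2^p ⟩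
    ∑Ω ranges bad₃ * 2 ^ p                                    ≡⟨ cong (_* 2 ^ p) (∑Ω-∑ ranges large-degree) ⟩
    ∑ (λ v → ∑Ω ranges (λ ω → large-degree ω v)) * 2 ^ p      ≡⟨ ∑-*ʳ _ (2 ^ p) ⟨
    ∑ (λ v → ∑Ω ranges (λ ω → large-degree ω v) * 2 ^ p)      ≤⟨ ∑-mono large-degree-bound ⟩
    ∑ {N} (const M)                                           ≡⟨ trans (∑-const N M) (*-comm N M) ⟩
    M * N                                                     ∎)
    where
    open ≤-Reasoning
    arith : ∀ x N → 4 * x * N ≡ x * (4 * N)
    arith = solve-∀

  bad<M : ∑Ω ranges bad < M
  bad<M = *-cancelˡ-< 4 _ _ (begin-strict
    4 * ∑Ω ranges bad                                                ≡⟨ cong (4 *_) (trans (∑Ω-+ ranges _ bad₃) (cong (_+ ∑Ω ranges bad₃) (∑Ω-+ ranges bad₁ bad₂))) ⟩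
    4 * (∑Ω ranges bad₁ + ∑Ω ranges bad₂ + ∑Ω ranges bad₃)           ≡⟨ arith (∑Ω ranges bad₁) (∑Ω ranges bad₂) (∑Ω ranges bad₃) ⟩
    4 * ∑Ω ranges bad₁ + 4 * ∑Ω ranges bad₂ + 4 * ∑Ω ranges bad₃     ≤⟨ +-mono-≤ (+-mono-≤ 4bad₁≤M 4bad₂≤M) 4bad₃≤M ⟩
    M + M + M                                                        <⟨ m<n+m (M + M + M) M>0 ⟩
    M + (M + M + M)                                                  ≡⟨ arith′ M ⟩
    4 * M                                                            ∎)
    where
    open ≤-Reasoning
    arith : ∀ x y z → 4 * (x + y + z) ≡ 4 * x + 4 * y + 4 * z
    arith = solve-∀
    arith′ : ∀ x → x + (x + x + x) ≡ 4 * x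
    arith′ = solve-∀

  record Good (G : Graph N) : Set where
    field
      no-triangles : TriangleFree G
      degree-lower : ∀ v → p ≤ ∑deg G v + half
      degree-upper : ∀ v → ∑deg G v < 9 * p
      sparse       : ∀ f → Stable₁ G f → ∑cross G f < (17 * L + 80) * ∑size f + 6

  module Outcome (ω : Flag → ℕ) (ω<ranges : ∀ i → ω i < ranges i) (bad≡0 : bad ω ≡ 0) where
    open Sample ω ω<ranges

    bad₁≡0 : bad₁ ω ≡ 0
    bad₁≡0 = m+n≡0⇒m≡0 (bad₁ ω) (m+n≡0⇒m≡0 (bad₁ ω + bad₂ ω) bad≡0)

    bad₂≡0 : bad₂ ω ≡ 0
    bad₂≡0 = m+n≡0⇒n≡0 (bad₁ ω) (m+n≡0⇒m≡0 (bad₁ ω + bad₂ ω) bad≡0)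

    bad₃≡0 : bad₃ ω ≡ 0
    bad₃≡0 = m+n≡0⇒n≡0 (bad₁ ω + bad₂ ω) bad≡0

    χ≡0 : ∀ {P : Set} (d : Dec P) → χ d ≤ 0 → ¬ P
    χ≡0 d le q = contradiction (≤-trans (≤-reflexive (sym (χ-yes d q))) le) λ ()

    degree-upper : ∀ v → ∑deg graph v < 9 * p
    degree-upper v = ≤-<-trans (≤-trans deg≤cross (hits-across (star v)))
      (≰⇒> (χ≡0 (9 * p ≤? hits ranges (Below.hitᶠ (across (star v))) ω) (≤-trans (term≤∑ (large-degree ω) v) (≤-reflexive bad₃≡0))))
      where
      star-centre : star v v ≡ one
      star-centre with v Fin.≟ v
      ... | yes _ = refl
      ... | no v≢ = contradiction refl v≢
      term : ∀ w → b2n (adj graph v w) ≤ b2n (isOne (star v v) ∧ (isTwo (star v w) ∧ adj graph v w))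
      term w rewrite star-centre with w Fin.≟ v
      ... | yes refl = ≤-reflexive (cong b2n (Graph.irrefl graph v))
      ... | no _     = ≤-refl
      deg≤cross : ∑deg graph v ≤ ∑cross graph (star v)
      deg≤cross = ≤-trans (∑-mono term) (term≤∑ (λ u → ∑ λ w → b2n (isOne (star v u) ∧ (isTwo (star v w) ∧ adj graph u w))) v)

    -- The indicator of V₁ is one of the colourings summed in `bad₁`; a larger stable set would
    -- contribute 1 to a total of 0.
    ones≤s : ∀ f → Stable₁ graph f → ∑ (ones f) ≤ s
    ones≤s f stable = <⇒≤ (≰⇒> λ s≤ones → absurd s≤ones (∑Ω-term (const 2) (large-stable ω) (ones f) λ i → s≤s (b2n≤1 (isOne (f i)))))
      where
      absurd : s ≤ ∑ (ones f) → (∃ λ c → (∀ i → c i ≡ ones f i) × large-stable ω c ≤ bad₁ ω) → ⊥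
      absurd s≤ones (c , e , le) = contradiction (begin
        1                                                       ≡⟨ cong₂ _*_ (sym (χ-yes (s ≤? support c) (≤-trans s≤ones (≤-reflexive (sym support≡))))) (sym (hits-inside (nonzero? ∘ c) stableᶜ)) ⟩
        large-stable ω c                                        ≤⟨ le ⟩
        bad₁ ω                                                  ≡⟨ bad₁≡0 ⟩
        0                                                       ∎) λ ()
        where
        open ≤-Reasoning
        sign-b2n : ∀ x → sign (b2n x) ≡ b2n x
        sign-b2n true  = refl
        sign-b2n false = refl
        support≡ : support c ≡ ∑ (ones f)
        support≡ = ∑-cong λ i → trans (cong sign (e i)) (sign-b2n (isOne (f i)))
        nonzero⇒one : ∀ a → nonzero? (b2n (isOne a)) ≡ true → a ≡ one
        nonzero⇒one one _ = refl
        stableᶜ : ∀ u v → adj graph u v ≡ true → nonzero? (c u) ≡ true → nonzero? (c v) ≡ true → ⊥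
        stableᶜ u v a nu nv = stable u v a (nonzero⇒one (f u) (trans (cong nonzero? (sym (e u))) nu))
                                           (nonzero⇒one (f v) (trans (cong nonzero? (sym (e v))) nv))

    sparse : ∀ f → Stable₁ graph f → ∑cross graph f < (17 * L + 80) * ∑size f + 6
    sparse f stable = from (∑Ω-term (const 3) (many-across ω) (code ∘ f) (λ i → code<3 (f i)))
     where
     from : (∃ λ c → (∀ i → c i ≡ code (f i)) × many-across ω c ≤ bad₂ ω) → ∑cross graph f < (17 * L + 80) * ∑size f + 6
     from (c , e , le) = begin-strict
        ∑cross graph f                              ≡⟨ ∑-cong (λ u → ∑-cong λ v → cong₂ (λ a b → b2n (isOne a ∧ (isTwo b ∧ adj graph u v))) (sym (f≡ u)) (sym (f≡ v))) ⟩
        ∑cross graph (part ∘ c)                     ≤⟨ hits-across (part ∘ c) ⟩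
        hits ranges (acrossᶜ c) ω                   <⟨ ≰⇒> (χ≡0 (θ c ≤? hits ranges (acrossᶜ c) ω) not-many) ⟩
        (17 * L + 80) * support c + 6               ≡⟨ cong (λ z → (17 * L + 80) * z + 6) (∑-cong λ i → trans (sym (inV-part (c i))) (cong (b2n ∘ inV') (f≡ i))) ⟩
        (17 * L + 80) * ∑size f + 6                 ∎
        where
        open ≤-Reasoning
        f≡ : ∀ i → part (c i) ≡ f i
        f≡ i = trans (cong part (e i)) (part-code (f i))
        few-ones : ∑ (ones (part ∘ c)) ≤ s
        few-ones = ≤-trans (≤-reflexive (∑-cong λ i → cong (b2n ∘ isOne) (f≡ i))) (ones≤s f stable)
        not-many : χ (θ c ≤? hits ranges (acrossᶜ c) ω) ≤ 0
        not-many = begin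
          χ (θ c ≤? hits ranges (acrossᶜ c) ω)      ≡⟨ trans (sym (*-identityˡ _)) (cong (_* χ (θ c ≤? hits ranges (acrossᶜ c) ω)) (sym (χ-yes (∑ (ones (part ∘ c)) ≤? s) few-ones))) ⟩
          many-across ω c                           ≤⟨ le ⟩
          bad₂ ω                                    ≡⟨ bad₂≡0 ⟩
          0                                         ∎

  good : ∃ Good
  good = let ω , ω<ranges , bad≡0 = ∑Ω-pigeonhole ranges bad bad<M in
    Sample.graph ω ω<ranges , record
    { no-triangles = Sample.triangle-free ω ω<ranges
    ; degree-lower = Sample.p≤deg+half ω ω<ranges
    ; degree-upper = Outcome.degree-upper ω ω<ranges bad≡0
    ; sparse       = Outcome.sparse ω ω<ranges bad≡0 }

-- Primes in intervals

module PrimeGaps where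
  open import Data.Nat.Combinatorics using (_C_; nCk≡nC[n∸k]; nCn≡1; nC1≡n; nCk+nC[k+1]≡[n+1]C[k+1]; k![n∸k]!∣n!)
  open import Data.Nat.Combinatorics.Specification using (k>n⇒nCk≡0; nCk≡n!/k![n-k]!)
  open import Data.Nat.Coprimality using (Coprime; coprime-divisor)
  open import Data.Nat.Induction using (<-rec)

  nC0≡1 : ∀ n → n C 0 ≡ 1
  nC0≡1 n = trans (nCk≡nC[n∸k] {n = n} z≤n) (nCn≡1 n)

  [1+k]*[1+n]C[1+k] : ∀ n k → suc k * (suc n C suc k) ≡ suc n * (n C k)
  [1+k]*[1+n]C[1+k] zero zero    = refl
  [1+k]*[1+n]C[1+k] zero (suc k) = begin
    suc (suc k) * (1 C suc (suc k))  ≡⟨ cong (suc (suc k) *_) (k>n⇒nCk≡0 {1} {suc (suc k)} (s≤s (s≤s z≤n))) ⟩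
    suc (suc k) * 0                  ≡⟨ *-zeroʳ (suc (suc k)) ⟩
    0                                ≡⟨ cong (1 *_) (sym (k>n⇒nCk≡0 {0} {suc k} (s≤s z≤n))) ⟩
    1 * (0 C suc k)                  ∎
    where open ≡-Reasoning
  [1+k]*[1+n]C[1+k] (suc n) zero    = trans (*-identityˡ _) (trans (nC1≡n (suc (suc n))) (sym (trans (cong (suc (suc n) *_) (nC0≡1 (suc n))) (*-identityʳ _))))
  [1+k]*[1+n]C[1+k] (suc n) (suc k) = begin
    suc (suc k) * (suc (suc n) C suc (suc k))                                         ≡⟨ cong (suc (suc k) *_) (sym (nCk+nC[k+1]≡[n+1]C[k+1] (suc n) (suc k))) ⟩
    suc (suc k) * (suc n C suc k + suc n C suc (suc k))                               ≡⟨ arith₁ k (suc n C suc k) (suc n C suc (suc k)) ⟩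
    suc n C suc k + (suc k * (suc n C suc k) + suc (suc k) * (suc n C suc (suc k)))   ≡⟨ cong (suc n C suc k +_) (cong₂ _+_ ([1+k]*[1+n]C[1+k] n k) ([1+k]*[1+n]C[1+k] n (suc k))) ⟩
    suc n C suc k + (suc n * (n C k) + suc n * (n C suc k))                           ≡⟨ cong (suc n C suc k +_) (sym (*-distribˡ-+ (suc n) (n C k) (n C suc k))) ⟩
    suc n C suc k + suc n * (n C k + n C suc k)                                       ≡⟨ cong (λ z → suc n C suc k + suc n * z) (nCk+nC[k+1]≡[n+1]C[k+1] n k) ⟩
    suc (suc n) * (suc n C suc k)                                                     ∎
    where
    open ≡-Reasoning
    arith₁ : ∀ k a b → (2 + k) * (a + b) ≡ a + ((1 + k) * a + (2 + k) * b)
    arith₁ = solve-∀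

  k*[1+n]Ck+[1+n]*nCk : ∀ n k → k * (suc n C k) + suc n * (n C k) ≡ suc n * (suc n C k)
  k*[1+n]Ck+[1+n]*nCk n zero    = cong (suc n *_) (trans (nC0≡1 n) (sym (nC0≡1 (suc n))))
  k*[1+n]Ck+[1+n]*nCk n (suc k) = begin
    suc k * (suc n C suc k) + suc n * (n C suc k)   ≡⟨ cong (_+ suc n * (n C suc k)) ([1+k]*[1+n]C[1+k] n k) ⟩
    suc n * (n C k) + suc n * (n C suc k)           ≡⟨ *-distribˡ-+ (suc n) (n C k) (n C suc k) ⟨
    suc n * (n C k + n C suc k)                     ≡⟨ cong (suc n *_) (nCk+nC[k+1]≡[n+1]C[k+1] n k) ⟩
    suc n * (suc n C suc k)                         ∎
    where open ≡-Reasoning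

  -- Leibniz's harmonic triangle: 1/((n+1) C(n,k)) = 1/((n+2) C(n+1,k)) + 1/((n+2) C(n+1,k+1)).
  leibniz : ∀ D n k → suc n * (n C k) ∣ D → suc (suc n) * (suc n C k) ∣ D → suc (suc n) * (suc n C suc k) ∣ D
  leibniz D n k (divides a D≡a) (divides b D≡b) = divides (a ∸ b) (*-cancelˡ-≡ D _ (suc k) (sym (begin
    suc k * ((a ∸ b) * (suc (suc n) * y))            ≡⟨ arith₁ (suc k) (a ∸ b) (suc (suc n)) y ⟩
    (a ∸ b) * (suc (suc n) * (suc k * y))            ≡⟨ cong (λ w → (a ∸ b) * (suc (suc n) * w)) ([1+k]*[1+n]C[1+k] n k) ⟩
    (a ∸ b) * Q                                      ≡⟨ *-distribʳ-∸ Q a b ⟩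
    a * Q ∸ b * Q                                    ≡⟨ cong (_∸ b * Q) aQ ⟩
    b * Q + suc k * D ∸ b * Q                        ≡⟨ m+n∸m≡n (b * Q) (suc k * D) ⟩
    suc k * D                                        ∎)))
    where
    open ≡-Reasoning
    x = suc n C k
    y = suc n C suc k
    z = n C k
    Q = suc (suc n) * (suc n * z)
    arith₁ : ∀ k d m y → k * (d * (m * y)) ≡ d * (m * (k * y))
    arith₁ = solve-∀
    arith₂ : ∀ a m n z → a * (m * (n * z)) ≡ m * (a * (n * z))
    arith₂ = solve-∀
    arith₃ : ∀ b n x k → (2 + n) * (b * ((2 + n) * x)) ≡ b * ((2 + n) * ((1 + n) * x)) + b * ((2 + n) * x)
    arith₃ = solve-∀
    arith₄ : ∀ b m k x w → b * (m * (k * x + w)) + b * (m * x) ≡ b * (m * w) + (1 + k) * (b * (m * x))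
    arith₄ = solve-∀
    aQ : a * Q ≡ b * Q + suc k * D
    aQ = begin
      a * Q                                                                          ≡⟨ arith₂ a (suc (suc n)) (suc n) z ⟩
      suc (suc n) * (a * (suc n * z))                                                ≡⟨ cong (suc (suc n) *_) (trans (sym D≡a) D≡b) ⟩
      suc (suc n) * (b * (suc (suc n) * x))                                          ≡⟨ arith₃ b n x k ⟩
      b * (suc (suc n) * (suc n * x)) + b * (suc (suc n) * x)                        ≡⟨ cong (λ w → b * (suc (suc n) * w) + b * (suc (suc n) * x)) (sym (k*[1+n]Ck+[1+n]*nCk n k)) ⟩
      b * (suc (suc n) * (k * x + suc n * z)) + b * (suc (suc n) * x)                ≡⟨ arith₄ b (suc (suc n)) k x (suc n * z) ⟩
      b * Q + suc k * (b * (suc (suc n) * x))                                        ≡⟨ cong (λ w → b * Q + suc k * w) (sym D≡b) ⟩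
      b * Q + suc k * D                                                              ∎

  -- `D` stands for a common multiple of 1, ..., n + 1. The edge k = 0 of Leibniz's triangle holds
  -- by assumption, and `leibniz` moves inward from it. The middle entry forces every such `D` to be
  -- exponentially large.
  [1+n]*nCk∣D : ∀ D n k → k ≤ n → (∀ j → j ≤ n → suc j ∣ D) → suc n * (n C k) ∣ D
  [1+n]*nCk∣D D n       zero    _          div = subst (_∣ D) (sym (trans (cong (suc n *_) (nC0≡1 n)) (*-identityʳ _))) (div n ≤-refl)
  [1+n]*nCk∣D D (suc n) (suc k) (s≤s k≤n) div = leibniz D n k
    ([1+n]*nCk∣D D n k k≤n λ j j≤n → div j (m≤n⇒m≤1+n j≤n))
    ([1+n]*nCk∣D D (suc n) k (m≤n⇒m≤1+n k≤n) div)

  2^m≤[2m]Cm : ∀ m → 2 ^ m ≤ (m + m) C m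
  2^m≤[2m]Cm zero    = ≤-refl
  2^m≤[2m]Cm (suc m) = begin
    2 ^ m + (2 ^ m + 0)                                    ≤⟨ +-mono-≤ (2^m≤[2m]Cm m) (≤-trans (≤-reflexive (+-identityʳ _)) (2^m≤[2m]Cm m)) ⟩
    (m + m) C m + (m + m) C m                              ≤⟨ +-mono-≤ left right ⟩
    suc (m + m) C m + suc (m + m) C suc m                  ≡⟨ nCk+nC[k+1]≡[n+1]C[k+1] (suc (m + m)) m ⟩
    suc (suc (m + m)) C suc m                              ≡⟨ cong (λ z → suc z C suc m) (sym (+-suc m m)) ⟩
    (suc m + suc m) C suc m                                ∎
    where
    open ≤-Reasoning
    right : (m + m) C m ≤ suc (m + m) C suc m
    right = ≤-trans (m≤m+n _ _) (≤-reflexive (nCk+nC[k+1]≡[n+1]C[k+1] (m + m) m))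
    left : (m + m) C m ≤ suc (m + m) C m
    left = go m
      where
      go : ∀ k → (m + m) C k ≤ suc (m + m) C k
      go zero    = ≤-reflexive (trans (nC0≡1 (m + m)) (sym (nC0≡1 (suc (m + m)))))
      go (suc k) = ≤-trans (m≤n+m _ _) (≤-reflexive (nCk+nC[k+1]≡[n+1]C[k+1] (m + m) k))

  nCk≤2^n : ∀ n k → n C k ≤ 2 ^ n
  nCk≤2^n n       zero    = ≤-trans (≤-reflexive (nC0≡1 n)) (m^n>0 2 n)
  nCk≤2^n zero    (suc k) = ≤-trans (≤-reflexive (k>n⇒nCk≡0 {0} {suc k} (s≤s z≤n))) z≤n
  nCk≤2^n (suc n) (suc k) = begin
    suc n C suc k            ≡⟨ nCk+nC[k+1]≡[n+1]C[k+1] n k ⟨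
    n C k + n C suc k        ≤⟨ +-mono-≤ (nCk≤2^n n k) (nCk≤2^n n (suc k)) ⟩
    2 ^ n + 2 ^ n            ≡⟨ cong (2 ^ n +_) (sym (+-identityʳ _)) ⟩
    2 ^ suc n                ∎
    where open ≤-Reasoning

  prime∤! : ∀ {q} → Prime q → ∀ k → k < q → ¬ q ∣ k !
  prime∤! q-prime zero    k<q d = contradiction (∣⇒≤ d) (<⇒≱ (nonTrivial⇒n>1 _ {{prime⇒nonTrivial q-prime}}))
  prime∤! q-prime (suc k) k<q d with euclidsLemma (suc k) (k !) q-prime d
  ... | inj₁ e = >⇒∤ k<q e
  ... | inj₂ e = prime∤! q-prime k (<-trans (n<1+n k) k<q) e

  -- q divides (2m)! but neither factor m! of the denominator.
  prime∣[2m]Cm : ∀ {q m} → Prime q → m < q → q ≤ m + m → q ∣ (m + m) C m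
  prime∣[2m]Cm {q} {m} q-prime m<q q≤2m with euclidsLemma ((m + m) C m) (m ! * (m + m ∸ m) !) q-prime (subst (q ∣_) (sym factorial) q∣)
    where
    factorial : ((m + m) C m) * (m ! * (m + m ∸ m) !) ≡ (m + m) !
    factorial = trans (cong (_* (m ! * (m + m ∸ m) !)) (nCk≡n!/k![n-k]! (m≤m+n m m)))
      (m/n*n≡m {{m !* (m + m ∸ m) !≢0}} (k![n∸k]!∣n! (m≤m+n m m)))
    q∣ : q ∣ (m + m) !
    q∣ = ∣-trans (n∣n! q {{prime⇒nonZero q-prime}}) (m≤n⇒m!∣n! q≤2m)
      where
      n∣n! : ∀ n .{{_ : NonZero n}} → n ∣ n !
      n∣n! (suc n) = m∣m*n (n !)
  ... | inj₁ d = d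
  ... | inj₂ d with euclidsLemma (m !) ((m + m ∸ m) !) q-prime d
  ... | inj₁ e = contradiction e (prime∤! q-prime m m<q)
  ... | inj₂ e = contradiction (subst (λ z → q ∣ z !) (m+n∸m≡n m m) e) (prime∤! q-prime m m<q)

  primePart : ℕ → ℕ
  primePart n = if does (prime? n) then n else 1

  primorial : ℕ → ℕ
  primorial zero    = 1
  primorial (suc n) = primePart (suc n) * primorial n

  prime∣primorial : ∀ {q} → Prime q → ∀ n → q ≤ n → q ∣ primorial n
  prime∣primorial q-prime zero    q≤0 = contradiction (≤-trans (nonTrivial⇒n>1 _ {{prime⇒nonTrivial q-prime}}) q≤0) λ ()
  prime∣primorial {q} q-prime (suc n) q≤1+n with m≤n⇒m<n∨m≡n q≤1+n
  ... | inj₁ q<1+n = ∣n⇒∣m*n (primePart (suc n)) (prime∣primorial q-prime n (s≤s⁻¹ q<1+n))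
  ... | inj₂ refl with prime? (suc n)
  ... | yes _ = m∣m*n (primorial n)
  ... | no ¬q = contradiction q-prime ¬q

  prime∤primorial : ∀ {q} → Prime q → ∀ n → n < q → ¬ q ∣ primorial n
  prime∤primorial q-prime zero    n<q d = prime∤! q-prime 0 n<q d
  prime∤primorial q-prime (suc n) n<q d with euclidsLemma (primePart (suc n)) (primorial n) q-prime d
  ... | inj₂ e = prime∤primorial q-prime n (<-trans (n<1+n n) n<q) e
  ... | inj₁ e with prime? (suc n)
  ... | yes _ = >⇒∤ n<q e
  ... | no  _ = prime∤! q-prime 0 (≤-trans (s≤s z≤n) n<q) e

  -- `R` is the product of the primes in (m, j + m]. Each of them divides C(2m, m), and a new prime
  -- does not divide the product of the earlier ones, so it divides the cofactor.
  primorial-split : ∀ m j → j ≤ m → ∃ λ R → primorial (j + m) ≡ R * primorial m × R ∣ (m + m) C m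
  primorial-split m zero    _   = 1 , sym (*-identityˡ _) , 1∣ _
  primorial-split m (suc j) j<m with primorial-split m j (<⇒≤ j<m)
  ... | R , e , R∣ with prime? (suc (j + m))
  ... | no _ = R , trans (*-identityˡ _) e , R∣
  ... | yes q-prime = q * R , trans (cong (q *_) e) (sym (*-assoc q R _)) , q*R∣ R∣
    where
    q = suc (j + m)
    q∣ : q ∣ (m + m) C m
    q∣ = prime∣[2m]Cm q-prime (s≤s (m≤n+m m j)) (+-monoˡ-≤ m j<m)
    q∤R : ¬ q ∣ R
    q∤R d = prime∤primorial q-prime (j + m) ≤-refl (subst (q ∣_) (sym e) (∣m⇒∣m*n (primorial m) d))
    q*R∣ : R ∣ (m + m) C m → q * R ∣ (m + m) C m
    q*R∣ (divides t eq) with euclidsLemma t R q-prime (subst (q ∣_) eq q∣)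
    ... | inj₂ d = contradiction d q∤R
    ... | inj₁ (divides t′ refl) = divides t′ (trans eq (*-assoc t′ q R))

  primorial-2m : ∀ m → primorial (m + m) ≤ 4 ^ m * primorial m
  primorial-2m m with primorial-split m m ≤-refl
  ... | R , e , R∣ = ≤-trans (≤-reflexive e) (*-monoˡ-≤ (primorial m) (begin
    R              ≤⟨ ∣⇒≤ {{>-nonZero (≤-trans (m^n>0 2 m) (2^m≤[2m]Cm m))}} R∣ ⟩
    (m + m) C m    ≤⟨ nCk≤2^n (m + m) m ⟩
    2 ^ (m + m)    ≡⟨ cong (λ z → 2 ^ (m + z)) (sym (+-identityʳ m)) ⟩
    2 ^ (2 * m)    ≡⟨ ^-*-assoc 2 2 m ⟨
    4 ^ m          ∎))
    where open ≤-Reasoning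

  primorial-mono : ∀ {m n} → m ≤ n → primorial m ≤ primorial n
  primorial-mono {m} {n} m≤n = go (≤⇒≤′ m≤n)
    where
    primePart>0 : ∀ k → 1 ≤ primePart (suc k)
    primePart>0 k with prime? (suc k)
    ... | yes _ = s≤s z≤n
    ... | no _  = s≤s z≤n
    go : ∀ {n} → m ≤′ n → primorial m ≤ primorial n
    go ≤′-refl             = ≤-refl
    go (≤′-step {n} m≤n) = ≤-trans (go m≤n) (≤-trans (≤-reflexive (sym (*-identityˡ _))) (*-monoˡ-≤ (primorial n) (primePart>0 n)))

  -- Erdős's doubling argument: the primes in (h, 2h] cost 4^h, and 4^h · 16^h = 4^(3h) ≤ 16^n for h
  -- = ⌈n/2⌉ and n ≥ 2.
  primorial≤16^n : ∀ n → primorial n ≤ 16 ^ n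
  primorial≤16^n = <-rec _ step
    where
    open ≤-Reasoning
    step : ∀ n → (∀ {k} → k < n → primorial k ≤ 16 ^ k) → primorial n ≤ 16 ^ n
    step 0 _ = ≤-refl
    step 1 _ = s≤s z≤n
    step n@(suc (suc k)) rec = begin
      primorial n               ≤⟨ primorial-mono (≤-trans (≤-reflexive (sym (⌊n/2⌋+⌈n/2⌉≡n n))) (+-monoˡ-≤ h (⌊n/2⌋≤⌈n/2⌉ n))) ⟩
      primorial (h + h)         ≤⟨ primorial-2m h ⟩
      4 ^ h * primorial h       ≤⟨ *-monoʳ-≤ (4 ^ h) (rec (⌈n/2⌉<n k)) ⟩
      4 ^ h * 16 ^ h            ≡⟨ cong (4 ^ h *_) (^-*-assoc 4 2 h) ⟩
      4 ^ h * 4 ^ (2 * h)       ≡⟨ ^-distribˡ-+-* 4 h (2 * h) ⟨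
      4 ^ (h + 2 * h)           ≤⟨ ^-monoʳ-≤ 4 (3h≤2n k) ⟩
      4 ^ (2 * n)               ≡⟨ ^-*-assoc 4 2 n ⟨
      16 ^ n                    ∎
      where
      h = ⌈ n /2⌉
      3h≤2n : ∀ k → ⌈ suc (suc k) /2⌉ + 2 * ⌈ suc (suc k) /2⌉ ≤ 2 * suc (suc k)
      3h≤2n 0 = s≤s (s≤s (s≤s z≤n))
      3h≤2n 1 = ≤-refl
      3h≤2n (suc (suc k)) = begin
        suc (c + 2 * suc c)                ≡⟨ arith₁ c ⟩
        3 + (c + 2 * c)                    ≤⟨ +-mono-≤ (n≤1+n 3) (3h≤2n k) ⟩
        4 + 2 * suc (suc k)                ≡⟨ arith₂ k ⟩
        2 * suc (suc (suc (suc k)))        ∎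
        where
        c = ⌈ suc (suc k) /2⌉
        arith₁ : ∀ c → 1 + (c + 2 * (1 + c)) ≡ 3 + (c + 2 * c)
        arith₁ = solve-∀
        arith₂ : ∀ k → 4 + 2 * (2 + k) ≡ 2 * (4 + k)
        arith₂ = solve-∀

  prime-divisor : ∀ n → 1 < n → ∃ λ q → Prime q × q ∣ n
  prime-divisor = <-rec _ step
    where
    step : ∀ n → (∀ {k} → k < n → 1 < k → ∃ λ q → Prime q × q ∣ k) → 1 < n → ∃ λ q → Prime q × q ∣ n
    step n rec 1<n with prime? n
    ... | yes n-prime = n , n-prime , ∣-refl
    ... | no ¬prime with ¬prime⇒composite {{n>1⇒nonTrivial 1<n}} ¬prime
    ... | hasNonTrivialDivisor {divisor = d} d<n d∣n with rec d<n (nonTrivial⇒n>1 d)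
    ... | q , q-prime , q∣d = q , q-prime , ∣-trans q∣d d∣n

  prime-power-split : ∀ {q} → Prime q → ∀ n → 0 < n → ∃₂ λ e r → n ≡ q ^ e * r × ¬ q ∣ r
  prime-power-split {q} q-prime = <-rec _ step
    where
    step : ∀ n → (∀ {k} → k < n → 0 < k → ∃₂ λ e r → k ≡ q ^ e * r × ¬ q ∣ r) → 0 < n → ∃₂ λ e r → n ≡ q ^ e * r × ¬ q ∣ r
    step n rec 0<n with q ∣? n
    ... | no q∤n = 0 , n , sym (*-identityˡ n) , q∤n
    ... | yes (divides k refl) with rec {k} k<n 0<k
      where
      0<k : 0 < k
      0<k = n≢0⇒n>0 λ { refl → contradiction 0<n λ () }
      k<n : k < k * q
      k<n = m<m*n k q {{>-nonZero 0<k}} (nonTrivial⇒n>1 q {{prime⇒nonTrivial q-prime}})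
    ... | e , r , k≡ , q∤r = suc e , r , trans (cong (_* q) k≡) (arith (q ^ e) r q) , q∤r
      where
      arith : ∀ x r q → x * r * q ≡ q * x * r
      arith = solve-∀

  prime∤⇒coprime : ∀ {q r} → Prime q → ¬ q ∣ r → Coprime r q
  prime∤⇒coprime q-prime q∤r (d∣r , d∣q) with prime⇒irreducible q-prime d∣q
  ... | inj₁ d≡1  = d≡1
  ... | inj₂ refl = contradiction d∣r q∤r

  -- Strong induction that splits off the full power of one prime. The cofactor is coprime to that
  -- prime, so it divides `D` jointly with the power.
  prime-powers⇒∣ : ∀ D n → 0 < n → (∀ q e → Prime q → q ^ e ∣ n → q ^ e ∣ D) → n ∣ D
  prime-powers⇒∣ D = <-rec _ step
    where
    step : ∀ n → (∀ {k} → k < n → 0 < k → (∀ q e → Prime q → q ^ e ∣ k → q ^ e ∣ D) → k ∣ D) →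
           0 < n → (∀ q e → Prime q → q ^ e ∣ n → q ^ e ∣ D) → n ∣ D
    step 1 _ _ _ = 1∣ D
    step n@(suc (suc _)) rec 0<n div with prime-divisor n (s≤s (s≤s z≤n))
    ... | q , q-prime , q∣n with prime-power-split q-prime n 0<n
    ... | zero  , r , n≡ , q∤r = contradiction (subst (q ∣_) (trans n≡ (*-identityˡ r)) q∣n) q∤r
    ... | suc e , r , n≡ , q∤r = subst (_∣ D) (sym n≡) (multiply (div q (suc e) q-prime (subst (q ^ suc e ∣_) (sym n≡) (m∣m*n r))))
      where
      0<r : 0 < r
      0<r = n≢0⇒n>0 λ { refl → contradiction (trans n≡ (*-zeroʳ (q ^ suc e))) λ () }
      instance
        q≢0 : NonZero q
        q≢0 = prime⇒nonZero q-prime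
      1<q^ : 1 < q ^ suc e
      1<q^ = ≤-trans (nonTrivial⇒n>1 q {{prime⇒nonTrivial q-prime}}) (m≤m*n q (q ^ e) {{m^n≢0 q e}})
      r<n : r < n
      r<n = subst (r <_) (sym (trans n≡ (*-comm (q ^ suc e) r))) (m<m*n r (q ^ suc e) {{>-nonZero 0<r}} 1<q^)
      r∣n : r ∣ n
      r∣n = subst (r ∣_) (sym n≡) (n∣m*n (q ^ suc e))
      r∣D : r ∣ D
      r∣D = rec r<n 0<r λ q′ e′ q′-prime d → div q′ e′ q′-prime (∣-trans d r∣n)
      cancel : ∀ k t → r ∣ q ^ k * t → r ∣ t
      cancel zero    t d = subst (r ∣_) (*-identityˡ t) d
      cancel (suc k) t d = cancel k t (coprime-divisor (prime∤⇒coprime q-prime q∤r) (subst (r ∣_) (*-assoc q (q ^ k) t) d))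
      multiply : q ^ suc e ∣ D → q ^ suc e * r ∣ D
      multiply (divides t D≡) = subst (q ^ suc e * r ∣_) (sym (trans D≡ (*-comm t (q ^ suc e)))) (*-monoʳ-∣ (q ^ suc e) (cancel (suc e) t (subst (r ∣_) (trans D≡ (*-comm t (q ^ suc e))) r∣D)))

  -- The search descends from the last argument. Starting at `n` is high enough for b ≥ 2 because e
  -- ≤ 2^e.
  floorLog : ℕ → ℕ → ℕ → ℕ
  floorLog b n zero    = 0
  floorLog b n (suc k) with b ^ suc k ≤? n
  ... | yes _ = suc k
  ... | no _  = floorLog b n k

  b^floorLog≤n : ∀ b n k → 0 < n → b ^ floorLog b n k ≤ n
  b^floorLog≤n b n zero    0<n = 0<n
  b^floorLog≤n b n (suc k) 0<n with b ^ suc k ≤? n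
  ... | yes le = le
  ... | no _   = b^floorLog≤n b n k 0<n

  e≤floorLog : ∀ b n k e → e ≤ k → b ^ e ≤ n → e ≤ floorLog b n k
  e≤floorLog b n zero    e e≤k le = e≤k
  e≤floorLog b n (suc k) e e≤k le with b ^ suc k ≤? n | m≤n⇒m<n∨m≡n e≤k
  ... | yes _ | _          = e≤k
  ... | no _  | inj₁ e<1+k = e≤floorLog b n k e (s≤s⁻¹ e<1+k) le
  ... | no ≰  | inj₂ refl  = contradiction le ≰

  topPower : ℕ → ℕ → ℕ
  topPower n b = b ^ floorLog b n n

  e≤2^e : ∀ e → e ≤ 2 ^ e
  e≤2^e zero    = z≤n
  e≤2^e (suc e) = ≤-trans (+-mono-≤ (m^n>0 2 e) (e≤2^e e)) (+-monoʳ-≤ (2 ^ e) (≤-reflexive (sym (+-identityʳ (2 ^ e)))))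

  power∣topPower : ∀ n b e → 1 < b → b ^ e ≤ n → b ^ e ∣ topPower n b
  power∣topPower n b e 1<b le = m≤n⇒m^∣ (e≤floorLog b n n e (≤-trans (≤-trans (e≤2^e e) (^-monoˡ-≤ e 1<b)) le) le)
    where
    m≤n⇒m^∣ : ∀ {i j} → i ≤ j → b ^ i ∣ b ^ j
    m≤n⇒m^∣ {i} {j} i≤j = divides (b ^ (j ∸ i)) (trans (cong (b ^_) (sym (m∸n+n≡m i≤j))) (^-distribˡ-+-* b (j ∸ i) i))

  ∣∏ : ∀ {n} (f : Fin n → ℕ) i → f i ∣ ∏ f
  ∣∏ f zero    = m∣m*n _
  ∣∏ f (suc i) = ∣n⇒∣m*n (f zero) (∣∏ (f ∘ suc) i)

  -- Composite bases may stay in the product: each factor is at most `n`, and n^s with s near √n is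
  -- small against an exponential in n.
  topPowers : ℕ → ℕ → ℕ
  topPowers s n = ∏ {s} λ i → topPower n (suc (toℕ i))

  topPowers≤n^s : ∀ s n → 0 < n → topPowers s n ≤ n ^ s
  topPowers≤n^s s n 0<n = ≤-trans (∏-mono {s} λ i → b^floorLog≤n (suc (toℕ i)) n n 0<n) (≤-reflexive (∏-const s n))

  topPowers>0 : ∀ s n → 0 < topPowers s n
  topPowers>0 s n = ≤-trans (≤-reflexive (sym (trans (∏-const s 1) (^-zeroˡ s)))) (∏-mono {s} {const 1} λ i → m^n>0 (suc (toℕ i)) (floorLog (suc (toℕ i)) n n))

  topPower∣topPowers : ∀ s n b → 0 < b → b ≤ s → topPower n b ∣ topPowers s n
  topPower∣topPowers s n (suc b) _ b<s = subst (λ z → topPower n (suc z) ∣ topPowers s n) (Fin.toℕ-fromℕ< b<s)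
    (∣∏ (λ i → topPower n (suc (toℕ i))) (fromℕ< b<s))

  integerRoot : ∀ k .{{_ : NonZero k}} n → ∃ λ s → s ^ k ≤ n × n < suc s ^ k
  integerRoot (suc k) zero    = 0 , z≤n , m^n>0 1 (suc k)
  integerRoot k (suc n) with integerRoot k n
  ... | s , s^k≤n , n<[1+s]^k with suc s ^ k ≤? suc n
  ... | yes le = suc s , le , ≤-<-trans n<[1+s]^k (^-monoˡ-< k (n<1+n (suc s)))
  ... | no ≰   = s , m≤n⇒m≤1+n s^k≤n , ≰⇒> ≰

  -- Primes above s divide no j ≤ n twice, and by hypothesis none of them lies between x and n.
  ∣primorial*topPowers : ∀ x n s → n < suc s ^ 2 → (∀ q → Prime q → q ≤ n → q ≤ x) →
                         ∀ j → 0 < j → j ≤ n → j ∣ primorial x * topPowers s n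
  ∣primorial*topPowers x n s n<s² gap j 0<j j≤n = prime-powers⇒∣ _ j 0<j go
    where
    go : ∀ q e → Prime q → q ^ e ∣ j → q ^ e ∣ primorial x * topPowers s n
    go q e q-prime q^e∣j with q ≤? s
    ... | yes q≤s = ∣n⇒∣m*n (primorial x) (∣-trans (power∣topPower n q e (nonTrivial⇒n>1 q {{prime⇒nonTrivial q-prime}}) q^e≤n)
            (topPower∣topPowers s n q (>-nonZero⁻¹ q {{prime⇒nonZero q-prime}}) q≤s))
      where
      q^e≤n : q ^ e ≤ n
      q^e≤n = ≤-trans (∣⇒≤ {{>-nonZero 0<j}} q^e∣j) j≤n
    ... | no q≰s = large e (≤-trans (∣⇒≤ {{>-nonZero 0<j}} q^e∣j) j≤n)
      where
      instance
        q≢0 : NonZero q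
        q≢0 = prime⇒nonZero q-prime
      large : ∀ e → q ^ e ≤ n → q ^ e ∣ primorial x * topPowers s n
      large zero    _  = 1∣ _
      large (suc zero) le = subst (_∣ _) (sym (*-identityʳ q)) (∣m⇒∣m*n (topPowers s n) (prime∣primorial q-prime x (gap q q-prime (subst (_≤ n) (*-identityʳ q) le))))
      large (suc (suc e)) le = contradiction (<-≤-trans n<s² (≤-trans (^-monoˡ-≤ 2 (≰⇒> q≰s)) (^-monoʳ-≤ q {2} {suc (suc e)} (s≤s (s≤s z≤n))))) (≤⇒≯ le)

  -- Raising s by one doubles the right side and multiplies the left side by at most two, since 2k ≤
  -- s + 2.
  [1+s]^k<2^s : ∀ k s₀ → k + k ≤ 2 + s₀ → suc s₀ ^ k < 2 ^ s₀ → ∀ s → s₀ ≤ s → suc s ^ k < 2 ^ s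
  [1+s]^k<2^s k s₀ 2k≤ base s s₀≤s = subst (λ z → suc z ^ k < 2 ^ z) (m∸n+n≡m s₀≤s) (go (s ∸ s₀))
    where
    open ≤-Reasoning
    go : ∀ d → suc (d + s₀) ^ k < 2 ^ (d + s₀)
    go zero    = base
    go (suc d) = begin-strict
      suc (suc (d + s₀)) ^ k    ≤⟨ [1+m]^k≤2*m^k (suc (d + s₀)) k (≤-trans 2k≤ (s≤s (s≤s (m≤n+m s₀ d)))) ⟩
      suc (d + s₀) ^ k * 2      <⟨ *-monoˡ-< 2 (go d) ⟩
      2 ^ (d + s₀) * 2          ≡⟨ *-comm (2 ^ (d + s₀)) 2 ⟩
      2 ^ suc (d + s₀)          ∎

  -- Without such a prime, `D` is a common multiple of 1, ..., n for n = 10x + 1 and s = ⌊√n⌋, so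
  -- 32^x ≤ D ≤ 16^x · n^s and 2^x ≤ (s + 1)^(2s). As s² ≤ 10x + 1, this contradicts (s + 1)^21 <
  -- 2^s. The factor 10 makes 32 = 2^(10/2) exceed the 16 of `primorial≤16^n`, and 21 = 2 · 10 + 1.
  bertrand-above : ∀ k s₀ → 21 ≤ k → k + k ≤ 2 + s₀ → suc s₀ ^ k < 2 ^ s₀ →
                   ∀ x → suc s₀ ^ 2 ≤ x → ∃ λ q → Prime q × x < q × q ≤ suc (10 * x)
  bertrand-above k s₀ 21≤k 2k≤ base x x-large with Fin.any? {suc (suc (10 * x))} (λ i → (x <? toℕ i) ×-dec prime? (toℕ i))
  ... | yes (i , x<i , i-prime) = toℕ i , i-prime , x<i , s≤s⁻¹ (Fin.toℕ<n i)
  ... | no ∄ = ⊥-elim (absurd (integerRoot 2 n))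
    where
    open ≤-Reasoning
    n = suc (10 * x)
    gap : ∀ q → Prime q → q ≤ n → q ≤ x
    gap q q-prime q≤n = ≮⇒≥ λ x<q → ∄ (fromℕ< (s≤s q≤n) , subst (x <_) (sym (Fin.toℕ-fromℕ< (s≤s q≤n))) x<q , subst Prime (sym (Fin.toℕ-fromℕ< (s≤s q≤n))) q-prime)
    absurd : (∃ λ s → s ^ 2 ≤ n × n < suc s ^ 2) → ⊥
    absurd (s , s²≤n , n<[1+s]²) = <⇒≱ ([1+s]^k<2^s k s₀ 2k≤ base s (<⇒≤ s₀<s)) (^-cancelˡ-≤ s {{>-nonZero 1≤s}} (begin
      (2 ^ s) ^ s                        ≡⟨ ^-*-assoc 2 s s ⟩
      2 ^ (s * s)                        ≤⟨ ^-monoʳ-≤ 2 (≤-trans (≤-reflexive (cong (s *_) (sym (*-identityʳ s)))) s²≤n) ⟩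
      2 * 2 ^ (10 * x)                   ≡⟨ cong (λ z → 2 * 2 ^ z) (*-comm 10 x) ⟩
      2 * 2 ^ (x * 10)                   ≡⟨ cong (2 *_) (^-*-assoc 2 x 10) ⟨
      2 * (2 ^ x) ^ 10                   ≤⟨ *-mono-≤ 2≤ (^-monoˡ-≤ 10 2^x≤) ⟩
      suc s ^ s * (suc s ^ (2 * s)) ^ 10 ≡⟨ cong (suc s ^ s *_) (^-*-assoc (suc s) (2 * s) 10) ⟩
      suc s ^ s * suc s ^ (2 * s * 10)   ≡⟨ ^-distribˡ-+-* (suc s) s (2 * s * 10) ⟨
      suc s ^ (s + 2 * s * 10)           ≡⟨ cong (suc s ^_) (arith s) ⟩
      suc s ^ (21 * s)                   ≤⟨ ^-monoʳ-≤ (suc s) (*-monoˡ-≤ s 21≤k) ⟩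
      suc s ^ (k * s)                    ≡⟨ ^-*-assoc (suc s) k s ⟨
      (suc s ^ k) ^ s                    ∎))
      where
      arith : ∀ s → s + 2 * s * 10 ≡ 21 * s
      arith = solve-∀
      s₀<s : s₀ < s
      s₀<s = ≰⇒> λ s≤s₀ → <⇒≱ n<[1+s]² (≤-trans (^-monoˡ-≤ 2 (s≤s s≤s₀)) (≤-trans x-large (m≤n⇒m≤1+n (m≤n*m x 10))))
      1≤s : 1 ≤ s
      1≤s = ≤-trans (s≤s z≤n) s₀<s
      2≤ : 2 ≤ suc s ^ s
      2≤ = ≤-trans (s≤s 1≤s) (≤-trans (≤-reflexive (sym (*-identityʳ (suc s)))) (^-monoʳ-≤ (suc s) 1≤s))
      m = 5 * x
      D = primorial x * topPowers s n
      D>0 : 0 < D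
      D>0 = *-mono-≤ (primorial-mono {0} {x} z≤n) (topPowers>0 s n)
      n≡ : m + m ≡ 10 * x
      n≡ = arith′ x
        where
        arith′ : ∀ x → 5 * x + 5 * x ≡ 10 * x
        arith′ = solve-∀
      32^x≤D : 2 ^ m ≤ D
      32^x≤D = begin
        2 ^ m                          ≤⟨ 2^m≤[2m]Cm m ⟩
        (m + m) C m                    ≤⟨ m≤n*m _ (suc (m + m)) ⟩
        suc (m + m) * ((m + m) C m)    ≤⟨ ∣⇒≤ {{>-nonZero D>0}} ([1+n]*nCk∣D D (m + m) m (m≤m+n m m) λ j j≤2m →
                                            ∣primorial*topPowers x n s n<[1+s]² gap (suc j) (s≤s z≤n) (s≤s (subst (j ≤_) n≡ j≤2m))) ⟩
        D                              ∎
      2^x≤ : 2 ^ x ≤ suc s ^ (2 * s)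
      2^x≤ = *-cancelˡ-≤ (16 ^ x) {{m^n≢0 16 x}} (begin
        16 ^ x * 2 ^ x                 ≡⟨ ^-distribʳ-* 16 2 x ⟨
        32 ^ x                         ≡⟨ ^-*-assoc 2 5 x ⟩
        2 ^ m                          ≤⟨ 32^x≤D ⟩
        D                              ≤⟨ *-mono-≤ (primorial≤16^n x) (topPowers≤n^s s n (s≤s z≤n)) ⟩
        16 ^ x * n ^ s                 ≤⟨ *-monoʳ-≤ (16 ^ x) (^-monoˡ-≤ s (<⇒≤ n<[1+s]²)) ⟩
        16 ^ x * (suc s ^ 2) ^ s       ≡⟨ cong (16 ^ x *_) (^-*-assoc (suc s) 2 s) ⟩
        16 ^ x * suc s ^ (2 * s)       ∎)

  bertrand : ∃ λ x₀ → ∀ x → x₀ ≤ x → ∃ λ q → Prime q × x < q × q ≤ suc (10 * x)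
  -- The base case 161^21 < 2^160 holds by evaluation.
  bertrand = _ , bertrand-above 21 160 ≤-refl (≤ᵇ⇒≤ 42 162 _) (<ᵇ⇒< (161 ^ 21) (2 ^ 160) _)

open PrimeGaps using (integerRoot; bertrand)

-- Blow-ups

∑-initial-mono : ∀ {a b} → a ≤ b → (F : ℕ → ℕ) → ∑ {a} (F ∘ toℕ) ≤ ∑ {b} (F ∘ toℕ)
∑-initial-mono {a} {b} a≤b F = ≤-trans (≤-reflexive (sym (∑-< a b F a≤b)))
  (∑-mono {b} λ t → ≤-trans (*-monoˡ-≤ (F (toℕ t)) (χ≤1 (toℕ t <? a))) (≤-reflexive (*-identityˡ _)))

module Periodic (N : ℕ) .{{_ : NonZero N}} (h : Fin N → ℕ) where

  wrap : ℕ → ℕ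
  wrap t = h (t mod N)

  mod-toℕ : ∀ (i : Fin N) k → (toℕ i + k * N) mod N ≡ i
  mod-toℕ i k = Fin.toℕ-injective (trans (Fin.toℕ-fromℕ< _) (trans ([m+kn]%n≡m%n (toℕ i) k N) (m<n⇒m%n≡m (Fin.toℕ<n i))))

  ∑-periods : ∀ K → ∑ {K * N} (wrap ∘ toℕ) ≡ K * ∑ h
  ∑-periods K = trans (∑-combine K {N} (wrap ∘ toℕ)) (trans
    (∑-cong {K} λ a → ∑-cong λ b → cong h (trans
      (cong (_mod N) (trans (Fin.toℕ-combine a b) (trans (+-comm (N * toℕ a) (toℕ b)) (cong (toℕ b +_) (*-comm N (toℕ a))))))
      (mod-toℕ b (toℕ a))))
    (∑-const K (∑ h)))

  ∑≤∑-wrap : ∀ {n} → N ≤ n → ∑ h ≤ ∑ {n} (wrap ∘ toℕ)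
  ∑≤∑-wrap {n} N≤n = ≤-trans (≤-reflexive (trans (sym (*-identityˡ (∑ h))) (sym (∑-periods 1))))
    (∑-initial-mono (≤-trans (≤-reflexive (*-identityˡ N)) N≤n) wrap)

  ∑-wrap≤ : ∀ {n} K → n ≤ K * N → ∑ {n} (wrap ∘ toℕ) ≤ K * ∑ h
  ∑-wrap≤ K n≤KN = ≤-trans (∑-initial-mono n≤KN wrap) (≤-reflexive (∑-periods K))

-- Index i is a copy of i mod N, which gives every vertex between 1 and K copies for any n from N to
-- KN.
module BlowUp {N : ℕ} .{{_ : NonZero N}} (G : Graph N) (n K : ℕ) (N≤n : N ≤ n) (n≤KN : n ≤ K * N) where

  φ : Fin n → Fin N
  φ i = toℕ i mod N

  blowUp : Graph n
  blowUp = record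
    { adj    = λ i j → adj G (φ i) (φ j)
    ; sym    = λ i j → adj-sym G (φ i) (φ j)
    ; irrefl = λ i → irrefl G (φ i) }

  blowUp-triangle-free : TriangleFree G → TriangleFree blowUp
  blowUp-triangle-free tf u v w = tf (φ u) (φ v) (φ w)

  deg≤ : ∀ i → ∑deg G (φ i) ≤ ∑deg blowUp i
  deg≤ i = Periodic.∑≤∑-wrap N (λ v → b2n (adj G (φ i) v)) N≤n

  ≤deg : ∀ i → ∑deg blowUp i ≤ K * ∑deg G (φ i)
  ≤deg i = Periodic.∑-wrap≤ N (λ v → b2n (adj G (φ i) v)) K n≤KN

  module Project (f : Fin n → Part) (stable : Stable₁ blowUp f) where

    Contains : (Part → Bool) → Fin N → Set
    Contains P u = ∃ λ i → φ i ≡ u × P (f i) ≡ true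

    contains? : ∀ P u → Dec (Contains P u)
    contains? P u = Fin.any? λ i → (φ i Fin.≟ u) ×-dec (P (f i) Bool.≟ true)

    choose : ∀ {P Q : Set} → Dec P → Dec Q → Part
    choose (yes _) _       = one
    choose (no _)  (yes _) = two
    choose (no _)  (no _)  = out

    -- A vertex with a copy in V₁ goes to V₁ even if other copies lie in V₂. No edge is lost: copies
    -- of adjacent vertices are adjacent, so a neighbour of such a vertex has no copy in V₁.
    g : Fin N → Part
    g u = choose (contains? isOne u) (contains? isTwo u)

    g-one : ∀ u → g u ≡ one → Contains isOne u
    g-one u = go (contains? isOne u) (contains? isTwo u)
      where
      go : ∀ {P Q : Set} (d : Dec P) (e : Dec Q) → choose d e ≡ one → P
      go (yes q) _       _  = q
      go (no _)  (yes _) ()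
      go (no _)  (no _)  ()

    one-g : ∀ {u} → Contains isOne u → g u ≡ one
    one-g {u} = go (contains? isOne u) (contains? isTwo u)
      where
      go : ∀ {P Q : Set} (d : Dec P) (e : Dec Q) → P → choose d e ≡ one
      go (yes _) _ _ = refl
      go (no ¬q) _ q = contradiction q ¬q

    two-g : ∀ {u} → Contains isTwo u → g u ≢ one → g u ≡ two
    two-g {u} = go (contains? isOne u) (contains? isTwo u)
      where
      go : ∀ {P Q : Set} (d : Dec P) (e : Dec Q) → Q → choose d e ≢ one → choose d e ≡ two
      go (yes _) _       _ ≢one = contradiction refl ≢one
      go (no _)  (yes _) _ _    = refl
      go (no _)  (no ¬q) q _    = contradiction q ¬q

    isOne⇒ : ∀ {a} → isOne a ≡ true → a ≡ one
    isOne⇒ {one} _ = refl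

    stable-g : Stable₁ G g
    stable-g u v a gu gv with g-one u gu | g-one v gv
    ... | i , refl , fi | j , refl , fj = stable i j a (isOne⇒ fi) (isOne⇒ fj)

    size≤ : ∑size g ≤ ∑size f
    size≤ = begin
      ∑size g                                                       ≤⟨ ∑-mono (λ u → covered u (contains? isOne u) (contains? isTwo u)) ⟩
      ∑ (λ u → ∑ (λ i → χ (φ i Fin.≟ u) * b2n (inV' (f i))))        ≡⟨ ∑-swap (λ u i → χ (φ i Fin.≟ u) * b2n (inV' (f i))) ⟩
      ∑ (λ i → ∑ (λ u → χ (φ i Fin.≟ u) * b2n (inV' (f i))))        ≡⟨ ∑-cong (λ i → ∑-δ′ (φ i) (const (b2n (inV' (f i))))) ⟩
      ∑size f                                                       ∎
      where
      open ≤-Reasoning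
      member : ∀ u i → φ i ≡ u → inV' (f i) ≡ true → 1 ≤ ∑ (λ i → χ (φ i Fin.≟ u) * b2n (inV' (f i)))
      member u i e q = ≤-trans (≤-reflexive (sym (cong₂ _*_ (χ-yes (φ i Fin.≟ u) e) (cong b2n q)))) (term≤∑ (λ i → χ (φ i Fin.≟ u) * b2n (inV' (f i))) i)
      one⇒in : ∀ {a} → isOne a ≡ true → inV' a ≡ true
      one⇒in {one} _ = refl
      two⇒in : ∀ {a} → isTwo a ≡ true → inV' a ≡ true
      two⇒in {two} _ = refl
      covered : ∀ u (d : Dec (Contains isOne u)) (e : Dec (Contains isTwo u)) →
                b2n (inV' (choose d e)) ≤ ∑ (λ i → χ (φ i Fin.≟ u) * b2n (inV' (f i)))
      covered u (yes (i , e , q)) _                 = member u i e (one⇒in q)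
      covered u (no _)            (yes (i , e , q)) = member u i e (two⇒in q)
      covered u (no _)            (no _)            = z≤n

    -- A base edge has at most K copies of each end. Together with `size≤`, projecting costs the
    -- average degree at most a factor K².
    cross≤ : ∑cross blowUp f ≤ K * (K * ∑cross G g)
    cross≤ = begin
      ∑cross blowUp f                                  ≤⟨ ∑-mono (λ i → ∑-mono λ j → term i j (isOne (f i)) (isTwo (f j)) (adj G (φ i) (φ j)) refl refl refl) ⟩
      ∑ (λ i → ∑ (λ j → edge (φ i) (φ j)))             ≤⟨ ∑-mono (λ i → Periodic.∑-wrap≤ N (edge (φ i)) K n≤KN) ⟩
      ∑ (λ i → K * ∑ (λ v → edge (φ i) v))             ≡⟨ ∑-*ˡ K _ ⟩
      K * ∑ (λ i → ∑ (λ v → edge (φ i) v))             ≤⟨ *-monoʳ-≤ K (Periodic.∑-wrap≤ N (λ u → ∑ (edge u)) K n≤KN) ⟩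
      K * (K * ∑cross G g)                             ∎
      where
      open ≤-Reasoning
      edge : Fin N → Fin N → ℕ
      edge u v = b2n (isOne (g u) ∧ (isTwo (g v) ∧ adj G u v))
      term : ∀ i j x y z → isOne (f i) ≡ x → isTwo (f j) ≡ y → adj G (φ i) (φ j) ≡ z → b2n (x ∧ (y ∧ z)) ≤ edge (φ i) (φ j)
      term i j true true true ei ej ea = ≤-reflexive (sym (cong b2n (cong₂ _∧_ (cong isOne gi) (cong₂ _∧_ (cong isTwo gj) ea))))
        where
        gi : g (φ i) ≡ one
        gi = one-g (i , refl , ei)
        gj : g (φ j) ≡ two
        gj = two-g (j , refl , ej) (stable-g (φ i) (φ j) ea gi)
      term i j true true  false _ _ _ = z≤n
      term i j true false _     _ _ _ = z≤n
      term i j false _    _     _ _ _ = z≤n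

-- From bounds in ℕ to the rational statement

fraction-pos : ∀ a d → 0ℚ ℚ.< (ℤ.+ suc a) ℚ./ suc d
fraction-pos a d = ℚP.≰⇒> λ le → contradiction (fraction-≤⁻¹ (suc a) d 0 0 le) λ ()

cube-ℕtoℚ : ∀ a → cube (ℕtoℚ a) ≡ ℕtoℚ (a * a * a)
cube-ℕtoℚ a = sym (trans (ℕtoℚ-* (a * a) a) (cong (ℚ._* ℕtoℚ a) (ℕtoℚ-* a a)))

lower-cube-root : ∀ k n d → n ≤ (suc k * d) * (suc k * d) * (suc k * d) → LowerCubeRoot (recip k) n d
lower-cube-root k n d le = ℚP.≤-trans
  (ℚP.*-monoˡ-≤-nonNeg (cube (recip k)) {{ℚ.nonNegative (*-nonneg (*-nonneg (0≤recip k) (0≤recip k)) (0≤recip k))}} (ℕtoℚ-mono le))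
  (ℚP.≤-reflexive (trans (cong (cube (recip k) ℚ.*_) (trans (sym (cube-ℕtoℚ (suc k * d))) (cong cube (ℕtoℚ-* (suc k) d))))
    (trans (solve 3 (λ r s d → r :* r :* r :* (s :* d :* (s :* d) :* (s :* d)) := s :* r :* (s :* r) :* (s :* r) :* (d :* d :* d)) refl (recip k) (ℕtoℚ (suc k)) (ℕtoℚ d))
      (trans (cong (λ z → z ℚ.* z ℚ.* z ℚ.* cube (ℕtoℚ d)) (recip-inverse k)) (ℚP.*-identityˡ _)))))
  where open +-*-Solver

upper-cube-root : ∀ c n d → d * d * d ≤ c * c * c * n → UpperCubeRoot (ℕtoℚ c) n d
upper-cube-root c n d le = subst₂ ℚ._≤_ (sym (cube-ℕtoℚ d)) (trans (ℕtoℚ-* (c * c * c) n) (cong (ℚ._* ℕtoℚ n) (sym (cube-ℕtoℚ c)))) (ℕtoℚ-mono le)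

divPos-cancel : ∀ a C (C>0 : C > 0ℚ) → divPos a C C>0 ℚ.* C ≡ a
divPos-cancel a C C>0 = trans (ℚP.*-assoc a _ C) (trans (cong (a ℚ.*_) (ℚP.*-inverseˡ C {{ℚP.pos⇒nonZero C {{ℚ.positive C>0}}}})) (ℚP.*-identityʳ a))

divPos-≤ : ∀ a C (C>0 : C > 0ℚ) y → a ℚ.≤ y ℚ.* C → divPos a C C>0 ℚ.≤ y
divPos-≤ a C C>0 y le = ℚP.*-cancelʳ-≤-pos C {{ℚ.positive C>0}} (subst (ℚ._≤ y ℚ.* C) (sym (divPos-cancel a C C>0)) le)

0≤divPos : ∀ a C (C>0 : C > 0ℚ) → 0ℚ ℚ.≤ a → 0ℚ ℚ.≤ divPos a C C>0
0≤divPos a C C>0 le = ℚP.*-cancelʳ-≤-pos C {{ℚ.positive C>0}} (subst₂ ℚ._≤_ (sym (ℚP.*-zeroˡ C)) (sym (divPos-cancel a C C>0)) le)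

-- With C = 4B the average degree a = 2e/(m + 1) satisfies a/C ≤ j/2, so all partial sums of
-- exp(a/C) are at most 2^j. The choice ε = 1 in `GeCLog` then bounds n.
ge-log-bound : ∀ B (C>0 : ℕtoℚ (4 * B) > 0ℚ) e m j n → e ≤ B * (j * suc m) → GeCLog (ℕtoℚ (4 * B)) C>0 (avgDeg e m) n → n ≤ 2 ^ j + 1
ge-log-bound B C>0 e m j n le ge with ge ℚ.1ℚ (fraction-pos 0 0)
... | k , n≤ = ℕtoℚ-cancel (begin
  ℕtoℚ n                                    ≤⟨ n≤ ⟩
  expPartial x k ℚ.+ ℚ.1ℚ                     ≤⟨ ℚP.+-monoˡ-≤ ℚ.1ℚ (ℚP.≤-trans (expPartial-mono 0≤x x≤ k) (expPartial-halves j k)) ⟩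
  ℕtoℚ (2 ^ j) ℚ.+ ℕtoℚ 1                   ≡⟨ ℕtoℚ-+ (2 ^ j) 1 ⟨
  ℕtoℚ (2 ^ j + 1)                          ∎)
  where
  open ℚP.≤-Reasoning
  a = avgDeg e m
  C = ℕtoℚ (4 * B)
  x = divPos a C C>0
  0≤x : 0ℚ ℚ.≤ x
  0≤x = 0≤divPos a C C>0 (fraction-≤ 0 0 (2 * e) m z≤n)
  x≤ : x ℚ.≤ halves j
  x≤ = divPos-≤ a C C>0 (halves j) (begin
    a                                        ≤⟨ fraction-≤ (2 * e) m (j * (2 * B)) 0 (≤-trans (≤-reflexive (arith₁ e)) (≤-trans (*-monoʳ-≤ 2 le) (≤-reflexive (arith₂ B j (suc m))))) ⟩
    ℕtoℚ (j * (2 * B))                       ≡⟨ ℕtoℚ-* j (2 * B) ⟩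
    ℕtoℚ j ℚ.* ℕtoℚ (2 * B)                  ≡⟨ cong (ℚ._* ℕtoℚ (2 * B)) (sym (halves-double j)) ⟩
    halves j ℚ.* ℕtoℚ 2 ℚ.* ℕtoℚ (2 * B)     ≡⟨ ℚP.*-assoc (halves j) (ℕtoℚ 2) (ℕtoℚ (2 * B)) ⟩
    halves j ℚ.* (ℕtoℚ 2 ℚ.* ℕtoℚ (2 * B))   ≡⟨ cong (halves j ℚ.*_) (trans (sym (ℕtoℚ-* 2 (2 * B))) (cong ℕtoℚ (arith₃ B))) ⟩
    halves j ℚ.* C                           ∎)
    where
    arith₁ : ∀ e → 2 * e * 1 ≡ 2 * e
    arith₁ = solve-∀
    arith₂ : ∀ B j m → 2 * (B * (j * m)) ≡ j * (2 * B) * m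
    arith₂ = solve-∀
    arith₃ : ∀ B → 2 * (2 * B) ≡ 4 * B
    arith₃ = solve-∀

-- Integer logarithms and a prime of the order of n^(1/3)

logFloor : ∀ b → 1 < b → ∀ n → 0 < n → ∃ λ j → b ^ j ≤ n × n < b ^ suc j
logFloor b 1<b (suc zero)      _ = 0 , ≤-refl , ≤-trans 1<b (≤-reflexive (sym (*-identityʳ b)))
logFloor b 1<b (suc n@(suc _)) _ with logFloor b 1<b n (s≤s z≤n)
... | j , b^j≤n , n<b^1+j with b ^ suc j ≤? suc n
... | yes le = suc j , le , ≤-<-trans n<b^1+j (^-monoʳ-< b 1<b (n<1+n (suc j)))
... | no ≰   = j , m≤n⇒m≤1+n b^j≤n , ≰⇒> ≰

4p³≤2^p : ∀ p → 16 ≤ p → 4 * (p * (p * p)) ≤ 2 ^ p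
4p³≤2^p p 16≤p = subst (λ z → 4 * (z * (z * z)) ≤ 2 ^ z) (m∸n+n≡m 16≤p) (go (p ∸ 16))
  where
  open ≤-Reasoning
  cube≡ : ∀ z → z * (z * z) ≡ z ^ 3
  cube≡ z = cong (λ w → z * (z * w)) (sym (*-identityʳ z))
  go : ∀ d → 4 * ((d + 16) * ((d + 16) * (d + 16))) ≤ 2 ^ (d + 16)
  go zero    = ≤ᵇ⇒≤ _ _ _
  go (suc d) = begin
    4 * (suc q * (suc q * suc q))      ≡⟨ cong (4 *_) (cube≡ (suc q)) ⟩
    4 * suc q ^ 3                      ≤⟨ *-monoʳ-≤ 4 ([1+m]^k≤2*m^k q 3 (≤-trans (≤ᵇ⇒≤ 6 17 _) (s≤s (m≤n+m 16 d)))) ⟩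
    4 * (q ^ 3 * 2)                    ≡⟨ cong (λ w → 4 * (w * 2)) (sym (cube≡ q)) ⟩
    4 * (q * (q * q) * 2)              ≡⟨ arith (q * (q * q)) ⟩
    2 * (4 * (q * (q * q)))            ≤⟨ *-monoʳ-≤ 2 (go d) ⟩
    2 ^ suc q                          ∎
    where
    q = d + 16
    arith : ∀ x → 4 * (x * 2) ≡ 2 * (4 * x)
    arith = solve-∀

module CubeRoot (c x₀ : ℕ) .{{_ : NonZero c}} (next-prime : ∀ x → x₀ ≤ x → ∃ λ q → Prime q × x < q × q ≤ c * x) where
  open ≤-Reasoning

  y₀ : ℕ
  y₀ = x₀ ⊔ 16

  cube≡ : ∀ z → z ^ 3 ≡ z * (z * z)
  cube≡ z = cong (λ w → z * (z * w)) (*-identityʳ z)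

  module _ (n r : ℕ) (N₀≤n : (c * y₀) ^ 3 ≤ n) (r³≤n : r ^ 3 ≤ n) (n<[1+r]³ : n < suc r ^ 3) where

    -- With r the integer cube root of n, a prime in (r/c, c(r/c)] is at most r, so p³ ≤ n, and r +
    -- 1 ≤ cp, so n ≤ (cp)³.
    x : ℕ
    x = r / c

    cy₀≤r : c * y₀ ≤ r
    cy₀≤r = ≮⇒≥ λ r<cy₀ → <⇒≱ n<[1+r]³ (≤-trans (^-monoˡ-≤ 3 r<cy₀) N₀≤n)

    y₀≤x : y₀ ≤ x
    y₀≤x = ≤-trans (≤-reflexive (sym (trans (cong (_/ c) (*-comm c y₀)) (m*n/n≡m y₀ c)))) (/-monoˡ-≤ c cy₀≤r)

    module _ (p : ℕ) (x<p : x < p) (p≤cx : p ≤ c * x) where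

      16≤p : 16 ≤ p
      16≤p = ≤-trans (m≤n⊔m x₀ 16) (≤-trans y₀≤x (<⇒≤ x<p))

      p≤r : p ≤ r
      p≤r = ≤-trans p≤cx (≤-trans (≤-reflexive (*-comm c x)) (m/n*n≤m r c))

      p³≤n : p * (p * p) ≤ n
      p³≤n = ≤-trans (*-mono-≤ p≤r (*-mono-≤ p≤r p≤r)) (≤-trans (≤-reflexive (sym (cube≡ r))) r³≤n)

      1+r≤cp : suc r ≤ c * p
      1+r≤cp = begin
        suc r                   ≡⟨ cong suc (m≡m%n+[m/n]*n r c) ⟩
        suc (r % c + x * c)     ≤⟨ +-monoˡ-≤ (x * c) (m%n<n r c) ⟩
        suc x * c               ≤⟨ *-monoˡ-≤ c x<p ⟩
        p * c                   ≡⟨ *-comm p c ⟩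
        c * p                   ∎

      n≤c³p³ : n ≤ c * c * c * (p * (p * p))
      n≤c³p³ = begin
        n                            ≤⟨ <⇒≤ n<[1+r]³ ⟩
        suc r ^ 3                    ≤⟨ ^-monoˡ-≤ 3 1+r≤cp ⟩
        (c * p) ^ 3                  ≡⟨ cube≡ (c * p) ⟩
        c * p * (c * p * (c * p))    ≡⟨ arith c p ⟩
        c * c * c * (p * (p * p))    ∎
        where
        arith : ∀ c p → c * p * (c * p * (c * p)) ≡ c * c * c * (p * (p * p))
        arith = solve-∀

  cube-root-prime : ∀ n → (c * y₀) ^ 3 ≤ n → ∃ λ p → Prime p × 16 ≤ p × p * (p * p) ≤ n × n ≤ c * c * c * (p * (p * p))
  cube-root-prime n N₀≤n =
    let r , r³≤n , n<[1+r]³ = integerRoot 3 n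
        p , p-prime , x<p , p≤cx = next-prime (r / c) (≤-trans (m≤m⊔n x₀ 16) (y₀≤x n r N₀≤n r³≤n n<[1+r]³))
    in p , p-prime , 16≤p n r N₀≤n r³≤n n<[1+r]³ p x<p p≤cx , p³≤n n r N₀≤n r³≤n n<[1+r]³ p x<p p≤cx , n≤c³p³ n r N₀≤n r³≤n n<[1+r]³ p x<p p≤cx

-- Opaque, so that the constant c is never unfolded into a numeral.
opaque
  bertrand′ : ∃ λ c → NonZero c × ∃ λ x₀ → ∀ x → x₀ ≤ x → ∃ λ q → Prime q × x < q × q ≤ c * x
  bertrand′ = 11 , _ , suc (proj₁ bertrand) , λ x x₀<x →
    let q , q-prime , x<q , q≤ = proj₂ bertrand x (<⇒≤ x₀<x)
    in q , q-prime , x<q , ≤-trans q≤ (+-monoˡ-≤ (10 * x) (≤-trans (s≤s z≤n) x₀<x))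

private
  ratio : ℕ
  ratio = proj₁ bertrand′

  instance
    ratio≢0 : NonZero ratio
    ratio≢0 = proj₁ (proj₂ bertrand′)

blowUpFactor : ℕ
blowUpFactor = ratio * ratio * ratio

instance
  blowUpFactor≢0 : NonZero blowUpFactor
  blowUpFactor≢0 = m*n≢0 (ratio * ratio) ratio {{m*n≢0 ratio ratio}}

cube-root-prime : ∃ λ N₀ → ∀ n → N₀ ≤ n → ∃ λ p → Prime p × 16 ≤ p × p * (p * p) ≤ n × n ≤ blowUpFactor * (p * (p * p))
cube-root-prime = _ , CubeRoot.cube-root-prime ratio _ (proj₂ (proj₂ (proj₂ bertrand′)))

-- The blown-up graph and its constants

module Assembly (n p j : ℕ) (p-prime : Prime p) (16≤p : 16 ≤ p)
                (p³≤n : p * (p * p) ≤ n) (n≤Kp³ : n ≤ blowUpFactor * (p * (p * p)))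
                (1≤j : 1 ≤ j) (16^j≤n : 16 ^ j ≤ n) (n<16^1+j : n < 16 ^ suc j) where

  open PrimeField p p-prime using (space; p≢0)

  K N L B : ℕ
  K = blowUpFactor
  N = p * (p * p)
  -- N ≤ n < 16^(j+1) = 2^(4(j+1)).
  L = 4 * suc j
  -- 17L + 80 = 68j + 148, and the additive 6 of `sparse` makes 68j + 154 ≤ 222j; K² is the loss in
  -- the blow-up.
  B = K * K * 222

  instance
    N≢0 : NonZero N
    N≢0 = m*n≢0 p (p * p) {{p≢0}} {{m*n≢0 p p {{p≢0}} {{p≢0}}}}

  N≤2^L : N ≤ 2 ^ L
  N≤2^L = ≤-trans p³≤n (≤-trans (<⇒≤ n<16^1+j) (≤-reflexive (^-*-assoc 2 4 (suc j))))

  open Base space L N≤2^L (4p³≤2^p p 16≤p) using (Good; good)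

  G₀ : Graph N
  G₀ = proj₁ good

  open Good (proj₂ good)
  open BlowUp G₀ n K p³≤n n≤Kp³

  G : Graph n
  G = blowUp

  triangle-free : TriangleFree G
  triangle-free = blowUp-triangle-free no-triangles

  degree≡ : ∀ v → degree G v ≡ ∑deg G v
  degree≡ v = sum-allFin (λ w → b2n (adj G v w))

  -- With a = ⌊p/2⌋ the degree is at least a, and ⌈p/2⌉ ≤ a + 1 ≤ 2a.
  p≤3deg : ∀ v → p ≤ 3 * degree G v
  p≤3deg v = begin
    p                       ≡⟨ ⌊n/2⌋+⌈n/2⌉≡n p ⟨
    a + ⌈ p /2⌉             ≤⟨ +-monoʳ-≤ a ⌈⌉≤ ⟩
    a + (a + a)             ≡⟨ arith a ⟩
    3 * a                   ≤⟨ *-monoʳ-≤ 3 a≤deg ⟩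
    3 * degree G v          ∎
    where
    open ≤-Reasoning
    a = ⌊ p /2⌋
    arith : ∀ a → a + (a + a) ≡ 3 * a
    arith = solve-∀
    1≤a : 1 ≤ a
    1≤a = ⌊n/2⌋-mono (≤-trans (≤ᵇ⇒≤ 2 16 _) 16≤p)
    ⌈⌉≤ : ⌈ p /2⌉ ≤ a + a
    ⌈⌉≤ = ≤-trans (⌈n/2⌉≤1+⌊n/2⌋ p) (+-monoˡ-≤ a 1≤a)
      where
      ⌈n/2⌉≤1+⌊n/2⌋ : ∀ n → ⌈ n /2⌉ ≤ suc ⌊ n /2⌋
      ⌈n/2⌉≤1+⌊n/2⌋ zero          = z≤n
      ⌈n/2⌉≤1+⌊n/2⌋ (suc zero)    = ≤-refl
      ⌈n/2⌉≤1+⌊n/2⌋ (suc (suc n)) = s≤s (⌈n/2⌉≤1+⌊n/2⌋ n)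
    a≤deg : a ≤ degree G v
    a≤deg = +-cancelʳ-≤ ⌈ p /2⌉ _ _ (begin
      a + ⌈ p /2⌉                          ≡⟨ ⌊n/2⌋+⌈n/2⌉≡n p ⟩
      p                                    ≤⟨ degree-lower (φ v) ⟩
      ∑deg G₀ (φ v) + ⌈ p /2⌉              ≤⟨ +-monoˡ-≤ ⌈ p /2⌉ (≤-trans (deg≤ v) (≤-reflexive (sym (degree≡ v)))) ⟩
      degree G v + ⌈ p /2⌉                 ∎)

  deg≤9Kp : ∀ v → degree G v ≤ 9 * K * p
  deg≤9Kp v = begin
    degree G v              ≡⟨ degree≡ v ⟩
    ∑deg G v                ≤⟨ ≤deg v ⟩
    K * ∑deg G₀ (φ v)       ≤⟨ *-monoʳ-≤ K (<⇒≤ (degree-upper (φ v))) ⟩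
    K * (9 * p)             ≡⟨ arith K p ⟩
    9 * K * p               ∎
    where
    open ≤-Reasoning
    arith : ∀ K p → K * (9 * p) ≡ 9 * K * p
    arith = solve-∀

  n≤cube : ∀ v → n ≤ (3 * K * degree G v) * (3 * K * degree G v) * (3 * K * degree G v)
  n≤cube v = begin
    n                                    ≤⟨ n≤Kp³ ⟩
    K * (p * (p * p))                    ≤⟨ *-monoʳ-≤ K (*-mono-≤ (p≤3deg v) (*-mono-≤ (p≤3deg v) (p≤3deg v))) ⟩
    K * (3 * d * (3 * d * (3 * d)))      ≤⟨ *-monoˡ-≤ (3 * d * (3 * d * (3 * d))) (m≤m*n K (K * K) {{m*n≢0 K K}}) ⟩
    K * (K * K) * (3 * d * (3 * d * (3 * d)))  ≡⟨ arith K d ⟩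
    (3 * K * d) * (3 * K * d) * (3 * K * d)    ∎
    where
    open ≤-Reasoning
    d = degree G v
    arith : ∀ K d → K * (K * K) * (3 * d * (3 * d * (3 * d))) ≡ (3 * K * d) * (3 * K * d) * (3 * K * d)
    arith = solve-∀

  cube≤n : ∀ v → degree G v * degree G v * degree G v ≤ 9 * K * (9 * K) * (9 * K) * n
  cube≤n v = begin
    d * d * d                                        ≤⟨ *-mono-≤ (*-mono-≤ (deg≤9Kp v) (deg≤9Kp v)) (deg≤9Kp v) ⟩
    9 * K * p * (9 * K * p) * (9 * K * p)            ≡⟨ arith (9 * K) p ⟩
    9 * K * (9 * K) * (9 * K) * (p * (p * p))        ≤⟨ *-monoʳ-≤ (9 * K * (9 * K) * (9 * K)) p³≤n ⟩
    9 * K * (9 * K) * (9 * K) * n                    ∎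
    where
    open ≤-Reasoning
    d = degree G v
    arith : ∀ c p → c * p * (c * p) * (c * p) ≡ c * c * c * (p * (p * p))
    arith = solve-∀

  cross-bound : ∀ f m → Stable₁ G f → size f ≡ suc m → crossEdges G f ≤ B * (j * suc m)
  cross-bound f m stable size≡ = begin
    crossEdges G f                                        ≡⟨ trans (sum-allFin _) (∑-cong λ u → sum-allFin _) ⟩
    ∑cross G f                                            ≤⟨ cross≤ ⟩
    K * (K * ∑cross G₀ g)                                 ≤⟨ *-monoʳ-≤ K (*-monoʳ-≤ K (<⇒≤ (sparse g stable-g))) ⟩
    K * (K * ((17 * L + 80) * ∑size g + 6))               ≤⟨ *-monoʳ-≤ K (*-monoʳ-≤ K (+-monoˡ-≤ 6 (*-monoʳ-≤ (17 * L + 80) (≤-trans size≤ (≤-reflexive (trans (sym (sum-allFin _)) size≡)))))) ⟩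
    K * (K * ((17 * L + 80) * suc m + 6))                 ≤⟨ *-monoʳ-≤ K (*-monoʳ-≤ K (+-monoʳ-≤ ((17 * L + 80) * suc m) (m≤m*n 6 (suc m)))) ⟩
    K * (K * ((17 * L + 80) * suc m + 6 * suc m))         ≡⟨ arith₁ K 17 4 80 6 j (suc m) ⟩
    K * K * ((68 * j + 154) * suc m)                      ≤⟨ *-monoʳ-≤ (K * K) (*-monoˡ-≤ (suc m) (+-monoʳ-≤ (68 * j) (*-monoʳ-≤ 154 1≤j))) ⟩
    K * K * ((68 * j + 154 * j) * suc m)                  ≡⟨ arith₂ (K * K) 68 154 j (suc m) ⟩
    B * (j * suc m)                                       ∎
    where
    open ≤-Reasoning
    open Project f stable
    arith₁ : ∀ K a b c d j m → K * (K * ((a * (b * (1 + j)) + c) * m + d * m)) ≡ K * K * ((a * b * j + (a * b + c + d)) * m)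
    arith₁ = solve-∀
    arith₂ : ∀ K a b j m → K * ((a * j + b * j) * m) ≡ K * (a + b) * (j * m)
    arith₂ = solve-∀

  -- This contradicts the conclusion of `ge-log-bound`. The condition j ≥ 1 gives 2^j + 1 < 4^j, and
  -- taking logarithms to base 16 leaves room above.
  2^j+1<n : 2 ^ j + 1 < n
  2^j+1<n = begin-strict
    2 ^ j + 1            <⟨ +-monoʳ-< (2 ^ j) (≤-trans (≤-reflexive (sym (*-identityʳ 2))) (^-monoʳ-≤ 2 1≤j)) ⟩
    2 ^ j + 2 ^ j        ≡⟨ cong (2 ^ j +_) (sym (+-identityʳ (2 ^ j))) ⟩
    2 * 2 ^ j            ≤⟨ *-monoˡ-≤ (2 ^ j) (≤-trans (≤-reflexive (sym (*-identityʳ 2))) (^-monoʳ-≤ 2 1≤j)) ⟩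
    2 ^ j * 2 ^ j        ≡⟨ ^-distribʳ-* 2 2 j ⟨
    4 ^ j                ≤⟨ ^-monoˡ-≤ j (≤ᵇ⇒≤ 4 16 _) ⟩
    16 ^ j               ≤⟨ 16^j≤n ⟩
    n                    ∎
    where open ≤-Reasoning

  not-dense : (C>0 : ℕtoℚ (4 * B) > 0ℚ) → ¬ HasDenseSemiBip G (ℕtoℚ (4 * B)) C>0
  not-dense C>0 (f , m , stable , size≡ , ge) =
    <⇒≱ 2^j+1<n (ge-log-bound B C>0 (crossEdges G f) m j n (cross-bound f m stable size≡) ge)

ℕtoℚ-pos : ∀ k .{{_ : NonZero k}} → ℕtoℚ k > 0ℚ
ℕtoℚ-pos (suc k) = fraction-pos k 0

theorem3p9 : ∃ λ (C : ℚ) → Σ (C > 0ℚ) λ Cpos → ∃ λ (C' : ℚ) → ∃ λ (C'' : ℚ) →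
    C' > 0ℚ × C'' > 0ℚ × ∃ λ (N : ℕ) → ∀ (n : ℕ) → n ≥ N →
    ∃ λ (G : Graph n) → TriangleFree G
    × (∀ (v : Fin n) → LowerCubeRoot C' n (degree G v) × UpperCubeRoot C'' n (degree G v))
    × ¬ HasDenseSemiBip G C Cpos
-- C' = 1/(3K) and C'' = 9K come from p ≤ 3 deg and deg ≤ 9Kp with p³ ≤ n ≤ Kp³, where K ≤ K³ turns
-- K into a cube. The bound n ≥ 16 ensures j ≥ 1.
theorem3p9 = ℕtoℚ (4 * (K * K * 222)) , C>0 , recip (pred (3 * K)) , ℕtoℚ (9 * K) ,
    fraction-pos 0 (pred (3 * K)) , ℕtoℚ-pos (9 * K) {{m*n≢0 9 K}} , N₀ ⊔ 16 , large
  where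
  K = blowUpFactor
  N₀ = proj₁ cube-root-prime
  C>0 : ℕtoℚ (4 * (K * K * 222)) > 0ℚ
  C>0 = ℕtoℚ-pos (4 * (K * K * 222)) {{m*n≢0 4 (K * K * 222) {{_}} {{m*n≢0 (K * K) 222 {{m*n≢0 K K}}}}}}
  3K≡ : suc (pred (3 * K)) ≡ 3 * K
  3K≡ = suc-pred (3 * K) {{m*n≢0 3 K}}
  large : ∀ n → n ≥ N₀ ⊔ 16 → ∃ λ (G : Graph n) → TriangleFree G
    × (∀ (v : Fin n) → LowerCubeRoot (recip (pred (3 * K))) n (degree G v) × UpperCubeRoot (ℕtoℚ (9 * K)) n (degree G v))
    × ¬ HasDenseSemiBip G (ℕtoℚ (4 * (K * K * 222))) C>0
  large n n≥ = from (proj₂ cube-root-prime n (≤-trans (m≤m⊔n N₀ 16) n≥)) (logFloor 16 (s≤s (s≤s z≤n)) n (≤-trans (s≤s z≤n) 16≤n))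
    where
    16≤n : 16 ≤ n
    16≤n = ≤-trans (m≤n⊔m N₀ 16) n≥
    1≤log : ∀ j → n < 16 ^ suc j → 1 ≤ j
    1≤log zero    n<16 = contradiction n<16 (≤⇒≯ 16≤n)
    1≤log (suc j) _    = s≤s z≤n
    from : (∃ λ p → Prime p × 16 ≤ p × p * (p * p) ≤ n × n ≤ K * (p * (p * p))) → (∃ λ j → 16 ^ j ≤ n × n < 16 ^ suc j) →
      ∃ λ (G : Graph n) → TriangleFree G
      × (∀ (v : Fin n) → LowerCubeRoot (recip (pred (3 * K))) n (degree G v) × UpperCubeRoot (ℕtoℚ (9 * K)) n (degree G v))
      × ¬ HasDenseSemiBip G (ℕtoℚ (4 * (K * K * 222))) C>0
    from (p , p-prime , 16≤p , p³≤n , n≤Kp³) (j , 16^j≤n , n<16^1+j) = G ,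
      triangle-free ,
      (λ v → lower-cube-root (pred (3 * K)) n (degree G v) (subst (λ c → n ≤ (c * degree G v) * (c * degree G v) * (c * degree G v)) (sym 3K≡) (n≤cube v))
           , upper-cube-root (9 * K) n (degree G v) (cube≤n v)) ,
      not-dense C>0
      where
      open Assembly n p j p-prime 16≤p p³≤n n≤Kp³ (1≤log j n<16^1+j) 16^j≤n n<16^1+j hiding (K)
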